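{- Let $[\sigma]$ be a circular permutation avoiding $[1432]$. Then the pattern set $[1432,\sigma]$ is Wilf equivalent to a pattern set $[1432,\tau]$ where $[\tau]$ has one of the following forms: (1) $[G(w)]$ with $w = 0^a1^b0^c$, $a \geq c$; (2) $[G(w)]$ with $w$ an alternating binary word starting with $0$ having at least $4$ runs; (3) $[G(w)]$ with $w = B(n_1,n_2,\dots,n_k,1^r)$ having at least $4$ runs, $r \geq 0$, $n_1,n_k \neq 1$, and $(n_k,\dots,n_2,n_1) \leq_{\mathrm{lex}} (n_1,n_2,\dots,n_k)$; (4) $[IG(w)]$ with $w = 0^{n_1}1^{n_2}\cdots 1^{n_k}0^m$ not an alternating binary word, having at least $5$ runs, $m \geq 1$, and $(n_k,\dots,n_2,n_1) \leq_{\mathrm{lex}} (n_1,n_2,\dots,n_k)$.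
   Context: A circular permutation $[\pi]$ of size $n$ is the set of all $n$ rotations of a permutation $\pi$ of $[n]$. $[\sigma]$ contains $[\pi]$ if some rotation of $\sigma$ has a subsequence order-isomorphic to $\pi$; otherwise it avoids $[\pi]$. $\mathrm{Av}_n[\pi_1,\dots,\pi_m]$ is the set of circular permutations of size $n$ avoiding every $[\pi_i]$; two pattern sets are Wilf equivalent if their $\mathrm{Av}_n$ have equal cardinality for all $n\ge1$. A binary word is a finite sequence over $\{0,1\}$; a run is a maximal block of consecutive equal letters. For a composition $(n_1,n_2,\dots)$ (positive parts), $B(n_1,n_2,n_3,\dots)=0^{n_1}1^{n_2}0^{n_3}\cdots$, and $B(n_1,\dots,n_k,1^r)$ means $B(n_1,\dots,n_k,1,\dots,1)$ with $r$ extra parts equal to $1$. For a binary word $w=w_1\cdots w_n$ starting with $0$ with at least $3$ runs, $G(w)$ is the permutation of $[n]$ with exactly one descent such that, for each $i$, $w_i=0$ iff the value $n-i+1$ appears after the descent (so $G(w)$ ends with $n$); if $w$ starts with $0$ and has at most $2$ runs, $G(w)=12\cdots n$. $IG(w)$ is the inverse permutation of $G(w)$. $\leq_{\mathrm{lex}}$ is the lexicographic order on integer sequences. -}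

module Defs where

open import Data.Bool using (Bool; true; false; _∧_; _∨_; not; if_then_else_; T)
open import Data.Nat using (ℕ; zero; suc; _+_; _∸_; _≤_; _<_; _<ᵇ_; _≡ᵇ_)
open import Data.List using (List; []; _∷_; _++_; map; length; upTo; drop; take; filterᵇ; reverse; replicate; concatMap)
open import Data.Bool.ListAction using (all; any)
open import Data.List.Relation.Unary.All using (All)
open import Data.Maybe using (Maybe; just; nothing)
open import Data.Product using (Σ; _×_; ∃)
open import Data.Sum using (_⊎_)
open import Data.Empty using (⊥)
open import Data.Unit using (⊤)
open import Function.Bundles using (_⇔_)
open import Relation.Binary.PropositionalEquality using (_≡_; _≢_)

-- Permutations are lists of naturals; a permutation of size n is a
-- rearrangement of the values 0,1,...,n-1 (0-based values; the paper
-- uses 1..n, which is irrelevant for order-isomorphism).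

_!!_ : {A : Set} → List A → ℕ → Maybe A
[] !! _ = nothing
(x ∷ xs) !! zero = just x
(x ∷ xs) !! suc i = xs !! i

elemᵇ : ℕ → List ℕ → Bool
elemᵇ k xs = any (λ x → k ≡ᵇ x) xs

-- xs is a permutation of {0,...,length xs - 1}: every value < n occurs
-- and every entry is < n (with length n this is a bijection)
isPermᵇ : List ℕ → Bool
isPermᵇ xs = all (λ k → elemᵇ k xs) (upTo (length xs)) ∧ all (λ x → x <ᵇ length xs) xs

IsPerm : List ℕ → Set
IsPerm xs = T (isPermᵇ xs)

rotate : ℕ → List ℕ → List ℕ
rotate k xs = drop k xs ++ take k xs

rotations : List ℕ → List (List ℕ)
rotations xs = map (λ k → rotate k xs) (upTo (length xs))

subsequences : List ℕ → List (List ℕ)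
subsequences [] = [] ∷ []
subsequences (x ∷ xs) = map (x ∷_) (subsequences xs) ++ subsequences xs

_==ᵇ_ : Bool → Bool → Bool
true ==ᵇ b = b
false ==ᵇ b = not b

orderIsoᵇ : List ℕ → List ℕ → Bool
orderIsoᵇ [] [] = true
orderIsoᵇ [] (_ ∷ _) = false
orderIsoᵇ (_ ∷ _) [] = false
orderIsoᵇ (x ∷ xs) (y ∷ ys) =
  pairs x xs y ys ∧ orderIsoᵇ xs ys
  where
  pairs : ℕ → List ℕ → ℕ → List ℕ → Bool
  pairs x [] y [] = true
  pairs x (a ∷ as) y (b ∷ bs) =
    ((x <ᵇ a) ==ᵇ (y <ᵇ b)) ∧ ((a <ᵇ x) ==ᵇ (b <ᵇ y)) ∧ pairs x as y bs
  pairs x _ y _ = false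

containsᵇ : List ℕ → List ℕ → Bool
containsᵇ σ π = any (λ r → any (λ s → orderIsoᵇ s π) (subsequences r)) (rotations σ)

Contains : List ℕ → List ℕ → Set
Contains σ π = T (containsᵇ σ π)

Avoids : List ℕ → List ℕ → Set
Avoids σ π = T (not (containsᵇ σ π))

allLists : ℕ → ℕ → List (List ℕ)
allLists zero k = [] ∷ []
allLists (suc n) k = concatMap (λ x → map (x ∷_) (allLists n k)) (upTo k)

startsWith0ᵇ : List ℕ → Bool
startsWith0ᵇ [] = false
startsWith0ᵇ (x ∷ _) = x ≡ᵇ 0

-- |Av_n[π_1,...,π_m]|: each circular permutation of size n ≥ 1 has
-- exactly one rotation starting with its minimum value 0; we count the
-- circular permutations through these canonical representatives.
avCount : ℕ → List (List ℕ) → ℕ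
avCount n ps =
  length (filterᵇ (λ xs → isPermᵇ xs ∧ startsWith0ᵇ xs
                            ∧ all (λ p → not (containsᵇ xs p)) ps)
                  (allLists n n))

WilfEquiv : List (List ℕ) → List (List ℕ) → Set
WilfEquiv ps qs = (n : ℕ) → 1 ≤ n → avCount n ps ≡ avCount n qs

IsRotationOf : List ℕ → List ℕ → Set
IsRotationOf τ π = Σ ℕ λ k → k < length π × τ ≡ rotate k π

-- Binary words: false = 0, true = 1

Word : Set
Word = List Bool

runs : Word → ℕ
runs [] = 0
runs (x ∷ []) = 1
runs (x ∷ y ∷ r) = (if x ==ᵇ y then 0 else 1) + runs (y ∷ r)

StartsWith0 : Word → Set
StartsWith0 [] = ⊥
StartsWith0 (b ∷ _) = b ≡ false

Alternating : Word → Set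
Alternating [] = ⊤
Alternating (x ∷ []) = ⊤
Alternating (x ∷ y ∷ r) = x ≢ y × Alternating (y ∷ r)

Bfrom : Bool → List ℕ → Word
Bfrom b [] = []
Bfrom b (n ∷ ns) = replicate n b ++ Bfrom (not b) ns

B : List ℕ → Word
B = Bfrom false

Composition : List ℕ → Set
Composition ns = All (λ n → 1 ≤ n) ns

_≤lex_ : List ℕ → List ℕ → Set
[] ≤lex _ = ⊤
(x ∷ xs) ≤lex [] = ⊥
(x ∷ xs) ≤lex (y ∷ ys) = x < y ⊎ (x ≡ y × xs ≤lex ys)

descents : List ℕ → ℕ
descents [] = 0
descents (x ∷ []) = 0
descents (x ∷ y ∷ r) = (if y <ᵇ x then 1 else 0) + descents (y ∷ r)

DescentAt : List ℕ → ℕ → Set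
DescentAt π d = Σ ℕ λ x → Σ ℕ λ y → π !! d ≡ just x × π !! suc d ≡ just y × y < x

AppearsAfterDescent : List ℕ → ℕ → Set
AppearsAfterDescent π v =
  Σ ℕ λ d → Σ ℕ λ p → DescentAt π d × π !! p ≡ just v × d < p

-- IsG w π : π = G(w).  With 0-based positions j and 0-based values,
-- "w_i = 0 iff value n-i+1 appears after the descent" (1-based) reads
-- "w_j = 0 iff value n-1-j appears after the descent".
IsG : Word → List ℕ → Set
IsG w π =
  StartsWith0 w × IsPerm π × length π ≡ length w ×
  ( (runs w ≤ 2 × π ≡ upTo (length w))
  ⊎ (3 ≤ runs w × descents π ≡ 1 ×
     ((j : ℕ) → j < length w →
        (w !! j ≡ just false) ⇔ AppearsAfterDescent π (length w ∸ 1 ∸ j))))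

IsIG : Word → List ℕ → Set
IsIG w τ =
  Σ (List ℕ) λ π → IsG w π × IsPerm τ × length τ ≡ length π ×
    ((i v : ℕ) → π !! i ≡ just v → τ !! v ≡ just i)

last? : List ℕ → Maybe ℕ
last? [] = nothing
last? (x ∷ []) = just x
last? (x ∷ y ∷ r) = last? (y ∷ r)

head? : List ℕ → Maybe ℕ
head? [] = nothing
head? (x ∷ _) = just x

Form1 : List ℕ → Set
Form1 π = Σ ℕ λ a → Σ ℕ λ b → Σ ℕ λ c →
  c ≤ a × IsG (replicate a false ++ replicate b true ++ replicate c false) π

Form2 : List ℕ → Set
Form2 π = Σ Word λ w → Alternating w × StartsWith0 w × 4 ≤ runs w × IsG w π

Form3 : List ℕ → Set
Form3 π = Σ (List ℕ) λ ns → Σ ℕ λ r →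
  Composition ns × 1 ≤ length ns ×
  head? ns ≢ just 1 × last? ns ≢ just 1 ×
  reverse ns ≤lex ns ×
  4 ≤ runs (B (ns ++ replicate r 1)) ×
  IsG (B (ns ++ replicate r 1)) π

-- (4) [IG(w)], w = 0^{n_1} 1^{n_2} ... 1^{n_k} 0^m (so k even),
--     w not alternating, at least 5 runs, m ≥ 1,
--     (n_k,...,n_1) ≤lex (n_1,...,n_k)
Even : ℕ → Set
Even k = Σ ℕ λ h → k ≡ h + h

Form4 : List ℕ → Set
Form4 π = Σ (List ℕ) λ ns → Σ ℕ λ m →
  Composition ns × Even (length ns) × 1 ≤ m ×
  (Alternating (B (ns ++ m ∷ [])) → ⊥) ×
  5 ≤ runs (B (ns ++ m ∷ [])) ×
  reverse ns ≤lex ns ×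
  IsIG (B (ns ++ m ∷ [])) π

p1432 : List ℕ
p1432 = 0 ∷ 3 ∷ 2 ∷ 1 ∷ []

{-# OPTIONS --safe #-}
-- Rotate every circular permutation so that it starts with its minimum. Those avoiding [1432] are then exactly the
-- P v and Q u below (G(w) and IG(w) up to rotation), indexed by binary words starting with 0. A subpermutation of P v
-- (Q u) is P y (Q y) for a subword y, so containing a pattern becomes a subword condition: P v contains [P w] iff v
-- contains w or its complement, and Q u contains [Q x] iff u contains x with some part of its final block of 0s moved
-- to the front and complemented. Wilf equivalence thus reduces to counting words:
-- * the number of words containing a given word depends only on its length, which makes IG(w) equivalent to form
--   (2) if w ends in 1 or is alternating;
-- * the number of words containing w or its complement is unchanged when w is reversed and satisfies a recurrence
--   when a run of length 1 is put in front, so runs of length 1 can be moved from one end of w to the other, which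
--   yields form (3). A G(w) with four runs is also an IG, and is handled by a further count depending only on the
--   number of runs and the length;
-- * forms (1) and (4) need only the reverse-complement symmetry.
module Submission where

open import Defs
open import Data.Bool using (Bool; true; false; _∧_; _∨_; not; T; T?; if_then_else_)
open import Data.Bool.Properties using (T-∧; T-∨; not-involutive; T-≡; ∧-identityʳ; ∧-assoc)
open import Data.Empty using (⊥; ⊥-elim)
open import Data.List using (List; []; _∷_; _++_; map; length; upTo; drop; take; filterᵇ; reverse; replicate; concatMap; applyUpTo)
open import Data.List.Properties using (++-assoc; ++-identityʳ; map-++; length-map; length-++; map-∘; map-id; reverse-++; reverse-involutive; length-reverse; unfold-reverse; take++drop≡id; length-upTo; reverse-map; map-cong-local; ∷-injective; ∷-injectiveˡ; ∷-injectiveʳ; ∷ʳ-injectiveʳ; length-replicate; map-replicate)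
open import Data.List.Membership.Propositional using (_∈_; _∉_; find)
open import Data.List.Membership.Propositional.Properties using (∈-++⁺ˡ; ∈-++⁺ʳ; ∈-++⁻; ∈-map⁺; ∈-map⁻; ∈-∃++; ∈-upTo⁺; ∈-upTo⁻; ∈-filter⁺; ∈-filter⁻; ∈-concatMap⁺; ∈-concatMap⁻; ∈-insert)
open import Data.List.Relation.Unary.All as All using (All; []; _∷_)
open import Data.List.Relation.Unary.Any as Any using (Any; here; there)
import Data.List.Relation.Unary.All.Properties as Allₚ
import Data.List.Relation.Unary.Any.Properties as Anyₚ
open import Data.List.Relation.Unary.AllPairs as AllPairs using (AllPairs; []; _∷_)
open import Data.List.Relation.Unary.Unique.Propositional using (Unique)
import Data.List.Relation.Unary.Unique.Propositional.Properties as Uniqueₚ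
open import Data.List.Relation.Binary.Permutation.Propositional using (_↭_; ↭-refl; ↭-reflexive; ↭-sym; ↭-trans; prep; ↭⇒↭ₛ)
import Data.List.Relation.Binary.Permutation.Propositional.Properties as Perm
import Data.List.Relation.Binary.Permutation.Setoid.Properties as PermS
open import Data.List.Relation.Binary.Sublist.Propositional using (_⊆_; []; _∷_; _∷ʳ_; ⊆-trans; minimum)
import Data.List.Relation.Binary.Sublist.Propositional.Properties as Sub
open import Data.Maybe using (Maybe; just)
open import Data.Maybe.Properties using (just-injective)
open import Data.Nat using (ℕ; zero; suc; pred; _+_; _∸_; _≤_; _<_; _<ᵇ_; _≤ᵇ_; z≤n; s≤s; _≤?_; _≟_)
open import Data.Nat.Properties
open import Data.Nat.ListAction using (sum)
open import Data.Nat.ListAction.Properties using (sum-↭)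
open import Data.Product using (Σ; _×_; _,_; proj₁; proj₂; ∃-syntax; swap)
open import Data.Sum using (_⊎_; inj₁; inj₂; [_,_]′)
open import Data.Unit using (tt)
open import Function using (_∘_; id)
open import Function.Bundles using (mk⇔; Equivalence)
open import Relation.Binary.Definitions using (tri<; tri≈; tri>)
open import Relation.Binary.PropositionalEquality
open import Relation.Nullary using (¬_; yes; no; contradiction)

-- Permutations and circular containment

-- The obstacle is that neither parametrization is faithful and that the two overlap. All sorted
-- words `0^a 1^b` of one length give the identity, so `P` and `Q` are injective only where a
-- subword `10` is present; and `Q u` is itself a `P` when `u` starts with 0 and has at most four
-- runs. A canonical permutation is therefore charged to a `P` word when it has at most one descent,
-- and otherwise to a `Q` word with at least two factors `10`, which after an initial 0 means at
-- least five runs. This makes four runs the borderline: from five runs on, a `P` pattern occurs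
-- only in permutations `P v`, and a `Q` pattern only in permutations `Q u`. Permutations containing
-- σ are counted rather than those avoiding it, because containment is the subword condition; the
-- number of all canonical permutations does not involve σ, so either count determines the other.
-- The reversed complement enters because `G(w)` reads `w` against the values from the largest down.

T⇔⇒≡ : ∀ {a b} → (T a → T b) → (T b → T a) → a ≡ b
T⇔⇒≡ {false} {false} f g = refl
T⇔⇒≡ {false} {true} f g = ⊥-elim (g tt)
T⇔⇒≡ {true} {false} f g = ⊥-elim (f tt)
T⇔⇒≡ {true} {true} f g = refl

module _ {A : Set} where

  remove-⊆ : ∀ {x : A} {as} p {q} → x ∉ as → (∀ {y} → y ∈ x ∷ as → y ∈ p ++ x ∷ q) →
             ∀ {y} → y ∈ as → y ∈ p ++ q
  remove-⊆ {x} p x∉as sub {y} y∈as with ∈-++⁻ p (sub (there y∈as))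
  ... | inj₁ y∈p = ∈-++⁺ˡ y∈p
  ... | inj₂ (here refl) = contradiction y∈as x∉as
  ... | inj₂ (there y∈q) = ∈-++⁺ʳ p y∈q

  unique⊆⇒length≤ : ∀ {xs ys : List A} → Unique xs → (∀ {x} → x ∈ xs → x ∈ ys) → length xs ≤ length ys
  unique⊆⇒length≤ [] sub = z≤n
  unique⊆⇒length≤ {x ∷ xs} (x∉ ∷ u) sub with ∈-∃++ (sub (here refl))
  ... | p , q , refl =
    ≤-trans (s≤s (unique⊆⇒length≤ u (remove-⊆ p (λ x∈ → All.lookup x∉ x∈ refl) sub)))
            (≤-reflexive (sym (Perm.↭-length (Perm.shift x p q))))

  unique⊆∧length⇒↭ : ∀ {xs ys : List A} → Unique xs → (∀ {x} → x ∈ xs → x ∈ ys) →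
                     length ys ≡ length xs → xs ↭ ys
  unique⊆∧length⇒↭ {[]} {[]} _ _ _ = ↭-refl
  unique⊆∧length⇒↭ {x ∷ xs} (x∉ ∷ u) sub eq with ∈-∃++ (sub (here refl))
  ... | p , q , refl =
    ↭-trans (prep x (unique⊆∧length⇒↭ u (remove-⊆ p (λ x∈ → All.lookup x∉ x∈ refl) sub)
              (suc-injective (trans (sym (Perm.↭-length (Perm.shift x p q))) eq))))
            (↭-sym (Perm.shift x p q))

  unique-resp-↭ : ∀ {xs ys : List A} → xs ↭ ys → Unique xs → Unique ys
  unique-resp-↭ p = PermS.Unique-resp-↭ (setoid A) (↭⇒↭ₛ p)

  unique-⇔⇒length≡ : ∀ {xs ys : List A} → Unique xs → Unique ys →
    (∀ {x} → x ∈ xs → x ∈ ys) → (∀ {x} → x ∈ ys → x ∈ xs) → length xs ≡ length ys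
  unique-⇔⇒length≡ u v f g = ≤-antisym (unique⊆⇒length≤ u f) (unique⊆⇒length≤ v g)

  unique-map : ∀ {B : Set} {f : A → B} {xs} → (∀ {x y} → x ∈ xs → y ∈ xs → f x ≡ f y → x ≡ y) →
               Unique xs → Unique (map f xs)
  unique-map inj [] = []
  unique-map {xs = x ∷ xs} inj (x∉ ∷ u) =
    Allₚ.map⁺ (All.tabulate λ y∈ eq → All.lookup x∉ y∈ (inj (here refl) (there y∈) eq)) ∷
    unique-map (λ p q → inj (there p) (there q)) u

-- Stated with `↭` so that bounds, occurrence of every value, distinctness and invariance under
-- rotation all come from one relation.
Permutation : List ℕ → Set
Permutation xs = xs ↭ upTo (length xs)

bounded : ∀ {xs x} → Permutation xs → x ∈ xs → x < length xs
bounded p x∈ = ∈-upTo⁻ (Perm.∈-resp-↭ p x∈)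

covers : ∀ {xs k} → Permutation xs → k < length xs → k ∈ xs
covers p k< = Perm.∈-resp-↭ (↭-sym p) (∈-upTo⁺ k<)

unique : ∀ {xs} → Permutation xs → Unique xs
unique p = unique-resp-↭ (↭-sym p) (Uniqueₚ.upTo⁺ _)

Permutation-resp-↭ : ∀ {xs ys} → xs ↭ ys → Permutation xs → Permutation ys
Permutation-resp-↭ p q = ↭-trans (↭-sym p) (subst (λ n → _ ↭ upTo n) (Perm.↭-length p) q)

IsPerm⇒Permutation : ∀ xs → IsPerm xs → Permutation xs
IsPerm⇒Permutation xs p = ↭-sym (unique⊆∧length⇒↭ (Uniqueₚ.upTo⁺ _)
    (λ k∈ → Any.map (≡ᵇ⇒≡ _ _) (Anyₚ.any⁻ _ xs (All.lookup (Allₚ.all⁺ _ (upTo (length xs)) hyp) k∈)))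
    (sym (length-upTo _)))
  where hyp = proj₁ (Equivalence.to T-∧ p)

Permutation⇒IsPerm : ∀ xs → Permutation xs → IsPerm xs
Permutation⇒IsPerm xs p = Equivalence.from T-∧
  ( Allₚ.all⁻ _ (All.tabulate λ k∈ → Anyₚ.any⁺ _ (Any.map (≡⇒≡ᵇ _ _) (covers p (∈-upTo⁻ k∈))))
  , Allₚ.all⁻ _ (All.tabulate λ x∈ → <⇒<ᵇ (bounded p x∈)))

countBelow : ℕ → List ℕ → ℕ
countBelow z xs = length (filterᵇ (_<ᵇ z) xs)

countBelow-upTo : ∀ {z n} → z ≤ n → countBelow z (upTo n) ≡ z
countBelow-upTo {z} {n} le = trans (unique-⇔⇒length≡
    (Uniqueₚ.filter⁺ (λ x → T? (x <ᵇ z)) (Uniqueₚ.upTo⁺ n)) (Uniqueₚ.upTo⁺ z)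
    (λ x∈ → ∈-upTo⁺ (<ᵇ⇒< _ _ (proj₂ (∈-filter⁻ (λ x → T? (x <ᵇ z)) {xs = upTo n} x∈))))
    (λ x∈ → ∈-filter⁺ (λ x → T? (x <ᵇ z)) (∈-upTo⁺ (<-≤-trans (∈-upTo⁻ x∈) le)) (<⇒<ᵇ (∈-upTo⁻ x∈))))
  (length-upTo z)

countBelow-permutation : ∀ {xs z} → Permutation xs → z ≤ length xs → countBelow z xs ≡ z
countBelow-permutation {z = z} p z≤ =
  trans (Perm.↭-length (Perm.filter-↭ (λ x → T? (x <ᵇ z)) p)) (countBelow-upTo z≤)

-- A cut instead of a shift: symmetry swaps the two pieces, and transitivity only compares two
-- factorizations of one list, so no index arithmetic modulo the length arises.
data Rotation {A : Set} (xs ys : List A) : Set where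
  rot : ∀ a b → xs ≡ a ++ b → ys ≡ b ++ a → Rotation xs ys

Rotation-refl : ∀ {A : Set} {xs : List A} → Rotation xs xs
Rotation-refl {xs = xs} = rot [] xs refl (sym (++-identityʳ xs))

Rotation-sym : ∀ {A : Set} {xs ys : List A} → Rotation xs ys → Rotation ys xs
Rotation-sym (rot a b p q) = rot b a q p

++-≡-split : ∀ {A : Set} (a : List A) {b c d} → a ++ b ≡ c ++ d →
  (∃[ e ] (c ≡ a ++ e × b ≡ e ++ d)) ⊎ (∃[ e ] (a ≡ c ++ e × d ≡ e ++ b))
++-≡-split [] {c = c} eq = inj₁ (c , refl , eq)
++-≡-split (x ∷ a) {c = []} eq = inj₂ (x ∷ a , refl , sym eq)
++-≡-split (x ∷ a) {c = y ∷ c} eq with ++-≡-split a {c = c} (∷-injectiveʳ eq) | ∷-injectiveˡ eq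
... | inj₁ (e , p , q) | refl = inj₁ (e , cong (x ∷_) p , q)
... | inj₂ (e , p , q) | refl = inj₂ (e , cong (x ∷_) p , q)

Rotation-trans : ∀ {A : Set} {xs ys zs : List A} → Rotation xs ys → Rotation ys zs → Rotation xs zs
Rotation-trans (rot a b refl refl) (rot c d eq refl) with ++-≡-split b {c = c} {d} eq
... | inj₁ (e , refl , refl) = rot e (d ++ b) (++-assoc e d b) (sym (++-assoc d b e))
... | inj₂ (e , refl , refl) = rot (a ++ c) e (sym (++-assoc a c e)) (++-assoc e a c)

Rotation⇒↭ : ∀ {A : Set} {xs ys : List A} → Rotation xs ys → xs ↭ ys
Rotation⇒↭ (rot a b refl refl) = Perm.++-comm a b

∈-middle-unique : ∀ {A : Set} {x : A} {p q} → ¬ Unique (x ∷ p ++ x ∷ q)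
∈-middle-unique {x = x} {p} {q} (x∉ ∷ _) = All.lookup x∉ (∈-insert p) refl

-- If both pieces of the cut were nonempty, each would begin with 0, and 0 would occur twice. This
-- is what identifies a circular permutation with its rotation starting at 0.
rotation-from-0-unique : ∀ {xs ys : List ℕ} → Rotation xs ys → Unique xs →
  head? xs ≡ just 0 → head? ys ≡ just 0 → xs ≡ ys
rotation-from-0-unique (rot [] b refl refl) u h k = sym (++-identityʳ b)
rotation-from-0-unique (rot a@(_ ∷ _) [] refl refl) u h k = ++-identityʳ a
rotation-from-0-unique (rot (x ∷ a) (y ∷ b) refl refl) u refl refl = ⊥-elim (∈-middle-unique {p = a} {b} u)

rotation-from-0 : ∀ {xs : List ℕ} → 0 ∈ xs → ∃[ ys ] (Rotation xs ys × head? ys ≡ just 0)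
rotation-from-0 0∈ with ∈-∃++ 0∈
... | p , q , refl = _ , rot p (0 ∷ q) refl refl , refl

-- Only membership matters, not the order of the list, so a pairing may be rearranged or restricted
-- freely. First components are entries of the permutation, second components entries of the
-- pattern.
OrderIso : List (ℕ × ℕ) → Set
OrderIso ps = ∀ {p q} → p ∈ ps → q ∈ ps →
  (proj₁ p < proj₁ q → proj₂ p < proj₂ q) × (proj₂ p < proj₂ q → proj₁ p < proj₁ q)

OrderIso-⊆ : ∀ {ps qs} → (∀ {p} → p ∈ ps → p ∈ qs) → OrderIso qs → OrderIso ps
OrderIso-⊆ sub o p q = o (sub p) (sub q)

record Embeds (xs π : List ℕ) : Set where
  constructor embeds
  field
    pairing : List (ℕ × ℕ)
    orderIso : OrderIso pairing
    image : map proj₁ pairing ⊆ xs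
    pattern≡ : map proj₂ pairing ≡ π

map-split : ∀ {A B : Set} (f : A → B) ps {b c} → map f ps ≡ b ++ c →
  ∃[ qs ] ∃[ rs ] (ps ≡ qs ++ rs × map f qs ≡ b × map f rs ≡ c)
map-split f ps {[]} eq = [] , ps , refl , refl , eq
map-split f (p ∷ ps) {x ∷ b} eq with map-split f ps {b} (∷-injectiveʳ eq)
... | qs , rs , refl , refl , e = p ∷ qs , rs , refl , cong (_∷ _) (∷-injectiveˡ eq) , e

⊆-split : ∀ {A : Set} {s : List A} b {c} → s ⊆ b ++ c →
  ∃[ s₁ ] ∃[ s₂ ] (s ≡ s₁ ++ s₂ × s₁ ⊆ b × s₂ ⊆ c)
⊆-split [] τ = [] , _ , refl , [] , τ
⊆-split (x ∷ b) (_ ∷ʳ τ) with ⊆-split b τ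
... | s₁ , s₂ , refl , α , β = s₁ , s₂ , refl , x ∷ʳ α , β
⊆-split (x ∷ b) (refl ∷ τ) with ⊆-split b τ
... | s₁ , s₂ , refl , α , β = x ∷ s₁ , s₂ , refl , refl ∷ α , β

-- Rotating the pattern instead of the permutation gives the same notion of containment.
record Occurs (xs π : List ℕ) : Set where
  constructor occurs
  field
    {rotated} : List ℕ
    rotation : Rotation π rotated
    embedding : Embeds xs rotated

Embeds-rotate : ∀ {xs ys π} → Rotation xs ys → Embeds ys π → Occurs xs π
Embeds-rotate (rot a b refl refl) (embeds ps o im refl) with ⊆-split b im
... | s₁ , s₂ , eq , α , β with map-split proj₁ ps {s₁} {s₂} eq
... | qs , rs , refl , refl , refl =
  occurs (rot (map proj₂ qs) (map proj₂ rs) (map-++ proj₂ qs rs) refl)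
  (embeds (rs ++ qs)
    (OrderIso-⊆ (λ p∈ → [ ∈-++⁺ʳ qs , ∈-++⁺ˡ ]′ (∈-++⁻ rs p∈)) o)
    (subst (_⊆ _) (sym (map-++ proj₁ rs qs)) (Sub.++⁺ β α)) (map-++ proj₂ rs qs))

⊆-++-split : ∀ {A : Set} (s₁ : List A) {s₂ xs} → s₁ ++ s₂ ⊆ xs →
  ∃[ c ] ∃[ d ] (xs ≡ c ++ d × s₁ ⊆ c × s₂ ⊆ d)
⊆-++-split [] τ = [] , _ , refl , [] , τ
⊆-++-split (x ∷ s₁) (y ∷ʳ τ) with ⊆-++-split (x ∷ s₁) τ
... | c , d , refl , α , β = y ∷ c , d , refl , y ∷ʳ α , β
⊆-++-split (x ∷ s₁) (refl ∷ τ) with ⊆-++-split s₁ τ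
... | c , d , refl , α , β = x ∷ c , d , refl , refl ∷ α , β

Embeds-pattern-rotate : ∀ {xs π ρ} → Rotation π ρ → Embeds xs π → ∃[ ys ] (Rotation xs ys × Embeds ys ρ)
Embeds-pattern-rotate (rot a b refl refl) (embeds ps o im eq) with map-split proj₂ ps {a} {b} eq
... | qs , rs , refl , refl , refl
  with ⊆-++-split (map proj₁ qs) (subst (_⊆ _) (map-++ proj₁ qs rs) im)
... | c , d , refl , α , β = _ , rot c d refl refl ,
  embeds (rs ++ qs)
    (OrderIso-⊆ (λ p∈ → [ ∈-++⁺ʳ qs , ∈-++⁺ˡ ]′ (∈-++⁻ rs p∈)) o)
    (subst (_⊆ _) (sym (map-++ proj₁ rs qs)) (Sub.++⁺ β α)) (map-++ proj₂ rs qs)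

-- The comparison function local to orderIsoᵇ cannot be named, but unification recovers it. (As a local function it
-- also takes x, xs, y, ys as parameters; it does not use them, so conversion ignores them and it can be recursed on.)
orderIsoᵇ-unfold : Σ (ℕ → List ℕ → ℕ → List ℕ → Bool) λ cmp →
  ∀ x xs y ys → orderIsoᵇ (x ∷ xs) (y ∷ ys) ≡ cmp x xs y ys ∧ orderIsoᵇ xs ys
orderIsoᵇ-unfold = _ , λ x xs y ys → refl

compareHead : ℕ → List ℕ → ℕ → List ℕ → Bool
compareHead = proj₁ orderIsoᵇ-unfold

SameOrder : ℕ × ℕ → ℕ × ℕ → Set
SameOrder p q = ((proj₁ p <ᵇ proj₁ q) ≡ (proj₂ p <ᵇ proj₂ q)) × ((proj₁ q <ᵇ proj₁ p) ≡ (proj₂ q <ᵇ proj₂ p))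

==ᵇ⇒≡ : ∀ a b → T (a ==ᵇ b) → a ≡ b
==ᵇ⇒≡ false false _ = refl
==ᵇ⇒≡ true true _ = refl

≡⇒==ᵇ : ∀ a b → a ≡ b → T (a ==ᵇ b)
≡⇒==ᵇ false false _ = tt
≡⇒==ᵇ true true _ = tt

compareHead⁺ : ∀ x y ps → All (SameOrder (x , y)) ps → T (compareHead x (map proj₁ ps) y (map proj₂ ps))
compareHead⁺ x y [] [] = tt
compareHead⁺ x y ((a , b) ∷ ps) ((e₁ , e₂) ∷ al) = Equivalence.from T-∧
  (≡⇒==ᵇ (x <ᵇ a) _ e₁ , Equivalence.from T-∧ (≡⇒==ᵇ (a <ᵇ x) _ e₂ , compareHead⁺ x y ps al))

compareHead⁻ : ∀ x y as bs → T (compareHead x as y bs) →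
  ∃[ ps ] (map proj₁ ps ≡ as × map proj₂ ps ≡ bs × All (SameOrder (x , y)) ps)
compareHead⁻ x y [] [] t = [] , refl , refl , []
compareHead⁻ x y (a ∷ as) (b ∷ bs) t
  with Equivalence.to (T-∧ {(x <ᵇ a) ==ᵇ (y <ᵇ b)}) t
... | t₁ , t' with Equivalence.to (T-∧ {(a <ᵇ x) ==ᵇ (b <ᵇ y)}) t'
... | t₂ , t₃ with compareHead⁻ x y as bs t₃
... | ps , refl , refl , al = (a , b) ∷ ps , refl , refl , (==ᵇ⇒≡ (x <ᵇ a) _ t₁ , ==ᵇ⇒≡ (a <ᵇ x) _ t₂) ∷ al

-- `compareHead⁻` and the recursive call in `orderIsoᵇ⁻` rebuild the same pairing independently;
-- this identifies the two.
zip-unique : ∀ (ps qs : List (ℕ × ℕ)) → map proj₁ ps ≡ map proj₁ qs → map proj₂ ps ≡ map proj₂ qs → ps ≡ qs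
zip-unique [] [] _ _ = refl
zip-unique ((a , b) ∷ ps) ((c , d) ∷ qs) e f with ∷-injective e | ∷-injective f
... | refl , e' | refl , f' = cong ((a , b) ∷_) (zip-unique ps qs e' f')

SameOrder⇒ : ∀ {p q} → SameOrder p q →
  (proj₁ p < proj₁ q → proj₂ p < proj₂ q) × (proj₂ p < proj₂ q → proj₁ p < proj₁ q)
SameOrder⇒ (e , _) = (λ lt → <ᵇ⇒< _ _ (subst T e (<⇒<ᵇ lt))) , (λ lt → <ᵇ⇒< _ _ (subst T (sym e) (<⇒<ᵇ lt)))

OrderIso-∷ : ∀ {p ps} → All (SameOrder p) ps → OrderIso ps → OrderIso (p ∷ ps)
OrderIso-∷ al o (here refl) (here refl) = (λ lt → ⊥-elim (<-irrefl refl lt)) , (λ lt → ⊥-elim (<-irrefl refl lt))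
OrderIso-∷ al o (here refl) (there q) = SameOrder⇒ (All.lookup al q)
OrderIso-∷ al o (there p) (here refl) = SameOrder⇒ (swap (All.lookup al p))
OrderIso-∷ al o (there p) (there q) = o p q

<ᵇ-cong : ∀ {a b c d} → (a < b → c < d) → (c < d → a < b) → (a <ᵇ b) ≡ (c <ᵇ d)
<ᵇ-cong f g = T⇔⇒≡ (λ t → <⇒<ᵇ (f (<ᵇ⇒< _ _ t))) (λ t → <⇒<ᵇ (g (<ᵇ⇒< _ _ t)))

OrderIso⇒SameOrder : ∀ {ps p q} → OrderIso ps → p ∈ ps → q ∈ ps → SameOrder p q
OrderIso⇒SameOrder o p q = <ᵇ-cong (proj₁ (o p q)) (proj₂ (o p q)) , <ᵇ-cong (proj₁ (o q p)) (proj₂ (o q p))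

orderIsoᵇ⁺ : ∀ ps → OrderIso ps → T (orderIsoᵇ (map proj₁ ps) (map proj₂ ps))
orderIsoᵇ⁺ [] o = tt
orderIsoᵇ⁺ (p ∷ ps) o = Equivalence.from T-∧
  ( compareHead⁺ _ _ ps (All.tabulate λ q → OrderIso⇒SameOrder o (here refl) (there q))
  , orderIsoᵇ⁺ ps (OrderIso-⊆ there o))

orderIsoᵇ⁻ : ∀ s π → T (orderIsoᵇ s π) → ∃[ ps ] (OrderIso ps × map proj₁ ps ≡ s × map proj₂ ps ≡ π)
orderIsoᵇ⁻ [] [] t = [] , (λ ()) , refl , refl
orderIsoᵇ⁻ (x ∷ s) (y ∷ π) t with Equivalence.to (T-∧ {compareHead x s y π}) t
... | t₁ , t₂ with compareHead⁻ x y s π t₁ | orderIsoᵇ⁻ s π t₂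
... | ps , refl , refl , al | qs , o , e , f with zip-unique ps qs (sym e) (sym f)
... | refl = (x , y) ∷ ps , OrderIso-∷ al o , refl , refl

∈-subsequences⁻ : ∀ {s} xs → s ∈ subsequences xs → s ⊆ xs
∈-subsequences⁻ [] (here refl) = []
∈-subsequences⁻ (x ∷ xs) s∈ with ∈-++⁻ (map (x ∷_) (subsequences xs)) s∈
... | inj₂ q = x ∷ʳ ∈-subsequences⁻ xs q
... | inj₁ q with ∈-map⁻ (x ∷_) q
... | t , t∈ , refl = refl ∷ ∈-subsequences⁻ xs t∈

∈-subsequences⁺ : ∀ {s xs} → s ⊆ xs → s ∈ subsequences xs
∈-subsequences⁺ [] = here refl
∈-subsequences⁺ {xs = x ∷ xs} (_ ∷ʳ τ) = ∈-++⁺ʳ (map (x ∷_) (subsequences xs)) (∈-subsequences⁺ τ)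
∈-subsequences⁺ {xs = x ∷ xs} (refl ∷ τ) = ∈-++⁺ˡ (∈-map⁺ (x ∷_) (∈-subsequences⁺ τ))

Contains⁻ : ∀ xs π → Contains xs π → ∃[ ys ] (Rotation xs ys × Embeds ys π)
Contains⁻ xs π c with Any.satisfied (Anyₚ.map⁻ (Anyₚ.any⁻ _ (rotations xs) c))
... | k , c' with find (Anyₚ.any⁻ _ (subsequences (rotate k xs)) c')
... | s , s∈ , t with orderIsoᵇ⁻ s π t
... | ps , o , refl , e =
  _ , rot (take k xs) (drop k xs) (sym (take++drop≡id k xs)) refl ,
  embeds ps o (∈-subsequences⁻ _ s∈) e

take-++ : ∀ {A : Set} (a : List A) {b} → take (length a) (a ++ b) ≡ a
take-++ [] = refl
take-++ (x ∷ a) = cong (x ∷_) (take-++ a)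

drop-++ : ∀ {A : Set} (a : List A) {b} → drop (length a) (a ++ b) ≡ b
drop-++ [] = refl
drop-++ (x ∷ a) = drop-++ a

Rotation⇒rotate : ∀ {xs ys} → xs ≢ [] → Rotation xs ys → ∃[ k ] (k < length xs × ys ≡ rotate k xs)
Rotation⇒rotate ne (rot [] [] refl refl) = contradiction refl ne
-- `rotations` offers only shifts below the length, so a cut at the very end becomes shift 0.
Rotation⇒rotate ne (rot (x ∷ a) [] refl refl) = 0 , s≤s z≤n ,
  sym (trans (++-identityʳ _) (++-identityʳ _))
Rotation⇒rotate ne (rot a (x ∷ b) refl refl) = length a ,
  ≤-trans (m<m+n (length a) (s≤s z≤n)) (≤-reflexive (sym (length-++ a))) ,
  sym (cong₂ _++_ (drop-++ a) (take-++ a))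

Contains⁺ : ∀ {xs ys π} → xs ≢ [] → Rotation xs ys → Embeds ys π → Contains xs π
Contains⁺ {xs} {ys} {π} ne r (embeds ps o im refl) with Rotation⇒rotate ne r
... | k , k< , refl = Anyₚ.any⁺ _ (Anyₚ.map⁺ (Any.map
    (λ { refl → Anyₚ.any⁺ _ (Any.map (λ { refl → orderIsoᵇ⁺ ps o }) (∈-subsequences⁺ im)) })
    (∈-upTo⁺ k<)))

Contains-pattern-rotate : ∀ {xs π ρ} → xs ≢ [] → Rotation π ρ → Contains xs π → Contains xs ρ
Contains-pattern-rotate {xs} {π} ne r c with Contains⁻ xs π c
... | ys , r₁ , e with Embeds-pattern-rotate r e
... | zs , r₂ , e' = Contains⁺ ne (Rotation-trans r₁ r₂) e'

Contains-rotate : ∀ {xs ys π} → xs ≢ [] → Rotation xs ys → Contains ys π → Contains xs π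
Contains-rotate {ys = ys} {π} ne r c with Contains⁻ ys π c
... | zs , r₁ , e = Contains⁺ ne (Rotation-trans r r₁) e

Contains⇒Occurs : ∀ {xs π} → Contains xs π → Occurs xs π
Contains⇒Occurs {xs} {π} c with Contains⁻ xs π c
... | ys , r , e = Embeds-rotate r e

Occurs⇒Contains : ∀ {xs π} → xs ≢ [] → Occurs xs π → Contains xs π
Occurs⇒Contains ne (occurs r e) = Contains-pattern-rotate ne (Rotation-sym r) (Contains⁺ ne Rotation-refl e)

countBelow-OrderIso : ∀ {ps p} (qs : List (ℕ × ℕ)) → OrderIso ps → p ∈ ps → (∀ {q} → q ∈ qs → q ∈ ps) →
  countBelow (proj₁ p) (map proj₁ qs) ≡ countBelow (proj₂ p) (map proj₂ qs)
countBelow-OrderIso [] o p∈ sub = refl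
countBelow-OrderIso {p = p} ((a , b) ∷ qs) o p∈ sub
  with a <ᵇ proj₁ p | b <ᵇ proj₂ p | proj₂ (OrderIso⇒SameOrder o p∈ (sub (here refl)))
... | false | false | _ = countBelow-OrderIso qs o p∈ (sub ∘ there)
... | true | true | _ = cong suc (countBelow-OrderIso qs o p∈ (sub ∘ there))

-- In a permutation of 0, ..., n-1 each entry equals the number of entries below it, and an order
-- isomorphism preserves that number.
OrderIso-permutations : ∀ ps → OrderIso ps → Permutation (map proj₁ ps) → Permutation (map proj₂ ps) →
  map proj₁ ps ≡ map proj₂ ps
OrderIso-permutations ps o P Q = map-cong-local (All.tabulate λ {p} p∈ →
  trans (sym (countBelow-permutation P (<⇒≤ (bounded P (∈-map⁺ proj₁ p∈)))))
  (trans (countBelow-OrderIso ps o p∈ id)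
  (countBelow-permutation Q (<⇒≤ (bounded Q (∈-map⁺ proj₂ p∈))))))

-- Words and Grassmannian permutations

range : ℕ → ℕ → List ℕ
range k zero = []
range k (suc n) = k ∷ range (suc k) n

applyUpTo≡range : ∀ (f : ℕ → ℕ) k n → (∀ i → f i ≡ k + i) → applyUpTo f n ≡ range k n
applyUpTo≡range f k zero eq = refl
applyUpTo≡range f k (suc n) eq = cong₂ _∷_ (trans (eq 0) (+-identityʳ k))
  (applyUpTo≡range (f ∘ suc) (suc k) n (λ i → trans (eq (suc i)) (+-suc k i)))

upTo≡range : ∀ n → upTo n ≡ range 0 n
upTo≡range n = applyUpTo≡range id 0 n (λ _ → refl)

length-range : ∀ k n → length (range k n) ≡ n
length-range k zero = refl
length-range k (suc n) = cong suc (length-range (suc k) n)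

range-++ : ∀ k m n → range k (m + n) ≡ range k m ++ range (k + m) n
range-++ k zero n = cong (λ j → range j n) (sym (+-identityʳ k))
range-++ k (suc m) n = cong (k ∷_) (trans (range-++ (suc k) m n)
  (cong (λ j → range (suc k) m ++ range j n) (sym (+-suc k m))))

complement : Word → Word
complement = map not

complement-involutive : ∀ w → complement (complement w) ≡ w
complement-involutive [] = refl
complement-involutive (b ∷ w) = cong₂ _∷_ (not-involutive b) (complement-involutive w)

positions : Bool → ℕ → Word → List ℕ
positions b k [] = []
positions false k (false ∷ v) = k ∷ positions false (suc k) v
positions false k (true ∷ v) = positions false (suc k) v
positions true k (false ∷ v) = positions true (suc k) v
positions true k (true ∷ v) = k ∷ positions true (suc k) v

count : Bool → Word → ℕ
count b [] = 0
count false (false ∷ v) = suc (count false v)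
count false (true ∷ v) = count false v
count true (false ∷ v) = count true v
count true (true ∷ v) = suc (count true v)

-- For `l = 0` and `h = count false u` this is the standardization of the word `u`.
label : ℕ → ℕ → Word → List ℕ
label l h [] = []
label l h (false ∷ u) = l ∷ label (suc l) h u
label l h (true ∷ u) = h ∷ label l (suc h) u

-- P w = G(v) and Q w = IG(v) for v the reversed complement of w.
P : Word → List ℕ
P v = positions false 0 v ++ positions true 0 v

Q : Word → List ℕ
Q u = label 0 (count false u) u

length-positions : ∀ b k v → length (positions b k v) ≡ count b v
length-positions false k [] = refl
length-positions true k [] = refl
length-positions false k (false ∷ v) = cong suc (length-positions false (suc k) v)
length-positions false k (true ∷ v) = length-positions false (suc k) v
length-positions true k (false ∷ v) = length-positions true (suc k) v
length-positions true k (true ∷ v) = cong suc (length-positions true (suc k) v)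

length-label : ∀ l h u → length (label l h u) ≡ length u
length-label l h [] = refl
length-label l h (false ∷ u) = cong suc (length-label (suc l) h u)
length-label l h (true ∷ u) = cong suc (length-label l (suc h) u)

positions-↭ : ∀ k v → positions false k v ++ positions true k v ↭ range k (length v)
positions-↭ k [] = ↭-refl
positions-↭ k (false ∷ v) = prep k (positions-↭ (suc k) v)
positions-↭ k (true ∷ v) = ↭-trans (Perm.shift k (positions false (suc k) v) _) (prep k (positions-↭ (suc k) v))

label-↭ : ∀ l h u → label l h u ↭ range l (count false u) ++ range h (count true u)
label-↭ l h [] = ↭-refl
label-↭ l h (false ∷ u) = prep l (label-↭ (suc l) h u)
label-↭ l h (true ∷ u) = ↭-trans (prep h (label-↭ l (suc h) u)) (↭-sym (Perm.shift h (range l (count false u)) _))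

length≡counts : ∀ u → length u ≡ count false u + count true u
length≡counts [] = refl
length≡counts (false ∷ u) = cong suc (length≡counts u)
length≡counts (true ∷ u) = trans (cong suc (length≡counts u)) (sym (+-suc _ _))

permutation-range : ∀ {xs n} → xs ↭ range 0 n → Permutation xs
permutation-range {xs} {n} p = ↭-trans p (↭-reflexive (sym (trans (cong upTo (trans (Perm.↭-length p) (length-range 0 n))) (upTo≡range n))))

P-permutation : ∀ v → Permutation (P v)
P-permutation v = permutation-range (positions-↭ 0 v)

Q-permutation : ∀ u → Permutation (Q u)
Q-permutation u = permutation-range (↭-trans (label-↭ 0 (count false u) u)
  (↭-reflexive (sym (trans (cong (range 0) (length≡counts u)) (range-++ 0 (count false u) (count true u))))))

length-P : ∀ v → length (P v) ≡ length v
length-P v = trans (Perm.↭-length (positions-↭ 0 v)) (length-range 0 (length v))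

length-Q : ∀ u → length (Q u) ≡ length u
length-Q u = length-label 0 _ u

-- Subwords and order-isomorphic subsequences

<⇒SameOrder : ∀ {a b c d} → a < c → b < d → SameOrder (a , b) (c , d)
<⇒SameOrder p q = <ᵇ-cong (λ _ → q) (λ _ → p) , <ᵇ-cong (⊥-elim ∘ <-asym p) (⊥-elim ∘ <-asym q)

>⇒SameOrder : ∀ {a b c d} → c < a → d < b → SameOrder (a , b) (c , d)
>⇒SameOrder p q = swap (<⇒SameOrder p q)

-- The low and the high pairing stay apart because `P` concatenates two lists, while each further
-- letter extends only one of them. `bound` makes a new position the smallest of all, so it can be
-- put in front of either list.
record Match (k j : ℕ) (s t s' t' : List ℕ) : Set where
  constructor match
  field
    ps qs : List (ℕ × ℕ)
    ps₁ : map proj₁ ps ≡ s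
    qs₁ : map proj₁ qs ≡ t
    ps₂ : map proj₂ ps ≡ s'
    qs₂ : map proj₂ qs ≡ t'
    iso : OrderIso (ps ++ qs)
    bound : All (λ p → k ≤ proj₁ p × j ≤ proj₂ p) (ps ++ qs)

match-false : ∀ {k j s t s' t'} → Match (suc k) (suc j) s t s' t' → Match k j (k ∷ s) t (j ∷ s') t'
match-false {k} {j} (match ps qs refl refl refl refl o al) = match ((k , j) ∷ ps) qs refl refl refl refl
  (OrderIso-∷ (All.map (λ (p , q) → <⇒SameOrder p q) al) o)
  ((≤-refl , ≤-refl) ∷ All.map (λ (p , q) → <⇒≤ p , <⇒≤ q) al)

match-true : ∀ {k j s t s' t'} → Match (suc k) (suc j) s t s' t' → Match k j s (k ∷ t) s' (j ∷ t')
match-true {k} {j} (match ps qs refl refl refl refl o al) = match ps ((k , j) ∷ qs) refl refl refl refl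
  (OrderIso-⊆ (Perm.∈-resp-↭ sh) (OrderIso-∷ (All.map (λ (p , q) → <⇒SameOrder p q) al) o))
  (Perm.All-resp-↭ (↭-sym sh) ((≤-refl , ≤-refl) ∷ All.map (λ (p , q) → <⇒≤ p , <⇒≤ q) al))
  where sh = Perm.shift (k , j) ps qs

match-skip : ∀ {k j s t s' t'} → Match (suc k) j s t s' t' → Match k j s t s' t'
match-skip (match ps qs a b c d o al) = match ps qs a b c d o (All.map (λ (p , q) → <⇒≤ p , q) al)

match-[] : ∀ {k j} → Match k j [] [] [] []
match-[] = match [] [] refl refl refl refl (λ ()) []

-- Each position occurs in exactly one of the two lists, so the positions used by `s` and `t`
-- together spell a subword of `v`.
select-positions : ∀ {s t} k j v → s ⊆ positions false k v → t ⊆ positions true k v →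
  ∃[ y ] (y ⊆ v × Match k j s t (positions false j y) (positions true j y))
select-positions k j [] [] [] = [] , [] , match-[]
select-positions k j (false ∷ v) (_ ∷ʳ σ) τ with select-positions (suc k) j v σ τ
... | y , ι , m = y , false ∷ʳ ι , match-skip m
select-positions k j (false ∷ v) (refl ∷ σ) τ with select-positions (suc k) (suc j) v σ τ
... | y , ι , m = false ∷ y , refl ∷ ι , match-false m
select-positions k j (true ∷ v) σ (_ ∷ʳ τ) with select-positions (suc k) j v σ τ
... | y , ι , m = y , true ∷ʳ ι , match-skip m
select-positions k j (true ∷ v) σ (refl ∷ τ) with select-positions (suc k) (suc j) v σ τ
... | y , ι , m = true ∷ y , refl ∷ ι , match-true m

embed-positions : ∀ {y v} k j → y ⊆ v → ∃[ s ] ∃[ t ] (s ⊆ positions false k v × t ⊆ positions true k v ×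
  Match k j s t (positions false j y) (positions true j y))
embed-positions k j [] = [] , [] , [] , [] , match-[]
embed-positions k j (false ∷ʳ ι) with embed-positions (suc k) j ι
... | s , t , σ , τ , m = s , t , k ∷ʳ σ , τ , match-skip m
embed-positions k j (true ∷ʳ ι) with embed-positions (suc k) j ι
... | s , t , σ , τ , m = s , t , σ , k ∷ʳ τ , match-skip m
embed-positions k j (_∷_ {x = false} refl ι) with embed-positions (suc k) (suc j) ι
... | s , t , σ , τ , m = k ∷ s , t , refl ∷ σ , τ , match-false m
embed-positions k j (_∷_ {x = true} refl ι) with embed-positions (suc k) (suc j) ι
... | s , t , σ , τ , m = s , k ∷ t , σ , refl ∷ τ , match-true m

-- Labels below the thresholds H, H' belong to the letter false.
record MatchLabels (H H' l h l' h' : ℕ) (s s' : List ℕ) : Set where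
  constructor match
  field
    ps : List (ℕ × ℕ)
    ps₁ : map proj₁ ps ≡ s
    ps₂ : map proj₂ ps ≡ s'
    iso : OrderIso ps
    bound : All (λ p → (l ≤ proj₁ p × proj₁ p < H × l' ≤ proj₂ p × proj₂ p < H') ⊎ (h ≤ proj₁ p × h' ≤ proj₂ p)) ps

matchLabels-false : ∀ {H H' l h l' h' s s'} → l < H → l' < H' → H ≤ h → H' ≤ h' →
  MatchLabels H H' (suc l) h (suc l') h' s s' → MatchLabels H H' l h l' h' (l ∷ s) (l' ∷ s')
matchLabels-false {l = l} {l' = l'} a b c d (match ps refl refl o al) = match ((l , l') ∷ ps) refl refl
  (OrderIso-∷ (All.map (λ { (inj₁ (p , _ , q , _)) → <⇒SameOrder p q
                          ; (inj₂ (p , q)) → <⇒SameOrder (<-≤-trans a (≤-trans c p)) (<-≤-trans b (≤-trans d q)) }) al) o)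
  (inj₁ (≤-refl , a , ≤-refl , b) ∷
   All.map (λ { (inj₁ (p , q , r , s)) → inj₁ (<⇒≤ p , q , <⇒≤ r , s) ; (inj₂ x) → inj₂ x }) al)

matchLabels-true : ∀ {H H' l h l' h' s s'} → H ≤ h → H' ≤ h' →
  MatchLabels H H' l (suc h) l' (suc h') s s' → MatchLabels H H' l h l' h' (h ∷ s) (h' ∷ s')
matchLabels-true {h = h} {h' = h'} c d (match ps refl refl o al) = match ((h , h') ∷ ps) refl refl
  (OrderIso-∷ (All.map (λ { (inj₁ (_ , p , _ , q)) → >⇒SameOrder (<-≤-trans p c) (<-≤-trans q d)
                          ; (inj₂ (p , q)) → <⇒SameOrder p q }) al) o)
  (inj₂ (≤-refl , ≤-refl) ∷
   All.map (λ { (inj₁ x) → inj₁ x ; (inj₂ (p , q)) → inj₂ (<⇒≤ p , <⇒≤ q) }) al)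

matchLabels-skip-false : ∀ {H H' l h l' h' s s'} → MatchLabels H H' (suc l) h l' h' s s' → MatchLabels H H' l h l' h' s s'
matchLabels-skip-false (match ps a b o al) = match ps a b o
  (All.map (λ { (inj₁ (p , q , r , s)) → inj₁ (<⇒≤ p , q , r , s) ; (inj₂ x) → inj₂ x }) al)

matchLabels-skip-true : ∀ {H H' l h l' h' s s'} → MatchLabels H H' l (suc h) l' h' s s' → MatchLabels H H' l h l' h' s s'
matchLabels-skip-true (match ps a b o al) = match ps a b o
  (All.map (λ { (inj₁ x) → inj₁ x ; (inj₂ (p , q)) → inj₂ (<⇒≤ p , q) }) al)

+-suc-≤ : ∀ {l c H} → l + suc c ≤ H → suc l + c ≤ H
+-suc-≤ {l} {c} = ≤-trans (≤-reflexive (sym (+-suc l c)))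

+-suc-< : ∀ {l c H} → l + suc c ≤ H → l < H
+-suc-< {l} {c} le = ≤-trans (m≤m+n (suc l) c) (+-suc-≤ {l} {c} le)

-- The threshold needed for `H'` is `count false y`, known only once the whole subword has been
-- selected; hence thresholds and new labels are quantified after `y`.
select-label : ∀ {s} l h u → s ⊆ label l h u →
  ∃[ y ] (y ⊆ u × (∀ {H H' l' h'} → l + count false u ≤ H → l' + count false y ≤ H' → H ≤ h → H' ≤ h' →
    MatchLabels H H' l h l' h' s (label l' h' y)))
select-label l h [] [] = [] , [] , λ _ _ _ _ → match [] refl refl (λ ()) []
select-label l h (false ∷ u) (_ ∷ʳ σ) with select-label (suc l) h u σ
... | y , ι , m = y , false ∷ʳ ι , λ p q r s → matchLabels-skip-false (m (+-suc-≤ {l} p) q r s)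
select-label l h (false ∷ u) (refl ∷ σ) with select-label (suc l) h u σ
... | y , ι , m = false ∷ y , refl ∷ ι , λ {_} {_} {l'} p q r s →
  matchLabels-false (+-suc-< p) (+-suc-< q) r s (m (+-suc-≤ {l} p) (+-suc-≤ {l'} q) r s)
select-label l h (true ∷ u) (_ ∷ʳ σ) with select-label l (suc h) u σ
... | y , ι , m = y , true ∷ʳ ι , λ p q r s → matchLabels-skip-true (m p q (m≤n⇒m≤1+n r) s)
select-label l h (true ∷ u) (refl ∷ σ) with select-label l (suc h) u σ
... | y , ι , m = true ∷ y , refl ∷ ι , λ p q r s → matchLabels-true r s (m p q (m≤n⇒m≤1+n r) (m≤n⇒m≤1+n s))

embed-label : ∀ {y u H H'} l h l' h' → y ⊆ u → l + count false u ≤ H → l' + count false y ≤ H' → H ≤ h → H' ≤ h' →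
  ∃[ s ] (s ⊆ label l h u × MatchLabels H H' l h l' h' s (label l' h' y))
embed-label l h l' h' [] _ _ _ _ = [] , [] , match [] refl refl (λ ()) []
embed-label l h l' h' (false ∷ʳ ι) p q r s with embed-label (suc l) h l' h' ι (+-suc-≤ {l} p) q r s
... | t , τ , m = t , l ∷ʳ τ , matchLabels-skip-false m
embed-label l h l' h' (true ∷ʳ ι) p q r s with embed-label l (suc h) l' h' ι p q (m≤n⇒m≤1+n r) s
... | t , τ , m = t , h ∷ʳ τ , matchLabels-skip-true m
embed-label l h l' h' (_∷_ {x = false} refl ι) p q r s
  with embed-label (suc l) h (suc l') h' ι (+-suc-≤ {l} p) (+-suc-≤ {l'} q) r s
... | t , τ , m = l ∷ t , refl ∷ τ , matchLabels-false (+-suc-< p) (+-suc-< q) r s m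
embed-label l h l' h' (_∷_ {x = true} refl ι) p q r s
  with embed-label l (suc h) l' (suc h') ι p q (m≤n⇒m≤1+n r) (m≤n⇒m≤1+n s)
... | t , τ , m = h ∷ t , refl ∷ τ , matchLabels-true r s m

compose-pairings : ∀ (ps rs : List (ℕ × ℕ)) → map proj₁ ps ≡ map proj₁ rs →
  ∃[ ts ] (map proj₁ ts ≡ map proj₂ ps × map proj₂ ts ≡ map proj₂ rs ×
    (∀ {t} → t ∈ ts → ∃[ a ] ((a , proj₁ t) ∈ ps × (a , proj₂ t) ∈ rs)))
compose-pairings [] [] eq = [] , refl , refl , λ ()
compose-pairings ((a , b) ∷ ps) ((a' , c) ∷ rs) eq with ∷-injective eq
... | refl , eq' with compose-pairings ps rs eq'
... | ts , e , f , sub = (b , c) ∷ ts , cong (b ∷_) e , cong (c ∷_) f ,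
  λ { (here refl) → a , here refl , here refl
    ; (there t∈) → let (d , p , q) = sub t∈ in d , there p , there q }

-- Both pairings standardize the same sequence; composing one with the reverse of the other gives an
-- order isomorphism between two permutations.
OrderIso-unique : ∀ ps rs → OrderIso ps → OrderIso rs → map proj₁ ps ≡ map proj₁ rs →
  Permutation (map proj₂ ps) → Permutation (map proj₂ rs) → map proj₂ ps ≡ map proj₂ rs
OrderIso-unique ps rs o o' eq p q with compose-pairings ps rs eq
... | ts , e , f , sub = trans (sym e) (trans (OrderIso-permutations ts iso
    (subst Permutation (sym e) p) (subst Permutation (sym f) q)) f)
  where
  iso : OrderIso ts
  iso t∈ u∈ with sub t∈ | sub u∈
  ... | _ , tp , tr | _ , up , ur =
    (λ lt → proj₁ (o' tr ur) (proj₂ (o tp up) lt)) , (λ lt → proj₁ (o tp up) (proj₂ (o' tr ur) lt))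

-- The selected entries spell a subword `y` and are order-isomorphic to `P y`; standardization being
-- unique, the pattern must be `P y`.
Embeds-P⁻ : ∀ v {π} → Permutation π → Embeds (P v) π → ∃[ y ] (y ⊆ v × P y ≡ π)
Embeds-P⁻ v pπ (embeds ps o im refl) with ⊆-split (positions false 0 v) im
... | s , t , eq , σ , τ with select-positions 0 0 v σ τ
... | y , ι , match qs rs refl refl e f o' _ = y , ι , trans (sym ef)
    (sym (OrderIso-unique ps (qs ++ rs) o o' (trans eq (sym (map-++ proj₁ qs rs))) pπ
      (subst Permutation (sym ef) (P-permutation y))))
  where
  ef : map proj₂ (qs ++ rs) ≡ P y
  ef = trans (map-++ proj₂ qs rs) (cong₂ _++_ e f)

Embeds-P⁺ : ∀ {y v} → y ⊆ v → Embeds (P v) (P y)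
Embeds-P⁺ ι with embed-positions 0 0 ι
... | s , t , σ , τ , match qs rs refl refl e f o _ = embeds (qs ++ rs) o
  (subst (_⊆ _) (sym (map-++ proj₁ qs rs)) (Sub.++⁺ σ τ)) (trans (map-++ proj₂ qs rs) (cong₂ _++_ e f))

Embeds-Q⁻ : ∀ u {π} → Permutation π → Embeds (Q u) π → ∃[ y ] (y ⊆ u × Q y ≡ π)
Embeds-Q⁻ u pπ (embeds ps o im refl) with select-label 0 _ u im
... | y , ι , f with f {H' = count false y} {0} {count false y} ≤-refl ≤-refl ≤-refl ≤-refl
... | match rs e e' o' _ = y , ι , trans (sym e')
  (sym (OrderIso-unique ps rs o o' (sym e) pπ (subst Permutation (sym e') (Q-permutation y))))

Embeds-Q⁺ : ∀ {y u} → y ⊆ u → Embeds (Q u) (Q y)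
Embeds-Q⁺ ι with embed-label 0 _ 0 _ ι ≤-refl ≤-refl ≤-refl ≤-refl
... | s , σ , match ps refl e o _ = embeds ps o σ e

positions-complement : ∀ b k v → positions b k (complement v) ≡ positions (not b) k v
positions-complement b k [] = refl
positions-complement false k (false ∷ v) = positions-complement false (suc k) v
positions-complement false k (true ∷ v) = cong (k ∷_) (positions-complement false (suc k) v)
positions-complement true k (false ∷ v) = cong (k ∷_) (positions-complement true (suc k) v)
positions-complement true k (true ∷ v) = positions-complement true (suc k) v

-- Complementing the word exchanges the two increasing halves.
P-complement : ∀ v → Rotation (P v) (P (complement v))
P-complement v = rot (positions false 0 v) (positions true 0 v) refl
  (cong₂ _++_ (positions-complement false 0 v) (positions-complement true 0 v))

count-++ : ∀ b v w → count b (v ++ w) ≡ count b v + count b w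
count-++ b [] w = refl
count-++ false (false ∷ v) w = cong suc (count-++ false v w)
count-++ false (true ∷ v) w = count-++ false v w
count-++ true (false ∷ v) w = count-++ true v w
count-++ true (true ∷ v) w = cong suc (count-++ true v w)

count-replicate : ∀ b n → count b (replicate n b) ≡ n
count-replicate b zero = refl
count-replicate false (suc n) = cong suc (count-replicate false n)
count-replicate true (suc n) = cong suc (count-replicate true n)

count-replicate-not : ∀ b n → count b (replicate n (not b)) ≡ 0
count-replicate-not b zero = refl
count-replicate-not false (suc n) = count-replicate-not false n
count-replicate-not true (suc n) = count-replicate-not true n

label-++ : ∀ l h v w → label l h (v ++ w) ≡ label l h v ++ label (l + count false v) (h + count true v) w
label-++ l h [] w = cong₂ (λ a b → label a b w) (sym (+-identityʳ l)) (sym (+-identityʳ h))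
label-++ l h (false ∷ v) w = cong (l ∷_) (trans (label-++ (suc l) h v w)
  (cong (λ a → label (suc l) h v ++ label a (h + count true v) w) (sym (+-suc l _))))
label-++ l h (true ∷ v) w = cong (h ∷_) (trans (label-++ l (suc h) v w)
  (cong (λ a → label l (suc h) v ++ label (l + count false v) a w) (sym (+-suc h _))))

label-replicate-false : ∀ l h n → label l h (replicate n false) ≡ range l n
label-replicate-false l h zero = refl
label-replicate-false l h (suc n) = cong (l ∷_) (label-replicate-false (suc l) h n)

label-replicate-true : ∀ l h n → label l h (replicate n true) ≡ range h n
label-replicate-true l h zero = refl
label-replicate-true l h (suc n) = cong (h ∷_) (label-replicate-true l (suc h) n)

-- Moving `i` initial letters `true` to the end as letters `false` preserves all labels: the moved
-- letters carry the smallest high labels before and the largest low labels after, and both are `c`,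
-- ..., `c + i - 1`.
Q-rotate : ∀ i p → Rotation (Q (replicate i true ++ p)) (Q (p ++ replicate i false))
Q-rotate i p = rot (range c i) (label 0 (c + i) p) front back
  where
  c = count false p
  c₁ : count false (replicate i true ++ p) ≡ c
  c₁ = trans (count-++ false (replicate i true) p) (cong (_+ c) (count-replicate-not false i))
  c₂ : count false (p ++ replicate i false) ≡ c + i
  c₂ = trans (count-++ false p (replicate i false)) (cong (c +_) (count-replicate false i))
  front : Q (replicate i true ++ p) ≡ range c i ++ label 0 (c + i) p
  front = trans (cong (λ h → label 0 h (replicate i true ++ p)) c₁) (trans (label-++ 0 c (replicate i true) p)
    (cong₂ _++_ (label-replicate-true 0 c i)
      (cong₂ (λ a b → label a (c + b) p) (count-replicate-not false i) (count-replicate true i))))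
  back : Q (p ++ replicate i false) ≡ label 0 (c + i) p ++ range c i
  back = trans (cong (λ h → label 0 h (p ++ replicate i false)) c₂) (trans (label-++ 0 (c + i) p (replicate i false))
    (cong (label 0 (c + i) p ++_) (label-replicate-false c _ i)))

-- For a subword starting with `true` the minimum opens the second half; complementing brings it to
-- the front, which is where the second alternative comes from.
Occurs-P⁻ : ∀ v {σ} → Permutation σ → head? σ ≡ just 0 → Occurs (P v) σ →
  ∃[ z ] (P (false ∷ z) ≡ σ × (false ∷ z ⊆ v ⊎ complement (false ∷ z) ⊆ v))
Occurs-P⁻ v {σ} pσ hd (occurs r e) with Embeds-P⁻ v (Permutation-resp-↭ (Rotation⇒↭ r) pσ) e
... | [] , ι , refl = contradiction (trans (sym hd) (cong head? (Perm.↭-empty-inv (Rotation⇒↭ r)))) λ ()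
... | false ∷ z , ι , refl = z , sym (rotation-from-0-unique r (unique pσ) hd refl) , inj₁ ι
... | true ∷ z , ι , refl = complement z ,
  sym (rotation-from-0-unique (Rotation-trans r (P-complement (true ∷ z))) (unique pσ) hd refl) ,
  inj₂ (subst (λ y → true ∷ y ⊆ v) (sym (complement-involutive z)) ι)

Occurs-P⁺ : ∀ {v z} → z ⊆ v ⊎ complement z ⊆ v → Occurs (P v) (P z)
Occurs-P⁺ (inj₁ ι) = occurs Rotation-refl (Embeds-P⁺ ι)
Occurs-P⁺ {z = z} (inj₂ ι) = occurs (P-complement z) (Embeds-P⁺ ι)

leading-trues : ∀ y → ∃[ i ] ∃[ p ] (y ≡ replicate i true ++ p × (p ≡ [] ⊎ ∃[ p' ] p ≡ false ∷ p'))
leading-trues [] = 0 , [] , refl , inj₁ refl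
leading-trues (false ∷ y) = 0 , false ∷ y , refl , inj₂ (y , refl)
leading-trues (true ∷ y) with leading-trues y
... | i , p , refl , h = suc i , p , refl , h

-- Label 0 belongs to the first `false` of the subword, so rotating it to the front amounts to
-- moving the `i` leading letters `true` to the end. A subword consisting of `true` only is the case
-- `p = []`.
Occurs-Q⁻ : ∀ u {σ} → Permutation σ → head? σ ≡ just 0 → Occurs (Q u) σ →
  ∃[ i ] ∃[ p ] ∃[ z ] (p ++ replicate i false ≡ false ∷ z × replicate i true ++ p ⊆ u × Q (false ∷ z) ≡ σ)
Occurs-Q⁻ u {σ} pσ hd (occurs r e) with Embeds-Q⁻ u (Permutation-resp-↭ (Rotation⇒↭ r) pσ) e
... | y , ι , refl with leading-trues y
... | zero , [] , refl , _ = contradiction (trans (sym hd) (cong head? (Perm.↭-empty-inv (Rotation⇒↭ r)))) λ ()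
... | suc i , [] , refl , _ = suc i , [] , replicate i false , refl , ι ,
  sym (rotation-from-0-unique (Rotation-trans r (Q-rotate (suc i) [])) (unique pσ) hd refl)
... | i , false ∷ p , refl , _ = i , false ∷ p , p ++ replicate i false , refl , ι ,
  sym (rotation-from-0-unique (Rotation-trans r (Q-rotate i (false ∷ p))) (unique pσ) hd refl)
... | i , true ∷ p , refl , inj₁ ()
... | i , true ∷ p , refl , inj₂ ()

Occurs-Q⁺ : ∀ {u z} → z ⊆ u → Occurs (Q u) (Q z)
Occurs-Q⁺ ι = occurs Rotation-refl (Embeds-Q⁺ ι)

-- Descents, inverses and uniqueness of the word

positions-≥ : ∀ b k v → All (k ≤_) (positions b k v)
positions-≥ b k [] = []
positions-≥ false k (false ∷ v) = ≤-refl ∷ All.map <⇒≤ (positions-≥ false (suc k) v)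
positions-≥ false k (true ∷ v) = All.map <⇒≤ (positions-≥ false (suc k) v)
positions-≥ true k (false ∷ v) = All.map <⇒≤ (positions-≥ true (suc k) v)
positions-≥ true k (true ∷ v) = ≤-refl ∷ All.map <⇒≤ (positions-≥ true (suc k) v)

Increasing : List ℕ → Set
Increasing = AllPairs _<_

positions-increasing : ∀ b k v → Increasing (positions b k v)
positions-increasing b k [] = []
positions-increasing false k (false ∷ v) = positions-≥ false (suc k) v ∷ positions-increasing false (suc k) v
positions-increasing false k (true ∷ v) = positions-increasing false (suc k) v
positions-increasing true k (false ∷ v) = positions-increasing true (suc k) v
positions-increasing true k (true ∷ v) = positions-≥ true (suc k) v ∷ positions-increasing true (suc k) v

≤⇒<ᵇ-false : ∀ {m n} → m ≤ n → (n <ᵇ m) ≡ false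
≤⇒<ᵇ-false {m} {n} le with n <ᵇ m in eq
... | false = refl
... | true = contradiction (<ᵇ⇒< n m (subst T (sym eq) tt)) (≤⇒≯ le)

<⇒<ᵇ-true : ∀ {m n} → m < n → (m <ᵇ n) ≡ true
<⇒<ᵇ-true lt = Equivalence.to T-≡ (<⇒<ᵇ lt)

descents-increasing : ∀ {xs} → Increasing xs → descents xs ≡ 0
descents-increasing [] = refl
descents-increasing (_ ∷ []) = refl
descents-increasing {x ∷ y ∷ xs} ((lt ∷ _) ∷ inc) rewrite ≤⇒<ᵇ-false (<⇒≤ lt) = descents-increasing inc

descents-++-increasing : ∀ {xs ys} → Increasing xs → Increasing ys → descents (xs ++ ys) ≤ 1
descents-++-increasing [] inc = ≤-trans (≤-reflexive (descents-increasing inc)) z≤n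
descents-++-increasing {x ∷ []} {[]} (_ ∷ []) inc = z≤n
descents-++-increasing {x ∷ []} {y ∷ ys} (_ ∷ []) inc rewrite descents-increasing inc with y <ᵇ x
... | false = z≤n
... | true = s≤s z≤n
descents-++-increasing {x ∷ y ∷ xs} ((lt ∷ _) ∷ inc) inc' rewrite ≤⇒<ᵇ-false (<⇒≤ lt) = descents-++-increasing inc inc'

descents-P : ∀ v → descents (P v) ≤ 1
descents-P v = descents-++-increasing (positions-increasing false 0 v) (positions-increasing true 0 v)

drops : Word → ℕ
drops [] = 0
drops (x ∷ []) = 0
drops (true ∷ false ∷ u) = suc (drops (false ∷ u))
drops (true ∷ true ∷ u) = drops (true ∷ u)
drops (false ∷ y ∷ u) = drops (y ∷ u)

ascent-step : ∀ {b m n} → b ≡ false → m ≡ n → (if b then 1 else 0) + m ≡ n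
ascent-step refl e = e

descent-step : ∀ {b m n} → b ≡ true → m ≡ n → (if b then 1 else 0) + m ≡ suc n
descent-step refl e = cong suc e

-- The hypothesis keeps all labels of `false` below those of `true`, so the label decreases exactly
-- where a `true` is followed by a `false`.
descents-label : ∀ l h u → l + count false u ≤ h → descents (label l h u) ≡ drops u
descents-label l h [] le = refl
descents-label l h (false ∷ []) le = refl
descents-label l h (true ∷ []) le = refl
descents-label l h (false ∷ false ∷ u) le =
  ascent-step (≤⇒<ᵇ-false (n≤1+n l)) (descents-label (suc l) h (false ∷ u) (+-suc-≤ {l} le))
descents-label l h (false ∷ true ∷ u) le =
  ascent-step (≤⇒<ᵇ-false (<⇒≤ (+-suc-< le))) (descents-label (suc l) h (true ∷ u) (+-suc-≤ {l} le))
descents-label l h (true ∷ false ∷ u) le =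
  descent-step (<⇒<ᵇ-true (+-suc-< le)) (descents-label l (suc h) (false ∷ u) (m≤n⇒m≤1+n le))
descents-label l h (true ∷ true ∷ u) le =
  ascent-step (≤⇒<ᵇ-false (n≤1+n h)) (descents-label l (suc h) (true ∷ u) (m≤n⇒m≤1+n le))

descents-Q : ∀ u → descents (Q u) ≡ drops u
descents-Q u = descents-label 0 (count false u) u ≤-refl

module _ {A : Set} where

  !!-< : ∀ {xs : List A} {i x} → xs !! i ≡ just x → i < length xs
  !!-< {x ∷ xs} {zero} e = s≤s z≤n
  !!-< {x ∷ xs} {suc i} e = s≤s (!!-< {xs} e)

  !!-just : ∀ {xs : List A} {i} → i < length xs → ∃[ x ] (xs !! i ≡ just x)
  !!-just {x ∷ xs} {zero} lt = x , refl
  !!-just {x ∷ xs} {suc i} (s≤s lt) = !!-just {xs} lt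

  !!-∈ : ∀ {xs : List A} {i x} → xs !! i ≡ just x → x ∈ xs
  !!-∈ {x ∷ xs} {zero} refl = here refl
  !!-∈ {x ∷ xs} {suc i} e = there (!!-∈ {xs} e)

  ∈-!! : ∀ {xs : List A} {x} → x ∈ xs → ∃[ i ] (xs !! i ≡ just x)
  ∈-!! (here refl) = 0 , refl
  ∈-!! (there x∈) = let (i , e) = ∈-!! x∈ in suc i , e

  !!-functional : ∀ {xs : List A} {i x y} → xs !! i ≡ just x → xs !! i ≡ just y → x ≡ y
  !!-functional e f = just-injective (trans (sym e) f)

  !!-injective : ∀ {xs : List A} {i j x} → Unique xs → xs !! i ≡ just x → xs !! j ≡ just x → i ≡ j
  !!-injective {x ∷ xs} {zero} {zero} u e f = refl
  !!-injective {x ∷ xs} {zero} {suc j} (x∉ ∷ u) refl f = contradiction refl (All.lookup x∉ (!!-∈ {xs} f))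
  !!-injective {x ∷ xs} {suc i} {zero} (x∉ ∷ u) e refl = contradiction refl (All.lookup x∉ (!!-∈ {xs} e))
  !!-injective {x ∷ xs} {suc i} {suc j} (x∉ ∷ u) e f = cong suc (!!-injective u e f)

  !!-++⁻ : ∀ (xs : List A) {ys i x} → (xs ++ ys) !! i ≡ just x →
    xs !! i ≡ just x ⊎ ∃[ j ] (i ≡ length xs + j × ys !! j ≡ just x)
  !!-++⁻ [] e = inj₂ (_ , refl , e)
  !!-++⁻ (x ∷ xs) {i = zero} e = inj₁ e
  !!-++⁻ (x ∷ xs) {i = suc i} e with !!-++⁻ xs e
  ... | inj₁ f = inj₁ f
  ... | inj₂ (j , refl , f) = inj₂ (j , refl , f)

  !!-++⁺ˡ : ∀ (xs : List A) {ys i x} → xs !! i ≡ just x → (xs ++ ys) !! i ≡ just x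
  !!-++⁺ˡ (x ∷ xs) {i = zero} e = e
  !!-++⁺ˡ (x ∷ xs) {i = suc i} e = !!-++⁺ˡ xs e

  !!-++⁺ʳ : ∀ (xs : List A) {ys} i → (xs ++ ys) !! (length xs + i) ≡ ys !! i
  !!-++⁺ʳ [] i = refl
  !!-++⁺ʳ (x ∷ xs) i = !!-++⁺ʳ xs i

  !!-ext : ∀ (xs ys : List A) → length xs ≡ length ys →
    (∀ {i x y} → xs !! i ≡ just x → ys !! i ≡ just y → x ≡ y) → xs ≡ ys
  !!-ext [] [] eq f = refl
  !!-ext (x ∷ xs) (y ∷ ys) eq f = cong₂ _∷_ (f {0} refl refl) (!!-ext xs ys (suc-injective eq) (λ {i} → f {suc i}))

Inverse : List ℕ → List ℕ → Set
Inverse xs ys = ∀ i v → xs !! i ≡ just v → ys !! v ≡ just i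

positions-label-false : ∀ k l h u i {v} → positions false k u !! i ≡ just v →
  ∃[ d ] (v ≡ k + d × label l h u !! d ≡ just (l + i))
positions-label-false k l h (false ∷ u) zero refl = 0 , sym (+-identityʳ k) , cong just (sym (+-identityʳ l))
positions-label-false k l h (false ∷ u) (suc i) e with positions-label-false (suc k) (suc l) h u i e
... | d , refl , f = suc d , sym (+-suc k d) , trans f (cong just (sym (+-suc l i)))
positions-label-false k l h (true ∷ u) i e with positions-label-false (suc k) l (suc h) u i e
... | d , refl , f = suc d , sym (+-suc k d) , f

positions-label-true : ∀ k l h u i {v} → positions true k u !! i ≡ just v →
  ∃[ d ] (v ≡ k + d × label l h u !! d ≡ just (h + i))
positions-label-true k l h (true ∷ u) zero refl = 0 , sym (+-identityʳ k) , cong just (sym (+-identityʳ h))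
positions-label-true k l h (true ∷ u) (suc i) e with positions-label-true (suc k) l (suc h) u i e
... | d , refl , f = suc d , sym (+-suc k d) , trans f (cong just (sym (+-suc h i)))
positions-label-true k l h (false ∷ u) i e with positions-label-true (suc k) (suc l) h u i e
... | d , refl , f = suc d , sym (+-suc k d) , f

-- Entry `i` of `P u` is the position of the letter that `Q u` labels `i`: the letters `false` are
-- listed and numbered before the letters `true`, each kind from left to right.
P-Q-inverse : ∀ u → Inverse (P u) (Q u)
P-Q-inverse u i v e with !!-++⁻ (positions false 0 u) e
... | inj₁ f with positions-label-false 0 0 (count false u) u i f
... | d , refl , g = g
P-Q-inverse u i v e | inj₂ (j , refl , f) with positions-label-true 0 0 (count false u) u j f
... | d , refl , g = trans g (cong (λ n → just (n + j)) (sym (length-positions false 0 u)))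

inverse-unique : ∀ {xs ys zs} → length xs ≡ length ys → Unique zs → Inverse xs zs → Inverse ys zs → xs ≡ ys
inverse-unique {xs} {ys} eq u f g = !!-ext xs ys eq λ e e' → !!-injective u (f _ _ e) (g _ _ e')

Inverse-sym : ∀ {xs ys} → Permutation xs → length ys ≡ length xs → Inverse xs ys → Inverse ys xs
Inverse-sym {xs} {ys} p eq f v i e with ∈-!! (covers p (subst (v <_) eq (!!-< {xs = ys} e)))
... | j , e' with !!-functional {xs = ys} e (f j v e')
... | refl = e'

positions-injective : ∀ k y w → length y ≡ length w → positions false k y ≡ positions false k w → y ≡ w
positions-injective k [] [] eq e = refl
positions-injective k (false ∷ y) (false ∷ w) eq e = cong (false ∷_) (positions-injective (suc k) y w (suc-injective eq) (∷-injectiveʳ e))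
positions-injective k (true ∷ y) (true ∷ w) eq e = cong (true ∷_) (positions-injective (suc k) y w (suc-injective eq) e)
positions-injective k (false ∷ y) (true ∷ w) eq e with subst (All (suc k ≤_)) (sym e) (positions-≥ false (suc k) w)
... | lt ∷ _ = contradiction lt (<-irrefl refl)
positions-injective k (true ∷ y) (false ∷ w) eq e with subst (All (suc k ≤_)) e (positions-≥ false (suc k) y)
... | lt ∷ _ = contradiction lt (<-irrefl refl)

drop-positions : ∀ k {w} → true ∷ false ∷ [] ⊆ w → ∃[ t ] ∃[ f ] (t ∈ positions true k w × f ∈ positions false k w × t < f)
drop-positions k (false ∷ʳ ι) with drop-positions (suc k) ι
... | t , f , a , b , c = t , f , a , there b , c
drop-positions k (true ∷ʳ ι) with drop-positions (suc k) ι
... | t , f , a , b , c = t , f , there a , b , c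
drop-positions k {true ∷ w} (refl ∷ ι) = k , _ , here refl , proj₂ (false∈ (suc k) ι) , All.lookup (positions-≥ false (suc k) w) (proj₂ (false∈ (suc k) ι))
  where
  false∈ : ∀ k {w} → false ∷ [] ⊆ w → ∃[ f ] (f ∈ positions false k w)
  false∈ k (true ∷ʳ ι) = false∈ (suc k) ι
  false∈ k (false ∷ʳ ι) = let (f , p) = false∈ (suc k) ι in f , there p
  false∈ k (refl ∷ ι) = k , here refl

increasing-++ : ∀ xs {ys x y} → Increasing (xs ++ ys) → x ∈ xs → y ∈ ys → x < y
increasing-++ (x ∷ xs) (a ∷ inc) (here refl) y∈ = All.lookup a (∈-++⁺ʳ xs y∈)
increasing-++ (x ∷ xs) (a ∷ inc) (there x∈) y∈ = increasing-++ xs inc x∈ y∈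

head-≤ : ∀ {x xs y} → Increasing (x ∷ xs) → y ∈ x ∷ xs → x ≤ y
head-≤ inc (here refl) = ≤-refl
head-≤ (a ∷ _) (there y∈) = <⇒≤ (All.lookup a y∈)

-- Once both sides are cut at the same place, the low positions determine the word. A subword `10`
-- puts some high position of `w` below a low one; if the cuts differed, the increasing pieces of
-- `y` and `w` would overlap and force the opposite comparison.
P-injective : ∀ {y w} → true ∷ false ∷ [] ⊆ w → P y ≡ P w → y ≡ w
P-injective {y} {w} ι eq with drop-positions 0 ι | ++-≡-split (positions false 0 y) {c = positions false 0 w} eq
... | _ | inj₁ ([] , e , _) = positions-injective 0 y w len (sym (trans e (++-identityʳ _)))
  where len = trans (sym (length-P y)) (trans (cong length eq) (length-P w))
... | _ | inj₂ ([] , e , _) = positions-injective 0 y w len (trans e (++-identityʳ _))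
  where len = trans (sym (length-P y)) (trans (cong length eq) (length-P w))
... | t , f , t∈ , f∈ , t<f | inj₁ (c ∷ e , p , q) with ∈-++⁻ (positions false 0 y) (subst (f ∈_) p f∈)
... | inj₁ f∈y = ⊥-elim (<-asym t<f (<-trans
        (increasing-++ (positions false 0 y) (subst Increasing p (positions-increasing false 0 w)) f∈y (here refl))
        (increasing-++ (c ∷ e) (subst Increasing q (positions-increasing true 0 y)) (here refl) t∈)))
... | inj₂ f∈e = ⊥-elim (<-asym t<f (increasing-++ (c ∷ e) (subst Increasing q (positions-increasing true 0 y)) f∈e t∈))
P-injective {y} {w} ι eq | t , f , t∈ , f∈ , t<f | inj₂ (c ∷ e , p , q) =
  ⊥-elim (<-asym t<f (<-≤-trans
    (increasing-++ (positions false 0 w) (subst Increasing p (positions-increasing false 0 y)) f∈ (here refl))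
    (head-≤ (subst Increasing q (positions-increasing true 0 w)) (subst (t ∈_) q t∈))))

P≡⇐Q≡ : ∀ {y w} → Q y ≡ Q w → P y ≡ P w
P≡⇐Q≡ {y} {w} eq = inverse-unique
  (trans (length-P y) (trans (sym (length-Q y)) (trans (cong length eq) (trans (length-Q w) (sym (length-P w))))))
  (unique (Q-permutation w)) (subst (Inverse (P y)) eq (P-Q-inverse y)) (P-Q-inverse w)

Q-injective : ∀ {y w} → true ∷ false ∷ [] ⊆ w → Q y ≡ Q w → y ≡ w
Q-injective ι eq = P-injective ι (P≡⇐Q≡ eq)

Q≡P⇒P≡Q : ∀ {z w} → Q z ≡ P w → P z ≡ Q w
Q≡P⇒P≡Q {z} {w} eq = inverse-unique
  (trans (length-P z) (trans (sym (length-Q z)) (trans (cong length eq) (trans (length-P w) (sym (length-Q w))))))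
  (unique (P-permutation w)) (subst (Inverse (P z)) eq (P-Q-inverse z))
  (Inverse-sym {P w} {Q w} (P-permutation w) (trans (length-Q w) (sym (length-P w))) (P-Q-inverse w))

p1432-permutation : Permutation p1432
p1432-permutation = IsPerm⇒Permutation p1432 tt

-- An occurrence would make 1432, which starts with its minimum, a `P` itself, but 1432 has two
-- descents.
P-avoids-1432 : ∀ v → ¬ Contains (P v) p1432
P-avoids-1432 v c with Occurs-P⁻ v p1432-permutation refl (Contains⇒Occurs c)
... | z , eq , _ = contradiction (subst (λ xs → descents xs ≤ 1) eq (descents-P (false ∷ z))) λ { (s≤s ()) }

Q-avoids-1432 : ∀ u → ¬ Contains (Q u) p1432
Q-avoids-1432 u c with Occurs-Q⁻ u p1432-permutation refl (Contains⇒Occurs c)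
... | _ , _ , z , _ , _ , eq = excluded z eq
  where
  excluded : ∀ z → Q (false ∷ z) ≢ p1432
  excluded [] ()
  excluded (false ∷ []) ()
  excluded (true ∷ []) ()
  excluded (false ∷ _ ∷ []) ()
  excluded (true ∷ false ∷ []) ()
  excluded (true ∷ true ∷ []) ()
  excluded (false ∷ _ ∷ _ ∷ []) ()
  excluded (true ∷ false ∷ false ∷ []) ()
  excluded (true ∷ false ∷ true ∷ []) ()
  excluded (true ∷ true ∷ false ∷ []) ()
  excluded (true ∷ true ∷ true ∷ []) ()
  excluded (a ∷ b ∷ c ∷ d ∷ z) eq with trans (sym (length-Q (false ∷ a ∷ b ∷ c ∷ d ∷ z))) (cong length eq)
  ... | ()

positions-++ : ∀ b k v w → positions b k (v ++ w) ≡ positions b k v ++ positions b (k + length v) w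
positions-++ b k [] w = cong (λ j → positions b j w) (sym (+-identityʳ k))
positions-++ false k (false ∷ v) w = cong (k ∷_) (trans (positions-++ false (suc k) v w)
  (cong (λ j → positions false (suc k) v ++ positions false j w) (sym (+-suc k _))))
positions-++ false k (true ∷ v) w = trans (positions-++ false (suc k) v w)
  (cong (λ j → positions false (suc k) v ++ positions false j w) (sym (+-suc k _)))
positions-++ true k (false ∷ v) w = trans (positions-++ true (suc k) v w)
  (cong (λ j → positions true (suc k) v ++ positions true j w) (sym (+-suc k _)))
positions-++ true k (true ∷ v) w = cong (k ∷_) (trans (positions-++ true (suc k) v w)
  (cong (λ j → positions true (suc k) v ++ positions true j w) (sym (+-suc k _))))

positions-replicate : ∀ b k n → positions b k (replicate n b) ≡ range k n
positions-replicate b k zero = refl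
positions-replicate false k (suc n) = cong (k ∷_) (positions-replicate false (suc k) n)
positions-replicate true k (suc n) = cong (k ∷_) (positions-replicate true (suc k) n)

positions-replicate-not : ∀ b k n → positions b k (replicate n (not b)) ≡ []
positions-replicate-not b k zero = refl
positions-replicate-not false k (suc n) = positions-replicate-not false (suc k) n
positions-replicate-not true k (suc n) = positions-replicate-not true (suc k) n

blocks : ℕ → ℕ → ℕ → ℕ → Word
blocks a b c d = replicate a false ++ replicate b true ++ replicate c false ++ replicate d true

-- Both sides exchange two adjacent blocks of consecutive values.
P-blocks≡Q-blocks : ∀ a b c d → P (blocks a b c d) ≡ Q (blocks a c b d)
P-blocks≡Q-blocks a b c d = trans p (sym q)
  where
  rest = range a b ++ range (a + b + c) d
  pos-false : ∀ k → positions false k (blocks a b c d) ≡ range k a ++ range (k + a + b) c ++ []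
  pos-false k
    rewrite positions-++ false k (replicate a false) (replicate b true ++ replicate c false ++ replicate d true)
          | length-replicate a {false} | positions-replicate false k a
          | positions-++ false (k + a) (replicate b true) (replicate c false ++ replicate d true)
          | length-replicate b {true} | positions-replicate-not false (k + a) b
          | positions-++ false (k + a + b) (replicate c false) (replicate d true)
          | positions-replicate false (k + a + b) c
          | length-replicate c {false} | positions-replicate-not false (k + a + b + c) d = refl
  pos-true : ∀ k → positions true k (blocks a b c d) ≡ range (k + a) b ++ range (k + a + b + c) d
  pos-true k
    rewrite positions-++ true k (replicate a false) (replicate b true ++ replicate c false ++ replicate d true)
          | length-replicate a {false} | positions-replicate-not true k a
          | positions-++ true (k + a) (replicate b true) (replicate c false ++ replicate d true)
          | length-replicate b {true} | positions-replicate true (k + a) b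
          | positions-++ true (k + a + b) (replicate c false) (replicate d true)
          | positions-replicate-not true (k + a + b) c
          | length-replicate c {false} | positions-replicate true (k + a + b + c) d = refl
  p : P (blocks a b c d) ≡ range 0 a ++ range (a + b) c ++ rest
  p rewrite pos-false 0 | pos-true 0 =
    trans (++-assoc (range 0 a) _ rest) (cong (λ x → range 0 a ++ x ++ rest) (++-identityʳ (range (a + b) c)))
  low : count false (blocks a c b d) ≡ a + b
  low rewrite count-++ false (replicate a false) (replicate c true ++ replicate b false ++ replicate d true)
            | count-replicate false a | count-++ false (replicate c true) (replicate b false ++ replicate d true)
            | count-replicate-not false c | count-++ false (replicate b false) (replicate d true)
            | count-replicate false b | count-replicate-not false d = cong (a +_) (+-identityʳ b)
  q : Q (blocks a c b d) ≡ range 0 a ++ range (a + b) c ++ rest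
  q rewrite low
          | label-++ 0 (a + b) (replicate a false) (replicate c true ++ replicate b false ++ replicate d true)
          | label-replicate-false 0 (a + b) a | count-replicate false a | count-replicate-not true a | +-identityʳ (a + b)
          | label-++ a (a + b) (replicate c true) (replicate b false ++ replicate d true)
          | label-replicate-true a (a + b) c | count-replicate-not false c | count-replicate true c | +-identityʳ a
          | label-++ a (a + b + c) (replicate b false) (replicate d true)
          | label-replicate-false a (a + b + c) b | count-replicate-not true b | +-identityʳ (a + b + c)
          | label-replicate-true (a + count false (replicate b false)) (a + b + c) d = refl

count-complement-reverse : ∀ b u → count b (complement (reverse u)) ≡ count (not b) u
count-complement-reverse b [] = refl
count-complement-reverse b (c ∷ u)
  rewrite unfold-reverse c u | map-++ not (reverse u) (c ∷ []) | count-++ b (complement (reverse u)) (not c ∷ [])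
        | count-complement-reverse b u | +-comm (count (not b) u) (count b (not c ∷ [])) = step b c
  where
  step : ∀ b c → count b (not c ∷ []) + count (not b) u ≡ count (not b) (c ∷ u)
  step false false = refl
  step false true = refl
  step true false = refl
  step true true = refl

-- The two equations say that under the reflection `x ↦ N - x` the block of labels used for `false`
-- in `u` becomes the block used for `true` in the reversed complement, and vice versa.
reverse-map-label : ∀ N u {l h l' h'} → l + h' + count false u ≡ suc N → h + l' + count true u ≡ suc N →
  reverse (map (N ∸_) (label l h u)) ≡ label l' h' (complement (reverse u))
reverse-map-label N [] p q = refl
reverse-map-label N (false ∷ u) {l} {h} {l'} {h'} p q
  rewrite unfold-reverse (N ∸ l) (map (N ∸_) (label (suc l) h u))
        | unfold-reverse false u | map-++ not (reverse u) (false ∷ [])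
        | label-++ l' h' (complement (reverse u)) (true ∷ [])
        | count-complement-reverse true u =
  cong₂ (λ a b → a ++ b ∷ []) (reverse-map-label N u (trans (sym (+-suc (l + h') _)) p) q)
    (trans (cong (_∸ l) (sym (trans (sym (+-assoc l h' _)) (suc-injective (trans (sym (+-suc (l + h') _)) p)))))
      (m+n∸m≡n l _))
reverse-map-label N (true ∷ u) {l} {h} {l'} {h'} p q
  rewrite unfold-reverse (N ∸ h) (map (N ∸_) (label l (suc h) u))
        | unfold-reverse true u | map-++ not (reverse u) (true ∷ [])
        | label-++ l' h' (complement (reverse u)) (false ∷ [])
        | count-complement-reverse false u =
  cong₂ (λ a b → a ++ b ∷ []) (reverse-map-label N u p (trans (sym (+-suc (h + l') _)) q))
    (trans (cong (_∸ h) (sym (trans (sym (+-assoc h l' _)) (suc-injective (trans (sym (+-suc (h + l') _)) q)))))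
      (m+n∸m≡n h _))

rc : List ℕ → List ℕ
rc xs = reverse (map (pred (length xs) ∸_) xs)

rc-Q : ∀ u → rc (Q u) ≡ Q (complement (reverse u))
rc-Q [] = refl
rc-Q u@(b ∷ u') rewrite count-complement-reverse false u | length-Q u =
  reverse-map-label (length u') u (trans (+-comm (count true u) _) (sym (length≡counts u)))
    (trans (cong (_+ count true u) (+-identityʳ _)) (sym (length≡counts u)))

-- Classification of the permutations avoiding 1432

-- Subsequences are assembled from the right: `s` uses only entries after index `i`, so the entry at
-- `i` may be put in front, and `k` leaves room for the next entry to its left.
at∷⊆drop : ∀ {A : Set} {xs s : List A} {i k a} → xs !! i ≡ just a → k ≤ i → s ⊆ drop (suc i) xs → a ∷ s ⊆ drop k xs
at∷⊆drop {xs = x ∷ xs} {i = zero} refl z≤n σ = refl ∷ σ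
at∷⊆drop {xs = x ∷ xs} {i = suc i} e z≤n σ = x ∷ʳ at∷⊆drop {xs = xs} e z≤n σ
at∷⊆drop {xs = x ∷ xs} {i = suc i} e (s≤s le) σ = at∷⊆drop {xs = xs} e le σ

sorted-OrderIso : ∀ {ps} → AllPairs (λ p q → proj₁ p < proj₁ q × proj₂ p < proj₂ q) ps → OrderIso ps
sorted-OrderIso [] ()
sorted-OrderIso (a ∷ s) = OrderIso-∷ (All.map (λ (p , q) → <⇒SameOrder p q) a) (sorted-OrderIso s)

record Point (xs : List ℕ) : Set where
  constructor point
  field
    ix vl : ℕ
    at : xs !! ix ≡ just vl

open Point

module Avoiding1432 {xs : List ℕ} (perm : Permutation xs) (starts : head? xs ≡ just 0)
  (avoids : ¬ Contains xs p1432) where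

  nonempty : xs ≢ []
  nonempty refl = contradiction starts λ ()

  first : xs !! 0 ≡ just 0
  first = go xs starts
    where
    go : ∀ ys → head? ys ≡ just 0 → ys !! 0 ≡ just 0
    go (y ∷ ys) e = e

  same-ix : (p q : Point xs) → ix p ≡ ix q → vl p ≡ vl q
  same-ix (point _ _ e) (point _ _ f) refl = !!-functional {xs = xs} e f

  same-vl : (p q : Point xs) → vl p ≡ vl q → ix p ≡ ix q
  same-vl (point _ _ e) (point _ _ f) refl = !!-injective (unique perm) e f

  -- The leading 0 followed by a decreasing triple is an occurrence of 1432; the local lemmas
  -- separate the triple from that first entry.
  no-321 : (p q r : Point xs) → ix p < ix q → ix q < ix r → vl r < vl q → vl q < vl p → ⊥
  no-321 p q r pq qr rq qp = avoids (Occurs⇒Contains nonempty (occurs Rotation-refl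
    (embeds ((0 , 0) ∷ (vl p , 3) ∷ (vl q , 2) ∷ (vl r , 1) ∷ [])
      (OrderIso-⊆ (λ { (here refl) → here refl ; (there (here refl)) → there (there (there (here refl)))
                     ; (there (there (here refl))) → there (there (here refl))
                     ; (there (there (there (here refl)))) → there (here refl) })
        (sorted-OrderIso {(0 , 0) ∷ (vl r , 1) ∷ (vl q , 2) ∷ (vl p , 3) ∷ []}
          (((0<r , s≤s z≤n) ∷ (<-trans 0<r rq , s≤s z≤n) ∷ (<-trans 0<r (<-trans rq qp) , s≤s z≤n) ∷ []) ∷
           ((rq , s≤s (s≤s z≤n)) ∷ (<-trans rq qp , s≤s (s≤s z≤n)) ∷ []) ∷
           ((qp , s≤s (s≤s (s≤s z≤n))) ∷ []) ∷ [] ∷ [])))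
      (at∷⊆drop {xs = xs} first z≤n (at∷⊆drop {xs = xs} (at p) 0<p (at∷⊆drop {xs = xs} (at q) pq
        (at∷⊆drop {xs = xs} (at r) qr (minimum _)))))
      refl)))
    where
    0<r : 0 < vl r
    0<r = n≢0⇒n>0 λ e → <⇒≢ (≤-<-trans z≤n qr) (same-vl (point 0 0 first) r (sym e))
    0<p : 0 < ix p
    0<p = n≢0⇒n>0 λ e → <⇒≢ (<-trans 0<r (<-trans rq qp)) (same-ix (point 0 0 first) p (sym e))

  -- 2143 is a rotation of 1432. The permutations avoiding 321 and 2143 are the Grassmannian ones
  -- and their inverses; the lemmas on inversions below lead to this.
  no-2143 : (p q r s : Point xs) → ix p < ix q → ix q < ix r → ix r < ix s →
    vl q < vl p → vl p < vl s → vl s < vl r → ⊥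
  no-2143 p q r s pq qr rs qp ps sr = avoids (Occurs⇒Contains nonempty (occurs
    (rot (0 ∷ 3 ∷ 2 ∷ []) (1 ∷ []) refl refl)
    (embeds ((vl p , 1) ∷ (vl q , 0) ∷ (vl r , 3) ∷ (vl s , 2) ∷ [])
      (OrderIso-⊆ (λ { (here refl) → there (here refl) ; (there (here refl)) → here refl
                     ; (there (there (here refl))) → there (there (there (here refl)))
                     ; (there (there (there (here refl)))) → there (there (here refl)) })
        (sorted-OrderIso {(vl q , 0) ∷ (vl p , 1) ∷ (vl s , 2) ∷ (vl r , 3) ∷ []}
          (((qp , s≤s z≤n) ∷ (<-trans qp ps , s≤s z≤n) ∷ (<-trans qp (<-trans ps sr) , s≤s z≤n) ∷ []) ∷
           ((ps , s≤s (s≤s z≤n)) ∷ (<-trans ps sr , s≤s (s≤s z≤n)) ∷ []) ∷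
           ((sr , s≤s (s≤s (s≤s z≤n))) ∷ []) ∷ [] ∷ [])))
      (at∷⊆drop {xs = xs} (at p) z≤n (at∷⊆drop {xs = xs} (at q) pq (at∷⊆drop {xs = xs} (at r) qr
        (at∷⊆drop {xs = xs} (at s) rs (minimum _)))))
      refl)))

  record Inversion : Set where
    constructor inversion
    field
      hi lo : Point xs
      ix< : ix hi < ix lo
      vl> : vl lo < vl hi

  open Inversion

  tops-increasing : (s t : Inversion) → vl (hi s) < vl (hi t) → ix (hi s) < ix (hi t)
  tops-increasing s t lt with <-cmp (ix (hi s)) (ix (hi t))
  ... | tri< a _ _ = a
  ... | tri≈ _ e _ = ⊥-elim (<-irrefl (same-ix (hi s) (hi t) e) lt)
  ... | tri> _ _ c = ⊥-elim (no-321 (hi t) (hi s) (lo s) c (ix< s) (vl> s) lt)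

  tops-increasing' : (s t : Inversion) → ix (hi s) < ix (hi t) → vl (hi s) < vl (hi t)
  tops-increasing' s t lt with <-cmp (vl (hi s)) (vl (hi t))
  ... | tri< a _ _ = a
  ... | tri≈ _ e _ = ⊥-elim (<-irrefl (same-vl (hi s) (hi t) e) lt)
  ... | tri> _ _ c = ⊥-elim (no-321 (hi s) (hi t) (lo t) lt (ix< t) (vl> t) c)

  bottoms-increasing : (s t : Inversion) → vl (lo s) < vl (lo t) → ix (lo s) < ix (lo t)
  bottoms-increasing s t lt with <-cmp (ix (lo s)) (ix (lo t))
  ... | tri< a _ _ = a
  ... | tri≈ _ e _ = ⊥-elim (<-irrefl (same-ix (lo s) (lo t) e) lt)
  ... | tri> _ _ c = ⊥-elim (no-321 (hi t) (lo t) (lo s) (ix< t) c lt (vl> t))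

  bottoms-increasing' : (s t : Inversion) → ix (lo s) < ix (lo t) → vl (lo s) < vl (lo t)
  bottoms-increasing' s t lt with <-cmp (vl (lo s)) (vl (lo t))
  ... | tri< a _ _ = a
  ... | tri≈ _ e _ = ⊥-elim (<-irrefl (same-vl (lo s) (lo t) e) lt)
  ... | tri> _ _ c = ⊥-elim (no-321 (hi s) (lo s) (lo t) (ix< s) lt c (vl> s))

  top≢bottom : (s t : Inversion) → ix (hi s) ≢ ix (lo t)
  top≢bottom s t e = no-321 (hi t) (hi s) (lo s) (subst (ix (hi t) <_) (sym e) (ix< t)) (ix< s) (vl> s)
    (subst (_< vl (hi t)) (sym (same-ix (hi s) (lo t) e)) (vl> t))

  -- The bottom of `b` separates `s` from `t` both in position and in value, so the four points of
  -- `s` and `t` form 2143.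
  top-bottom-top : (s b t : Inversion) → vl (hi s) < vl (lo b) → ix (lo b) < ix (hi t) → ⊥
  top-bottom-top s b t v i = no-2143 (hi s) (lo s) (hi t) (lo t) (ix< s)
    (<-trans (bottoms-increasing s b (<-trans (vl> s) v)) i) (ix< t) (vl> s)
    (<-trans v (bottoms-increasing' b t (<-trans i (ix< t)))) (vl> t)

  -- The previous argument for the inverse permutation: inversion exchanges tops with bottoms and
  -- fixes 2143.
  bottom-top-bottom : (b s c : Inversion) → ix (lo b) < ix (hi s) → vl (hi s) < vl (lo c) → ⊥
  bottom-top-bottom b s c i v = no-2143 (hi b) (lo b) (hi c) (lo c) (ix< b)
    (<-trans i (tops-increasing s c (<-trans v (vl> c)))) (ix< c) (vl> b)
    (<-trans (tops-increasing' b s (<-trans (ix< b) i)) v) (vl> c)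

  -- Call the upper (lower) points of inversions tops (bottoms). If no top is below a bottom, the values split into two
  -- increasing sequences, as in Q; if no bottom comes before a top, the positions do, as in P.
  tops-vs-bottoms : (s b b' s' : Inversion) → vl (hi s) < vl (lo b) → ix (lo b') < ix (hi s') → ⊥
  tops-vs-bottoms s b b' s' v i with <-cmp (vl (hi s)) (vl (lo b'))
  ... | tri< lt _ _ = top-bottom-top s b' s' lt i
  ... | tri≈ _ e _ = top≢bottom s b' (same-vl (hi s) (lo b') e)
  ... | tri> _ _ v' with <-cmp (ix (hi s)) (ix (lo b'))
  ... | tri> _ _ gt = bottom-top-bottom b' s b gt v
  ... | tri≈ _ e _ = top≢bottom s b' e
  ... | tri< i' _ _ with <-cmp (ix (hi s')) (ix (lo b))
  ... | tri> _ _ gt = top-bottom-top s b s' v gt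
  ... | tri≈ _ e _ = top≢bottom s' b e
  ... | tri< i'' _ _ with <-cmp (vl (hi s')) (vl (lo b))
  ... | tri< lt _ _ = bottom-top-bottom b' s' b i lt
  ... | tri≈ _ e _ = top≢bottom s' b (same-vl (hi s') (lo b) e)
  ... | tri> _ _ v'' = no-2143 (hi s) (lo b') (hi s') (lo b) i' i i'' v' v v''

record TwoDescents (xs : List ℕ) : Set where
  constructor twoDescents
  field
    {i j a b c d} : ℕ
    i<j : i < j
    at-a : xs !! i ≡ just a
    at-b : xs !! suc i ≡ just b
    at-c : xs !! j ≡ just c
    at-d : xs !! suc j ≡ just d
    b<a : b < a
    d<c : d < c

first-descent : ∀ xs → Unique xs → Increasing xs ⊎
  ∃[ as ] ∃[ x ] ∃[ y ] ∃[ bs ] (xs ≡ as ++ x ∷ y ∷ bs × y < x × Increasing (as ++ x ∷ []))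
first-descent [] u = inj₁ []
first-descent (x ∷ []) u = inj₁ ([] ∷ [])
first-descent (x ∷ y ∷ xs) ((x≢y ∷ _) ∷ u) with <-cmp x y
... | tri≈ _ e _ = contradiction e x≢y
... | tri> _ _ gt = inj₂ ([] , x , y , xs , refl , gt , [] ∷ [])
... | tri< lt _ _ with first-descent (y ∷ xs) u
... | inj₁ inc = inj₁ ((lt ∷ All.tabulate (λ p → <-≤-trans lt (head-≤ inc (there p)))) ∷ inc)
... | inj₂ ([] , _ , z , bs , refl , gt , inc) =
  inj₂ (x ∷ [] , y , z , bs , refl , gt , (lt ∷ []) ∷ inc)
... | inj₂ (_ ∷ as , w , z , bs , refl , gt , inc) =
  inj₂ (x ∷ y ∷ as , w , z , bs , refl , gt , (lt ∷ All.tabulate (λ p → <-≤-trans lt (head-≤ inc (there p)))) ∷ inc)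

unique-++ʳ : ∀ (as : List ℕ) {bs} → Unique (as ++ bs) → Unique bs
unique-++ʳ [] u = u
unique-++ʳ (a ∷ as) (_ ∷ u) = unique-++ʳ as u

!!-offset : ∀ {A : Set} (as : List A) {bs} i {x} → bs !! i ≡ just x → (as ++ bs) !! (length as + i) ≡ just x
!!-offset as i e = trans (!!-++⁺ʳ as i) e

split-increasing : ∀ xs → Unique xs →
  (∃[ as ] ∃[ bs ] (xs ≡ as ++ bs × Increasing as × Increasing bs)) ⊎ TwoDescents xs
split-increasing xs u with first-descent xs u
... | inj₁ inc = inj₁ (xs , [] , sym (++-identityʳ xs) , inc , [])
... | inj₂ (as , x , y , bs , refl , gt , inc) with first-descent (y ∷ bs) (unique-++ʳ (x ∷ []) (unique-++ʳ as u))
... | inj₁ inc' = inj₁ (as ++ x ∷ [] , y ∷ bs , sym (++-assoc as _ _) , inc , inc')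
... | inj₂ (cs , z , w , ds , e , gt' , _) = inj₂ (twoDescents {i = length as + 0} {length as + suc (length cs + 0)}
  (+-monoʳ-< (length as) (s≤s z≤n))
  (!!-offset as 0 refl)
  (trans (cong ((as ++ x ∷ y ∷ bs) !!_) (sym (+-suc (length as) 0))) (!!-offset as 1 refl))
  (!!-offset as (suc (length cs + 0)) (trans (cong (_!! (length cs + 0)) e) (!!-offset cs 0 refl)))
  (trans (cong ((as ++ x ∷ y ∷ bs) !!_) (sym (+-suc (length as) _)))
    (!!-offset as (suc (suc (length cs + 0))) (trans (cong₂ _!!_ e (sym (+-suc (length cs) 0))) (!!-offset cs 1 refl))))
  gt gt')

min-of-range : ∀ {k n x} → x ∈ range k n → k ≤ x
min-of-range {n = suc n} (here refl) = ≤-refl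
min-of-range {n = suc n} (there x∈) = <⇒≤ (min-of-range x∈)

-- The smallest remaining value `k` must head one of the two increasing lists, and which one decides
-- the next letter.
increasing-pair⇒positions : ∀ n k as bs → Increasing as → Increasing bs → as ++ bs ↭ range k n →
  ∃[ v ] (positions false k v ≡ as × positions true k v ≡ bs)
increasing-pair⇒positions zero k as bs ia ib p with as | bs | Perm.↭-empty-inv p
... | [] | [] | _ = [] , refl , refl
increasing-pair⇒positions (suc n) k as bs ia ib p with ∈-++⁻ as (Perm.∈-resp-↭ (↭-sym p) (here refl))
increasing-pair⇒positions (suc n) k (a ∷ as) bs ia@(_ ∷ ia') ib p | inj₁ k∈
  with ≤-antisym (head-≤ ia k∈) (min-of-range {n = suc n} (Perm.∈-resp-↭ p (here refl)))
... | refl with increasing-pair⇒positions n (suc k) as bs ia' ib (Perm.drop-∷ p)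
... | v , e , f = false ∷ v , cong (k ∷_) e , f
increasing-pair⇒positions (suc n) k as (b ∷ bs) ia ib@(_ ∷ ib') p | inj₂ k∈
  with ≤-antisym (head-≤ ib k∈) (min-of-range {n = suc n} (Perm.∈-resp-↭ p (∈-++⁺ʳ as (here refl))))
... | refl with increasing-pair⇒positions n (suc k) as bs ia ib' (Perm.drop-∷ (↭-trans (↭-sym (Perm.shift b as bs)) p))
... | v , e , f = true ∷ v , e , cong (k ∷_) f

nonempty-increasing-pair⇒P : ∀ {a as bs} → Permutation (a ∷ as ++ bs) → a ≡ 0 →
  Increasing (a ∷ as) → Increasing bs → ∃[ v ] (a ∷ as ++ bs ≡ P (false ∷ v))
nonempty-increasing-pair⇒P {a} {as} {bs} p refl ia ib
  with increasing-pair⇒positions (length (a ∷ as ++ bs)) 0 (a ∷ as) bs ia ib (↭-trans p (↭-reflexive (upTo≡range _)))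
... | false ∷ v , e , f = v , sym (cong₂ _++_ e f)
... | true ∷ v , e , f with subst (All (1 ≤_)) e (positions-≥ false 1 v)
... | () ∷ _

increasing-pair⇒P : ∀ {as bs} → Permutation (as ++ bs) → head? (as ++ bs) ≡ just 0 →
  Increasing as → Increasing bs → ∃[ v ] (as ++ bs ≡ P (false ∷ v))
increasing-pair⇒P {a ∷ as} p h ia ib = nonempty-increasing-pair⇒P p (just-injective h) ia ib
-- The word has to start with `false`, so a single increasing sequence is taken as the first half.
increasing-pair⇒P {[]} {b ∷ bs} p h ia ib
  with nonempty-increasing-pair⇒P {b} {bs} {[]} (subst Permutation (sym (++-identityʳ _)) p) (just-injective h) ib []
... | v , e = v , trans (sym (++-identityʳ _)) e

choose : ∀ {R : ℕ → ℕ → Set} n → (∀ v → v < n → ∃[ i ] R v i) →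
  ∃[ ys ] (length ys ≡ n × (∀ {v i} → ys !! v ≡ just i → R v i))
choose zero f = [] , refl , λ ()
choose {R} (suc n) f with f 0 (s≤s z≤n) | choose {R ∘ suc} n (λ v lt → f (suc v) (s≤s lt))
... | i , r | ys , e , g = i ∷ ys , cong suc e , λ { {zero} refl → r ; {suc v} e → g e }

inverse-exists : ∀ {xs} → Permutation xs → ∃[ ys ] (length ys ≡ length xs × Permutation ys × Inverse xs ys × Inverse ys xs)
inverse-exists {xs} p with choose {λ v i → xs !! i ≡ just v} (length xs) (λ v lt → ∈-!! (covers p lt))
... | ys , len , f = ys , len , permutation , inverse , (λ v i e → f e)
  where
  inverse : Inverse xs ys
  inverse i v e with !!-just {xs = ys} (subst (v <_) (sym len) (bounded p (!!-∈ {xs = xs} e)))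
  ... | j , e' with !!-injective (unique p) e (f e')
  ... | refl = e'
  permutation : Permutation ys
  permutation = ↭-sym (unique⊆∧length⇒↭ (Uniqueₚ.upTo⁺ (length ys))
    (λ {i} i∈ → let (v , e) = !!-just {xs = xs} (subst (i <_) len (∈-upTo⁻ i∈)) in !!-∈ {xs = ys} (inverse i v e))
    (sym (length-upTo (length ys))))

head?≡!!0 : ∀ (xs : List ℕ) → head? xs ≡ xs !! 0
head?≡!!0 [] = refl
head?≡!!0 (x ∷ xs) = refl

-- Adjacent descents, of `xs` or of its inverse, give 321. Otherwise, a descent of the inverse is an
-- inversion of two consecutive values, and two separate ones put a top below a bottom; two separate
-- descents of `xs` put a bottom before a top. `tops-vs-bottoms` excludes the combination.
two-descents : ∀ {xs ys} → Permutation xs → head? xs ≡ just 0 → ¬ Contains xs p1432 →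
  Inverse ys xs → TwoDescents xs → TwoDescents ys → ⊥
two-descents {xs} {ys} p h av inv
  (twoDescents {i} {j} i<j ea eb ec ed b<a d<c) (twoDescents {i'} {j'} i'<j' ea' eb' ec' ed' b'<a' d'<c')
  with m≤n⇒m<n∨m≡n i<j | m≤n⇒m<n∨m≡n i'<j'
... | inj₂ refl | _ = no-321 (point i _ ea) (point j _ ec) (point (suc j) _ ed) (n<1+n _) (n<1+n _) d<c
    (subst (_< _) (!!-functional {xs = xs} eb ec) b<a)
  where open Avoiding1432 p h av
... | inj₁ _ | inj₂ refl = no-321 (point _ _ (inv _ _ ed')) (point _ _ (inv _ _ ec')) (point _ _ (inv _ _ ea')) d'<c'
    (subst (_< _) (!!-functional {xs = ys} eb' ec') b'<a') (n<1+n _) (n<1+n _)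
  where open Avoiding1432 p h av
... | inj₁ lt | inj₁ lt' = tops-vs-bottoms
    (inversion (point _ _ (inv _ _ eb')) (point _ _ (inv _ _ ea')) b'<a' (n<1+n _))
    (inversion (point _ _ (inv _ _ ed')) (point _ _ (inv _ _ ec')) d'<c' (n<1+n _))
    (inversion (point i _ ea) (point (suc i) _ eb) (n<1+n _) b<a)
    (inversion (point j _ ec) (point (suc j) _ ed) (n<1+n _) d<c)
    lt' lt
  where open Avoiding1432 p h av

classify : ∀ {xs} → Permutation xs → head? xs ≡ just 0 → ¬ Contains xs p1432 →
  (∃[ v ] xs ≡ P (false ∷ v)) ⊎ (∃[ u ] xs ≡ Q (false ∷ u))
classify {xs} p h av with split-increasing xs (unique p)
... | inj₁ (as , bs , refl , ia , ib) = inj₁ (increasing-pair⇒P p h ia ib)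
... | inj₂ td with inverse-exists p
... | ys , len , p' , inv , inv' with split-increasing ys (unique p')
... | inj₂ td' = ⊥-elim (two-descents p h av inv' td td')
... | inj₁ (as , bs , refl , ia , ib)
  with increasing-pair⇒P p' (trans (head?≡!!0 ys) (inv 0 0 (trans (sym (head?≡!!0 xs)) h))) ia ib
... | u , e = inj₂ (u , inverse-unique (trans (sym len) (trans (cong length e) (trans (length-P w) (sym (length-Q w)))))
    (unique (P-permutation w)) (subst (Inverse xs) e inv)
    (Inverse-sym {P w} {Q w} (P-permutation w) (trans (length-Q w) (sym (length-P w))) (P-Q-inverse w)))
  where w = false ∷ u

descents-descent : ∀ as {x y bs} → y < x → suc (descents (y ∷ bs)) ≤ descents (as ++ x ∷ y ∷ bs)
descents-descent [] {bs = bs} lt = ≤-reflexive (sym (descent-step {m = descents (_ ∷ bs)} (<⇒<ᵇ-true lt) refl))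
descents-descent (a ∷ []) {x} {bs = bs} lt = ≤-trans (descents-descent [] {bs = bs} lt) (m≤n+m _ (if x <ᵇ a then 1 else 0))
descents-descent (a ∷ b ∷ as) lt = ≤-trans (descents-descent (b ∷ as) lt) (m≤n+m _ (if b <ᵇ a then 1 else 0))

classify-one-descent : ∀ {xs} → Permutation xs → head? xs ≡ just 0 → descents xs ≤ 1 → ∃[ v ] xs ≡ P (false ∷ v)
classify-one-descent {xs} p h le with first-descent xs (unique p)
... | inj₁ inc with increasing-pair⇒P {xs} {[]} (subst Permutation (sym (++-identityʳ xs)) p)
  (trans (cong head? (++-identityʳ xs)) h) inc []
... | v , e = v , trans (sym (++-identityʳ xs)) e
classify-one-descent {xs} p h le | inj₂ (as , x , y , bs , refl , gt , inc)
  with first-descent (y ∷ bs) (unique-++ʳ (x ∷ []) (unique-++ʳ as (unique p)))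
... | inj₂ (cs , z , w , ds , e , gt' , _) = contradiction
  (≤-trans (s≤s (≤-trans (≤-trans (s≤s z≤n) (descents-descent cs gt')) (≤-reflexive (cong descents (sym e)))))
    (≤-trans (descents-descent as gt) le)) λ { (s≤s ()) }
... | inj₁ inc' with increasing-pair⇒P {as ++ x ∷ []} {y ∷ bs} (subst Permutation (sym eq) p) (trans (cong head? eq) h) inc inc'
  where eq = ++-assoc as (x ∷ []) (y ∷ bs)
... | v , e = v , trans (sym (++-assoc as _ _)) e

-- Counting permutations by counting words

module _ {A : Set} where

  length-filterᵇ-cong : ∀ {p q : A → Bool} xs → (∀ {x} → x ∈ xs → p x ≡ q x) →
    length (filterᵇ p xs) ≡ length (filterᵇ q xs)
  length-filterᵇ-cong [] eq = refl
  length-filterᵇ-cong {p} {q} (x ∷ xs) eq with p x | q x | eq (here refl)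
  ... | true | true | _ = cong suc (length-filterᵇ-cong xs (eq ∘ there))
  ... | false | false | _ = length-filterᵇ-cong xs (eq ∘ there)

  length-filterᵇ-split : ∀ (p q : A → Bool) xs → length (filterᵇ p xs) ≡
    length (filterᵇ (λ x → p x ∧ q x) xs) + length (filterᵇ (λ x → p x ∧ not (q x)) xs)
  length-filterᵇ-split p q [] = refl
  length-filterᵇ-split p q (x ∷ xs) with p x | q x
  ... | false | _ = length-filterᵇ-split p q xs
  ... | true | true = cong suc (length-filterᵇ-split p q xs)
  ... | true | false = trans (cong suc (length-filterᵇ-split p q xs)) (sym (+-suc _ _))

  ∈-filterᵇ⁻ : ∀ (p : A → Bool) {x} xs → x ∈ filterᵇ p xs → x ∈ xs × T (p x)
  ∈-filterᵇ⁻ p xs = ∈-filter⁻ (T? ∘ p) {xs = xs}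

  ∈-filterᵇ⁺ : ∀ (p : A → Bool) {x xs} → x ∈ xs → T (p x) → x ∈ filterᵇ p xs
  ∈-filterᵇ⁺ p = ∈-filter⁺ (T? ∘ p)

  unique-filterᵇ : ∀ (p : A → Bool) {xs} → Unique xs → Unique (filterᵇ p xs)
  unique-filterᵇ p = Uniqueₚ.filter⁺ (T? ∘ p)

  unique-∷-map : ∀ (x : A) {xss} → Unique xss → Unique (map (x ∷_) xss)
  unique-∷-map x = Uniqueₚ.map⁺ ∷-injectiveʳ

words : ℕ → List Word
words zero = [] ∷ []
words (suc m) = map (false ∷_) (words m) ++ map (true ∷_) (words m)

∈-words⁺ : ∀ w → w ∈ words (length w)
∈-words⁺ [] = here refl
∈-words⁺ (false ∷ w) = ∈-++⁺ˡ (∈-map⁺ (false ∷_) (∈-words⁺ w))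
∈-words⁺ (true ∷ w) = ∈-++⁺ʳ (map (false ∷_) (words (length w))) (∈-map⁺ (true ∷_) (∈-words⁺ w))

∈-words⁻ : ∀ m {w} → w ∈ words m → length w ≡ m
∈-words⁻ zero (here refl) = refl
∈-words⁻ (suc m) w∈ with ∈-++⁻ (map (false ∷_) (words m)) w∈
... | inj₁ i with ∈-map⁻ (false ∷_) i
... | _ , j , refl = cong suc (∈-words⁻ m j)
∈-words⁻ (suc m) w∈ | inj₂ i with ∈-map⁻ (true ∷_) i
... | _ , j , refl = cong suc (∈-words⁻ m j)

words-unique : ∀ m → Unique (words m)
words-unique zero = [] ∷ []
words-unique (suc m) = Uniqueₚ.++⁺ (unique-∷-map false (words-unique m)) (unique-∷-map true (words-unique m))
  λ (i , j) → disjoint (∈-map⁻ (false ∷_) i) (∈-map⁻ (true ∷_) j)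
  where
  disjoint : ∀ {w} → (∃[ x ] (x ∈ words m × w ≡ false ∷ x)) → (∃[ x ] (x ∈ words m × w ≡ true ∷ x)) → ⊥
  disjoint (_ , _ , refl) (_ , _ , ())

-- Recursion on the first letter, instead of the length of a filtered list, makes the counting
-- recurrences follow by unfolding.
countWords : ℕ → (Word → Bool) → ℕ
countWords zero q = if q [] then 1 else 0
countWords (suc m) q = countWords m (q ∘ (false ∷_)) + countWords m (q ∘ (true ∷_))

length-filterᵇ-++ : ∀ {A : Set} (p : A → Bool) xs ys →
  length (filterᵇ p (xs ++ ys)) ≡ length (filterᵇ p xs) + length (filterᵇ p ys)
length-filterᵇ-++ p [] ys = refl
length-filterᵇ-++ p (x ∷ xs) ys with p x
... | true = cong suc (length-filterᵇ-++ p xs ys)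
... | false = length-filterᵇ-++ p xs ys

length-filterᵇ-map : ∀ {A B : Set} (p : B → Bool) (f : A → B) xs →
  length (filterᵇ p (map f xs)) ≡ length (filterᵇ (p ∘ f) xs)
length-filterᵇ-map p f [] = refl
length-filterᵇ-map p f (x ∷ xs) with p (f x)
... | true = cong suc (length-filterᵇ-map p f xs)
... | false = length-filterᵇ-map p f xs

countWords≡length : ∀ m q → countWords m q ≡ length (filterᵇ q (words m))
countWords≡length zero q with q []
... | true = refl
... | false = refl
countWords≡length (suc m) q = sym (trans (length-filterᵇ-++ q (map (false ∷_) (words m)) _)
  (cong₂ _+_ (trans (length-filterᵇ-map q (false ∷_) (words m)) (sym (countWords≡length m _)))
             (trans (length-filterᵇ-map q (true ∷_) (words m)) (sym (countWords≡length m _)))))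

countWords-cong : ∀ m {p q} → (∀ w → length w ≡ m → p w ≡ q w) → countWords m p ≡ countWords m q
countWords-cong zero eq = cong (λ b → if b then 1 else 0) (eq [] refl)
countWords-cong (suc m) eq = cong₂ _+_ (countWords-cong m λ w e → eq (false ∷ w) (cong suc e))
  (countWords-cong m λ w e → eq (true ∷ w) (cong suc e))

-- Injectivity is asked only on the words satisfying `q`, since `P` and `Q` identify all sorted
-- words of one length.
countWords-bijection : ∀ {A : Set} {p : A → Bool} {xs} {q m} (f : Word → A) → Unique xs →
  (∀ {x} → x ∈ xs → T (p x) → ∃[ w ] (length w ≡ m × T (q w) × f w ≡ x)) →
  (∀ {w} → length w ≡ m → T (q w) → f w ∈ xs × T (p (f w))) →
  (∀ {w w'} → T (q w) → T (q w') → f w ≡ f w' → w ≡ w') →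
  length (filterᵇ p xs) ≡ countWords m q
countWords-bijection {p = p} {xs} {q} {m} f u from to inj = trans
  (unique-⇔⇒length≡ (unique-filterᵇ p u)
    (unique-map {f = f} (λ i j → inj (proj₂ (∈-filterᵇ⁻ q (words m) i)) (proj₂ (∈-filterᵇ⁻ q (words m) j)))
      (unique-filterᵇ q (words-unique m)))
    forward backward)
  (trans (length-map f (filterᵇ q (words m))) (sym (countWords≡length m q)))
  where
  forward : ∀ {x} → x ∈ filterᵇ p xs → x ∈ map f (filterᵇ q (words m))
  forward i with ∈-filterᵇ⁻ p xs i
  ... | x∈ , px with from x∈ px
  ... | w , refl , qw , refl = ∈-map⁺ f (∈-filterᵇ⁺ q (∈-words⁺ w) qw)
  backward : ∀ {x} → x ∈ map f (filterᵇ q (words m)) → x ∈ filterᵇ p xs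
  backward i with ∈-map⁻ f i
  ... | w , w∈ , refl with ∈-filterᵇ⁻ q (words m) w∈
  ... | w∈' , qw = let (a , b) = to (∈-words⁻ m w∈') qw in ∈-filterᵇ⁺ p a b

∈-allLists⁺ : ∀ {k} xs → All (_< k) xs → xs ∈ allLists (length xs) k
∈-allLists⁺ [] [] = here refl
∈-allLists⁺ (x ∷ xs) (lt ∷ al) = ∈-concatMap⁺ _
  (Any.map (λ { refl → ∈-map⁺ (x ∷_) (∈-allLists⁺ xs al) }) (∈-upTo⁺ lt))

∈-allLists⁻ : ∀ n k {xs} → xs ∈ allLists n k → length xs ≡ n
∈-allLists⁻ zero k (here refl) = refl
∈-allLists⁻ (suc n) k i with Any.satisfied (∈-concatMap⁻ (λ x → map (x ∷_) (allLists n k)) {xs = upTo k} i)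
... | x , j with ∈-map⁻ (x ∷_) j
... | _ , l , refl = cong suc (∈-allLists⁻ n k l)

allLists-unique : ∀ n k → Unique (allLists n k)
allLists-unique zero k = [] ∷ []
allLists-unique (suc n) k = go (upTo k) (Uniqueₚ.upTo⁺ k)
  where
  f = λ (x : ℕ) → map (x ∷_) (allLists n k)
  go : ∀ ys → Unique ys → Unique (concatMap f ys)
  go [] _ = []
  go (y ∷ ys) (y∉ ∷ u) = Uniqueₚ.++⁺ (unique-∷-map y (allLists-unique n k)) (go ys u) disjoint
    where
    disjoint : ∀ {v} → ¬ (v ∈ f y × v ∈ concatMap f ys)
    disjoint (i , j) with find (∈-concatMap⁻ f {xs = ys} j)
    ... | z , z∈ , l with ∈-map⁻ (y ∷_) i | ∈-map⁻ (z ∷_) l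
    ... | _ , _ , refl | _ , _ , e = All.lookup y∉ z∈ (∷-injectiveˡ e)

isCanonicalᵇ : List ℕ → Bool
isCanonicalᵇ xs = isPermᵇ xs ∧ startsWith0ᵇ xs ∧ not (containsᵇ xs p1432)

record Canonical (xs : List ℕ) : Set where
  constructor canonical
  field
    permutation : Permutation xs
    from-0 : head? xs ≡ just 0
    avoids-1432 : ¬ Contains xs p1432

  nonempty : xs ≢ []
  nonempty refl = contradiction from-0 λ ()

open Canonical

¬T⇒T-not : ∀ {b} → ¬ T b → T (not b)
¬T⇒T-not {false} _ = tt
¬T⇒T-not {true} f = f tt

T-not⇒¬T : ∀ {b} → T (not b) → ¬ T b
T-not⇒¬T {false} _ ()

canonical⁻ : ∀ {xs} → T (isCanonicalᵇ xs) → Canonical xs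
canonical⁻ {xs} t with Equivalence.to (T-∧ {isPermᵇ xs}) t
... | p , t' with Equivalence.to (T-∧ {startsWith0ᵇ xs}) t'
... | s , a = canonical (IsPerm⇒Permutation xs p) (starts xs s) (T-not⇒¬T a)
  where
  starts : ∀ xs → T (startsWith0ᵇ xs) → head? xs ≡ just 0
  starts (x ∷ xs) t = cong just (≡ᵇ⇒≡ x 0 t)

canonical⁺ : ∀ {xs} → Canonical xs → T (isCanonicalᵇ xs)
canonical⁺ {xs} (canonical p h a) = Equivalence.from T-∧ (Permutation⇒IsPerm xs p ,
  Equivalence.from T-∧ (starts xs h , ¬T⇒T-not a))
  where
  starts : ∀ xs → head? xs ≡ just 0 → T (startsWith0ᵇ xs)
  starts (x ∷ xs) refl = tt

permutation-∈-allLists : ∀ {xs n} → Permutation xs → length xs ≡ n → xs ∈ allLists n n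
permutation-∈-allLists p refl = ∈-allLists⁺ _ (All.tabulate (bounded p))

countCanonical : ℕ → (List ℕ → Bool) → ℕ
countCanonical n q = length (filterᵇ (λ xs → isCanonicalᵇ xs ∧ q xs) (allLists n n))

containing : List ℕ → ℕ → ℕ
containing σ n = countCanonical n (λ xs → containsᵇ xs σ)

-- Avoiding and containing σ split the canonical permutations, whose number does not involve σ; Wilf
-- equivalence can therefore be tested on `containing`.
avCount+containing : ∀ n σ → avCount n (p1432 ∷ σ ∷ []) + containing σ n ≡ length (filterᵇ isCanonicalᵇ (allLists n n))
avCount+containing n σ = trans (+-comm (avCount n (p1432 ∷ σ ∷ [])) _) (trans
  (cong (containing σ n +_) (length-filterᵇ-cong (allLists n n) λ {xs} _ →
    regroup (isPermᵇ xs) (startsWith0ᵇ xs) (not (containsᵇ xs p1432)) (not (containsᵇ xs σ))))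
  (sym (length-filterᵇ-split isCanonicalᵇ (λ xs → containsᵇ xs σ) (allLists n n))))
  where
  regroup : ∀ a b c d → (a ∧ b ∧ c ∧ d ∧ true) ≡ ((a ∧ b ∧ c) ∧ d)
  regroup false b c d = refl
  regroup true false c d = refl
  regroup true true false d = refl
  regroup true true true d = ∧-identityʳ d

containing⇒WilfEquiv : ∀ {σ τ} → (∀ m → containing σ (suc m) ≡ containing τ (suc m)) →
  WilfEquiv (p1432 ∷ σ ∷ []) (p1432 ∷ τ ∷ [])
containing⇒WilfEquiv {σ} {τ} eq (suc m) _ = +-cancelʳ-≡ _ _ _
  (trans (avCount+containing (suc m) σ) (trans (sym (avCount+containing (suc m) τ))
    (cong (avCount (suc m) (p1432 ∷ τ ∷ []) +_) (sym (eq m)))))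

countCanonical-cong : ∀ n {p q} → (∀ {xs} → Canonical xs → (T (p xs) → T (q xs)) × (T (q xs) → T (p xs))) →
  countCanonical n p ≡ countCanonical n q
countCanonical-cong n {p} {q} f = length-filterᵇ-cong (allLists n n) λ {xs} _ → T⇔⇒≡
  (λ t → let (a , b) = Equivalence.to (T-∧ {isCanonicalᵇ xs} {p xs}) t in Equivalence.from T-∧ (a , proj₁ (f (canonical⁻ {xs} a)) b))
  (λ t → let (a , b) = Equivalence.to (T-∧ {isCanonicalᵇ xs} {q xs}) t in Equivalence.from T-∧ (a , proj₂ (f (canonical⁻ {xs} a)) b))

containing-rotation : ∀ {σ τ} n → Rotation σ τ → containing σ n ≡ containing τ n
containing-rotation n r = countCanonical-cong n λ {xs} c →
  Contains-pattern-rotate {xs} (nonempty c) r , Contains-pattern-rotate {xs} (nonempty c) (Rotation-sym r)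

isGrassmannianᵇ : List ℕ → Bool
isGrassmannianᵇ xs = descents xs ≤ᵇ 1

P-canonical : ∀ v → Canonical (P (false ∷ v))
P-canonical v = canonical (P-permutation (false ∷ v)) refl (P-avoids-1432 (false ∷ v))

Q-canonical : ∀ u → Canonical (Q (false ∷ u))
Q-canonical u = canonical (Q-permutation (false ∷ u)) refl (Q-avoids-1432 (false ∷ u))

countCanonical-split : ∀ n q → countCanonical n q ≡
  countCanonical n (λ xs → q xs ∧ isGrassmannianᵇ xs) + countCanonical n (λ xs → q xs ∧ not (isGrassmannianᵇ xs))
countCanonical-split n q = trans (length-filterᵇ-split _ isGrassmannianᵇ (allLists n n))
  (cong₂ _+_ (length-filterᵇ-cong (allLists n n) λ {xs} _ → ∧-assoc (isCanonicalᵇ xs) _ _)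
             (length-filterᵇ-cong (allLists n n) λ {xs} _ → ∧-assoc (isCanonicalᵇ xs) _ _))

T-∧⁺ : ∀ {a b} → T a → T b → T (a ∧ b)
T-∧⁺ x y = Equivalence.from T-∧ (x , y)

T-∧⁻ : ∀ {a b} → T (a ∧ b) → T a × T b
T-∧⁻ {a} = Equivalence.to (T-∧ {a})

true∷false : Word
true∷false = true ∷ false ∷ []

-- `nontrivial` confines `q` to words with a subword `10`, where `P` is injective.
countCanonical-P : ∀ m (q : List ℕ → Bool) → (∀ v → T (q (P (false ∷ v))) → true∷false ⊆ false ∷ v) →
  countCanonical (suc m) (λ xs → q xs ∧ isGrassmannianᵇ xs) ≡ countWords m (λ v → q (P (false ∷ v)))
countCanonical-P m q nontrivial = countWords-bijection {q = λ v → q (P (false ∷ v))} (λ v → P (false ∷ v)) (allLists-unique (suc m) (suc m)) (λ {xs} → from {xs}) (λ {w} → to {w})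
  (λ {_} {w} _ t' eq → ∷-injectiveʳ {x = false} {y = false} (P-injective (nontrivial w t') eq))
  where
  from : ∀ {xs} → xs ∈ allLists (suc m) (suc m) → T (isCanonicalᵇ xs ∧ q xs ∧ isGrassmannianᵇ xs) →
    ∃[ v ] (length v ≡ m × T (q (P (false ∷ v))) × P (false ∷ v) ≡ xs)
  from {xs} xs∈ t with T-∧⁻ {isCanonicalᵇ xs} t
  ... | c , t' with T-∧⁻ {q xs} t'
  ... | qx , g with classify-one-descent {xs} (permutation (canonical⁻ {xs} c)) (from-0 (canonical⁻ {xs} c)) (≤ᵇ⇒≤ _ 1 g)
  ... | v , refl = v , suc-injective (trans (sym (length-P (false ∷ v))) (∈-allLists⁻ (suc m) (suc m) xs∈)) , qx , refl
  to : ∀ {v} → length v ≡ m → T (q (P (false ∷ v))) → P (false ∷ v) ∈ allLists (suc m) (suc m) ×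
    T (isCanonicalᵇ (P (false ∷ v)) ∧ q (P (false ∷ v)) ∧ isGrassmannianᵇ (P (false ∷ v)))
  to {v} len t = permutation-∈-allLists (P-permutation (false ∷ v)) (trans (length-P (false ∷ v)) (cong suc len)) ,
    T-∧⁺ (canonical⁺ (P-canonical v)) (T-∧⁺ t (≤⇒≤ᵇ (descents-P (false ∷ v))))

drops⇒true∷false : ∀ u → 1 ≤ drops u → true∷false ⊆ u
drops⇒true∷false (false ∷ y ∷ u) le = false ∷ʳ drops⇒true∷false (y ∷ u) le
drops⇒true∷false (true ∷ true ∷ u) le = true ∷ʳ drops⇒true∷false (true ∷ u) le
drops⇒true∷false (true ∷ false ∷ u) le = refl ∷ refl ∷ minimum u

twoDropsᵇ : Word → Bool
twoDropsᵇ u = not (drops u ≤ᵇ 1)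

twoDrops⁻ : ∀ u → T (twoDropsᵇ u) → 2 ≤ drops u
twoDrops⁻ u t = ≰⇒> λ le → T-not⇒¬T t (≤⇒≤ᵇ le)

twoDrops⁺ : ∀ u → 2 ≤ drops u → T (twoDropsᵇ u)
twoDrops⁺ u le = ¬T⇒T-not λ t → <⇒≱ le (≤ᵇ⇒≤ (drops u) 1 t)

-- Two drops both characterize the words whose `Q` has more than one descent and supply the subword
-- `10` needed for injectivity.
countCanonical-Q : ∀ m (q : List ℕ → Bool) → countCanonical (suc m) (λ xs → q xs ∧ not (isGrassmannianᵇ xs)) ≡
  countWords m (λ u → q (Q (false ∷ u)) ∧ twoDropsᵇ (false ∷ u))
countCanonical-Q m q = countWords-bijection {q = λ u → q (Q (false ∷ u)) ∧ twoDropsᵇ (false ∷ u)} (λ u → Q (false ∷ u)) (allLists-unique (suc m) (suc m)) (λ {xs} → from {xs}) (λ {w} → to {w})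
  (λ {_} {u'} _ t' eq → ∷-injectiveʳ {x = false} {y = false} (Q-injective (drops⇒true∷false (false ∷ u')
    (<⇒≤ (twoDrops⁻ (false ∷ u') (proj₂ (T-∧⁻ {q (Q (false ∷ u'))} t'))))) eq))
  where
  same : ∀ u → not (isGrassmannianᵇ (Q u)) ≡ twoDropsᵇ u
  same u = cong (λ d → not (d ≤ᵇ 1)) (descents-Q u)
  from : ∀ {xs} → xs ∈ allLists (suc m) (suc m) → T (isCanonicalᵇ xs ∧ q xs ∧ not (isGrassmannianᵇ xs)) →
    ∃[ u ] (length u ≡ m × T (q (Q (false ∷ u)) ∧ twoDropsᵇ (false ∷ u)) × Q (false ∷ u) ≡ xs)
  from {xs} xs∈ t with T-∧⁻ {isCanonicalᵇ xs} t
  ... | c , t' with T-∧⁻ {q xs} t'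
  ... | qx , g with canonical⁻ {xs} c
  ... | canonical p h av with classify {xs} p h av
  ... | inj₁ (v , refl) = contradiction (≤⇒≤ᵇ (descents-P (false ∷ v))) (T-not⇒¬T g)
  ... | inj₂ (u , refl) = u , suc-injective (trans (sym (length-Q (false ∷ u))) (∈-allLists⁻ (suc m) (suc m) xs∈)) ,
    T-∧⁺ qx (subst T (same (false ∷ u)) g) , refl
  to : ∀ {u} → length u ≡ m → T (q (Q (false ∷ u)) ∧ twoDropsᵇ (false ∷ u)) → Q (false ∷ u) ∈ allLists (suc m) (suc m) ×
    T (isCanonicalᵇ (Q (false ∷ u)) ∧ q (Q (false ∷ u)) ∧ not (isGrassmannianᵇ (Q (false ∷ u))))
  to {u} len t with T-∧⁻ {q (Q (false ∷ u))} t
  ... | a , b = permutation-∈-allLists (Q-permutation (false ∷ u)) (trans (length-Q (false ∷ u)) (cong suc len)) ,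
    T-∧⁺ (canonical⁺ (Q-canonical u)) (T-∧⁺ a (subst T (sym (same (false ∷ u))) b))

-- A permutation that is both a `P` and a `Q` has at most one descent, so it is counted in the first
-- summand only.
containing-formula : ∀ σ m → (∀ v → Occurs (P (false ∷ v)) σ → true∷false ⊆ false ∷ v) → containing σ (suc m) ≡
  countWords m (λ v → containsᵇ (P (false ∷ v)) σ) +
  countWords m (λ u → containsᵇ (Q (false ∷ u)) σ ∧ twoDropsᵇ (false ∷ u))
containing-formula σ m nontrivial = trans (countCanonical-split (suc m) (λ xs → containsᵇ xs σ))
  (cong₂ _+_ (countCanonical-P m (λ xs → containsᵇ xs σ)
    (λ v t → nontrivial v (Contains⇒Occurs {P (false ∷ v)} {σ} t))) (countCanonical-Q m (λ xs → containsᵇ xs σ)))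

-- The reverse-complement symmetry

rotateTo0 : List ℕ → List ℕ → List ℕ
rotateTo0 acc [] = acc
rotateTo0 acc (zero ∷ xs) = zero ∷ xs ++ acc
rotateTo0 acc (suc x ∷ xs) = rotateTo0 (acc ++ suc x ∷ []) xs

rotateTo0-rotation : ∀ acc xs → Rotation (acc ++ xs) (rotateTo0 acc xs)
rotateTo0-rotation acc [] = rot acc [] refl refl
rotateTo0-rotation acc (zero ∷ xs) = rot acc (zero ∷ xs) refl refl
rotateTo0-rotation acc (suc x ∷ xs) = subst (λ ys → Rotation ys (rotateTo0 (acc ++ suc x ∷ []) xs))
  (++-assoc acc _ xs) (rotateTo0-rotation (acc ++ suc x ∷ []) xs)

rotateTo0-head : ∀ acc {xs} → 0 ∈ xs → head? (rotateTo0 acc xs) ≡ just 0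
rotateTo0-head acc {zero ∷ xs} _ = refl
rotateTo0-head acc {suc x ∷ xs} (there i) = rotateTo0-head (acc ++ suc x ∷ []) i

length-rc : ∀ xs → length (rc xs) ≡ length xs
length-rc xs = trans (length-reverse (map (pred (length xs) ∸_) xs)) (length-map (pred (length xs) ∸_) xs)

≤-pred-length : ∀ {xs x} → Permutation xs → x ∈ xs → x ≤ pred (length xs)
≤-pred-length p x∈ = pred-mono-≤ (bounded p x∈)

rc-involutive : ∀ {xs} → Permutation xs → rc (rc xs) ≡ xs
rc-involutive {xs} p = trans (cong (λ n → reverse (map (pred n ∸_) (rc xs))) (length-rc xs))
  (trans (cong reverse (reverse-map (pred (length xs) ∸_) (map (pred (length xs) ∸_) xs)))
  (trans (reverse-involutive _) (trans (sym (map-∘ xs))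
  (trans (map-cong-local (All.tabulate λ x∈ → m∸[m∸n]≡n (≤-pred-length p x∈))) (map-id xs)))))

rc-permutation : ∀ {xs} → Permutation xs → Permutation (rc xs)
rc-permutation {xs} p = ↭-trans (Perm.↭-reverse _) (↭-trans (Perm.map⁺ (pred n ∸_) p)
  (subst (λ k → map (pred n ∸_) (upTo n) ↭ upTo k) (sym (length-rc xs)) (↭-sym
    (unique⊆∧length⇒↭ (Uniqueₚ.upTo⁺ n)
      (λ {x} x∈ → subst (_∈ map (pred n ∸_) (upTo n)) (m∸[m∸n]≡n (pred-mono-≤ (∈-upTo⁻ x∈)))
        (∈-map⁺ (pred n ∸_) (∈-upTo⁺ (≤-<-trans (m∸n≤m (pred n) x) (pred-< (∈-upTo⁻ x∈))))))
      (length-map _ (upTo n))))))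
  where
  n = length xs
  pred-< : ∀ {x n} → x < n → pred n < n
  pred-< {n = suc n} _ = ≤-refl

reverse-map-++ : ∀ (f : ℕ → ℕ) a b → reverse (map f (a ++ b)) ≡ reverse (map f b) ++ reverse (map f a)
reverse-map-++ f a b = trans (cong reverse (map-++ f a b)) (reverse-++ (map f a) (map f b))

rc-rotation : ∀ {xs ys} → Rotation xs ys → Rotation (rc xs) (rc ys)
rc-rotation {xs} {ys} r@(rot a b refl refl) = rot (reverse (map f b)) (reverse (map f a)) (reverse-map-++ f a b)
  (trans (cong (λ n → reverse (map (pred n ∸_) (b ++ a))) (sym (Perm.↭-length (Rotation⇒↭ r)))) (reverse-map-++ f b a))
  where f = pred (length xs) ∸_

reflect-< : ∀ {N a b} → a ≤ N → b ≤ N → a < b → N ∸ b < N ∸ a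
reflect-< p q lt = ∸-monoʳ-< lt q

reflect-<⁻ : ∀ {N a b} → a ≤ N → b ≤ N → N ∸ b < N ∸ a → a < b
reflect-<⁻ {N} {a} {b} p q lt = ≰⇒> λ le → <⇒≱ lt (∸-monoʳ-≤ N le)

∈-⊆ : ∀ {A : Set} {x : A} {xs ys} → xs ⊆ ys → x ∈ xs → x ∈ ys
∈-⊆ (y ∷ʳ σ) i = there (∈-⊆ σ i)
∈-⊆ (refl ∷ σ) (here e) = here e
∈-⊆ (refl ∷ σ) (there i) = there (∈-⊆ σ i)

rc-Embeds : ∀ {xs π} → Permutation xs → Permutation π → Embeds xs π → Embeds (rc xs) (rc π)
rc-Embeds {xs} {π} p q (embeds ps o im refl) = embeds (reverse (map both ps)) iso
  (subst (_⊆ rc xs) (sym (reverse-map-both f (map-both₁ ps))) (Sub.reverse⁺ (Sub.map⁺ f im)))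
  (reverse-map-both g (map-both₂ ps))
  where
  f = pred (length xs) ∸_
  g = pred (length π) ∸_
  both : ℕ × ℕ → ℕ × ℕ
  both (a , b) = f a , g b
  map-both₁ : ∀ ps → map proj₁ (map both ps) ≡ map f (map proj₁ ps)
  map-both₁ ps = trans (sym (map-∘ ps)) (map-∘ ps)
  map-both₂ : ∀ ps → map proj₂ (map both ps) ≡ map g (map proj₂ ps)
  map-both₂ ps = trans (sym (map-∘ ps)) (map-∘ ps)
  reverse-map-both : ∀ (h : ℕ → ℕ) {k : ℕ × ℕ → ℕ} {qs zs} → map k qs ≡ map h zs →
    map k (reverse qs) ≡ reverse (map h zs)
  reverse-map-both h {k} {qs} e = trans (reverse-map k qs) (cong reverse e)
  iso : OrderIso (reverse (map both ps))
  iso i j with ∈-map⁻ both (Anyₚ.reverse⁻ {xs = map both ps} i) | ∈-map⁻ both (Anyₚ.reverse⁻ {xs = map both ps} j)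
  ... | (a , b) , i' , refl | (c , d) , j' , refl =
    (λ lt → reflect-< d≤ b≤ (proj₁ (o j' i') (reflect-<⁻ c≤ a≤ lt))) ,
    (λ lt → reflect-< c≤ a≤ (proj₂ (o j' i') (reflect-<⁻ d≤ b≤ lt)))
    where
    a≤ = ≤-pred-length p (∈-⊆ im (∈-map⁺ proj₁ i'))
    c≤ = ≤-pred-length p (∈-⊆ im (∈-map⁺ proj₁ j'))
    b≤ = ≤-pred-length q (∈-map⁺ proj₂ i')
    d≤ = ≤-pred-length q (∈-map⁺ proj₂ j')

rc-Contains : ∀ {xs π} → Permutation xs → Permutation π → Contains xs π → Contains (rc xs) (rc π)
rc-Contains {xs} {π} p q c with Contains⇒Occurs {xs} {π} c
... | occurs r e = Occurs⇒Contains nonempty-rc (occurs (rc-rotation r)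
  (rc-Embeds p (Permutation-resp-↭ (Rotation⇒↭ r) q) e))
  where
  nonempty-rc : rc xs ≢ []
  nonempty-rc e = contains-[] xs (trans (sym (length-rc xs)) (cong length e)) c
    where
    contains-[] : ∀ xs → length xs ≡ 0 → ¬ Contains xs π
    contains-[] [] _ ()

nonempty-length : ∀ {xs : List ℕ} → xs ≢ [] → 0 < length xs
nonempty-length {[]} ne = contradiction refl ne
nonempty-length {x ∷ xs} ne = s≤s z≤n

canonical-rc : ∀ {xs} → Canonical xs → Canonical (rotateTo0 [] (rc xs))
canonical-rc {xs} c@(canonical p h av) = canonical (Permutation-resp-↭ (Rotation⇒↭ r) p') (rotateTo0-head [] 0∈) λ con →
  av (subst (λ ys → Contains ys p1432) (rc-involutive p)
    -- The reverse-complement of 0321 is 2103, which is a rotation of 0321.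
    (Contains-pattern-rotate ne (rot (2 ∷ 1 ∷ []) (0 ∷ 3 ∷ []) refl refl)
      (rc-Contains p' p1432-permutation (Contains-rotate {rc xs} {rotateTo0 [] (rc xs)} ne' r con))))
  where
  p' = rc-permutation p
  r = rotateTo0-rotation [] (rc xs)
  0<n : 0 < length xs
  0<n = nonempty-length (nonempty c)
  0∈ : 0 ∈ rc xs
  0∈ = covers p' (subst (0 <_) (sym (length-rc xs)) 0<n)
  ne' : rc xs ≢ []
  ne' e = <⇒≢ 0<n (sym (trans (sym (length-rc xs)) (cong length e)))
  ne : rc (rc xs) ≢ []
  ne e = nonempty c (trans (sym (rc-involutive p)) e)

-- Reverse-complementing and rotating back to 0 is injective on canonical permutations. As `rc` is
-- an involution, the inequalities for σ and for `rc σ` give equality.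
containing-rc-≤ : ∀ {σ} n → Permutation σ → containing σ n ≤ containing (rc σ) n
containing-rc-≤ {σ} n pσ = ≤-trans (≤-reflexive (sym (length-map f xs)))
  (unique⊆⇒length≤ (unique-map injective (unique-filterᵇ test (allLists-unique n n))) image)
  where
  f = λ xs → rotateTo0 [] (rc xs)
  test = λ xs → isCanonicalᵇ xs ∧ containsᵇ xs σ
  xs = filterᵇ test (allLists n n)
  facts : ∀ {x} → x ∈ xs → length x ≡ n × Canonical x × Contains x σ
  facts {x} i with ∈-filterᵇ⁻ test (allLists n n) i
  ... | x∈ , t = ∈-allLists⁻ n n x∈ , canonical⁻ {x} (proj₁ (T-∧⁻ {isCanonicalᵇ x} t)) , proj₂ (T-∧⁻ {isCanonicalᵇ x} t)
  injective : ∀ {x y} → x ∈ xs → y ∈ xs → f x ≡ f y → x ≡ y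
  injective {x} {y} i j eq with facts i | facts j
  ... | _ , canonical p h _ , _ | _ , canonical q k _ , _ = rotation-from-0-unique
    (subst₂ Rotation (rc-involutive p) (rc-involutive q) (rc-rotation
      (Rotation-trans (rotateTo0-rotation [] (rc x))
        (subst (λ z → Rotation z (rc y)) (sym eq) (Rotation-sym (rotateTo0-rotation [] (rc y)))))))
    (unique p) h k
  image : ∀ {y} → y ∈ map f xs → y ∈ filterᵇ (λ xs → isCanonicalᵇ xs ∧ containsᵇ xs (rc σ)) (allLists n n)
  image i with ∈-map⁻ f i
  ... | x , x∈ , refl with facts x∈
  ... | len , c , con = ∈-filterᵇ⁺ (λ xs → isCanonicalᵇ xs ∧ containsᵇ xs (rc σ))
    (permutation-∈-allLists (permutation c') (trans (sym (Perm.↭-length (Rotation⇒↭ r))) (trans (length-rc x) len)))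
    (T-∧⁺ (canonical⁺ c') (Contains-rotate (nonempty c') (Rotation-sym r) (rc-Contains (permutation c) pσ con)))
    where
    c' = canonical-rc c
    r = rotateTo0-rotation [] (rc x)

containing-rc : ∀ {σ} n → Permutation σ → containing σ n ≡ containing (rc σ) n
containing-rc {σ} n p = ≤-antisym (containing-rc-≤ n p)
  (≤-trans (containing-rc-≤ n (rc-permutation p)) (≤-reflexive (cong (λ τ → containing τ n) (rc-involutive p))))

-- Counting words by their subwords

-- Matching is greedy, so the next letter of `v` alone decides the recursive call, and counting
-- never has to choose between embeddings.
subᵇ : Word → Word → Bool
subᵇ [] v = true
subᵇ (b ∷ x) [] = false
subᵇ (false ∷ x) (false ∷ v) = subᵇ x v
subᵇ (false ∷ x) (true ∷ v) = subᵇ (false ∷ x) v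
subᵇ (true ∷ x) (false ∷ v) = subᵇ (true ∷ x) v
subᵇ (true ∷ x) (true ∷ v) = subᵇ x v

subᵇ⇒⊆ : ∀ x v → T (subᵇ x v) → x ⊆ v
subᵇ⇒⊆ [] v t = minimum v
subᵇ⇒⊆ (false ∷ x) (false ∷ v) t = refl ∷ subᵇ⇒⊆ x v t
subᵇ⇒⊆ (false ∷ x) (true ∷ v) t = true ∷ʳ subᵇ⇒⊆ (false ∷ x) v t
subᵇ⇒⊆ (true ∷ x) (false ∷ v) t = false ∷ʳ subᵇ⇒⊆ (true ∷ x) v t
subᵇ⇒⊆ (true ∷ x) (true ∷ v) t = refl ∷ subᵇ⇒⊆ x v t

⊆-tail : ∀ {b : Bool} {x v} → b ∷ x ⊆ v → x ⊆ v
⊆-tail (c ∷ʳ σ) = c ∷ʳ ⊆-tail σ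
⊆-tail (refl ∷ σ) = _ ∷ʳ σ

⊆⇒subᵇ : ∀ {x v} → x ⊆ v → T (subᵇ x v)
⊆⇒subᵇ {[]} σ = tt
⊆⇒subᵇ {false ∷ x} (false ∷ʳ σ) = ⊆⇒subᵇ (⊆-tail σ)
⊆⇒subᵇ {false ∷ x} (true ∷ʳ σ) = ⊆⇒subᵇ σ
⊆⇒subᵇ {true ∷ x} (false ∷ʳ σ) = ⊆⇒subᵇ σ
⊆⇒subᵇ {true ∷ x} (true ∷ʳ σ) = ⊆⇒subᵇ (⊆-tail σ)
⊆⇒subᵇ {false ∷ x} (refl ∷ σ) = ⊆⇒subᵇ σ
⊆⇒subᵇ {true ∷ x} (refl ∷ σ) = ⊆⇒subᵇ σ

subᵇ-same : ∀ b x v → subᵇ (b ∷ x) (b ∷ v) ≡ subᵇ x v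
subᵇ-same false x v = refl
subᵇ-same true x v = refl

subᵇ-diff : ∀ b x v → subᵇ (b ∷ x) (not b ∷ v) ≡ subᵇ (b ∷ x) v
subᵇ-diff false x v = refl
subᵇ-diff true x v = refl

-- Under greedy matching exactly one of the two possible next letters advances, whichever letter is
-- wanted, so only the number of letters still to be matched counts.
countWords-subᵇ : ∀ m x y → length x ≡ length y → countWords m (subᵇ x) ≡ countWords m (subᵇ y)
countWords-subᵇ m [] [] eq = refl
countWords-subᵇ zero (b ∷ x) (c ∷ y) eq = refl
countWords-subᵇ (suc m) (false ∷ x) (false ∷ y) eq =
  cong₂ _+_ (countWords-subᵇ m x y (suc-injective eq)) (countWords-subᵇ m (false ∷ x) (false ∷ y) eq)
countWords-subᵇ (suc m) (true ∷ x) (true ∷ y) eq =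
  cong₂ _+_ (countWords-subᵇ m (true ∷ x) (true ∷ y) eq) (countWords-subᵇ m x y (suc-injective eq))
countWords-subᵇ (suc m) (false ∷ x) (true ∷ y) eq = trans (+-comm (countWords m (subᵇ x)) _)
  (cong₂ _+_ (countWords-subᵇ m (false ∷ x) (true ∷ y) eq) (countWords-subᵇ m x y (suc-injective eq)))
countWords-subᵇ (suc m) (true ∷ x) (false ∷ y) eq = trans (+-comm (countWords m (subᵇ (true ∷ x))) _)
  (cong₂ _+_ (countWords-subᵇ m x y (suc-injective eq)) (countWords-subᵇ m (true ∷ x) (false ∷ y) eq))

countWords-complement : ∀ m q → countWords m (q ∘ complement) ≡ countWords m q
countWords-complement zero q = refl
countWords-complement (suc m) q = trans (+-comm (countWords m _) _)
  (cong₂ _+_ (countWords-complement m (q ∘ (false ∷_))) (countWords-complement m (q ∘ (true ∷_))))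

countWords-snoc : ∀ m q → countWords (suc m) q ≡
  countWords m (λ v → q (v ++ false ∷ [])) + countWords m (λ v → q (v ++ true ∷ []))
countWords-snoc zero q = refl
countWords-snoc (suc m) q = trans (cong₂ _+_ (countWords-snoc m (q ∘ (false ∷_))) (countWords-snoc m (q ∘ (true ∷_))))
  (+-interchange (countWords m _) _ _ _)
  where
  +-interchange : ∀ a b c d → (a + b) + (c + d) ≡ (a + c) + (b + d)
  +-interchange a b c d = trans (+-assoc a b (c + d)) (trans (cong (a +_)
    (trans (sym (+-assoc b c d)) (trans (cong (_+ d) (+-comm b c)) (+-assoc c b d)))) (sym (+-assoc a c (b + d))))

countWords-reverse : ∀ m q → countWords m (q ∘ reverse) ≡ countWords m q
countWords-reverse zero q = refl
countWords-reverse (suc m) q = trans (cong₂ _+_ (step false) (step true)) (sym (countWords-snoc m q))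
  where
  step : ∀ b → countWords m (λ v → q (reverse (b ∷ v))) ≡ countWords m (λ v → q (v ++ b ∷ []))
  step b = trans (countWords-cong m λ v _ → cong q (unfold-reverse b v)) (countWords-reverse m (λ v → q (v ++ b ∷ [])))

-- Words containing a word or its complement

bothᵇ : Word → Word → Bool
bothᵇ w v = subᵇ w v ∨ subᵇ (complement w) v

T-∨⁻ : ∀ {a b} → T (a ∨ b) → T a ⊎ T b
T-∨⁻ {a} = Equivalence.to (T-∨ {a})

T-∨⁺ : ∀ {a b} → T a ⊎ T b → T (a ∨ b)
T-∨⁺ {a} = Equivalence.from (T-∨ {a})

bothᵇ⁻ : ∀ w v → T (bothᵇ w v) → w ⊆ v ⊎ complement w ⊆ v
bothᵇ⁻ w v t with T-∨⁻ {subᵇ w v} t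
... | inj₁ s = inj₁ (subᵇ⇒⊆ w v s)
... | inj₂ s = inj₂ (subᵇ⇒⊆ (complement w) v s)

bothᵇ⁺ : ∀ {w v} → w ⊆ v ⊎ complement w ⊆ v → T (bothᵇ w v)
bothᵇ⁺ (inj₁ σ) = T-∨⁺ (inj₁ (⊆⇒subᵇ σ))
bothᵇ⁺ {w} {v} (inj₂ σ) = T-∨⁺ {subᵇ w v} (inj₂ (⊆⇒subᵇ σ))

complement-⊆ : ∀ {x v} → x ⊆ v → complement x ⊆ complement v
complement-⊆ = Sub.map⁺ not

⊎-map-⊆ : ∀ {x x' y y' v v' : Word} → (x ⊆ v → x' ⊆ v') → (y ⊆ v → y' ⊆ v') → x ⊆ v ⊎ y ⊆ v → x' ⊆ v' ⊎ y' ⊆ v'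
⊎-map-⊆ f g (inj₁ a) = inj₁ (f a)
⊎-map-⊆ f g (inj₂ b) = inj₂ (g b)

⊎-swap-⊆ : ∀ {x y v : Word} → x ⊆ v ⊎ y ⊆ v → y ⊆ v ⊎ x ⊆ v
⊎-swap-⊆ (inj₁ a) = inj₂ a
⊎-swap-⊆ (inj₂ a) = inj₁ a

bothᵇ-complementˡ : ∀ w v → bothᵇ (complement w) v ≡ bothᵇ w v
bothᵇ-complementˡ w v = T⇔⇒≡
  (λ t → bothᵇ⁺ (⊎-swap-⊆ (subst (λ x → complement w ⊆ v ⊎ x ⊆ v) (complement-involutive w) (bothᵇ⁻ (complement w) v t))))
  (λ t → bothᵇ⁺ (subst (λ x → complement w ⊆ v ⊎ x ⊆ v) (sym (complement-involutive w)) (⊎-swap-⊆ (bothᵇ⁻ w v t))))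

bothᵇ-complement : ∀ w v → bothᵇ w (complement v) ≡ bothᵇ w v
bothᵇ-complement w v = trans (T⇔⇒≡ (λ t → go w v (bothᵇ⁻ w (complement v) t)) back) (bothᵇ-complementˡ w v)
  where
  go : ∀ w v → w ⊆ complement v ⊎ complement w ⊆ complement v → T (bothᵇ (complement w) v)
  go w v s = bothᵇ⁺ (⊎-map-⊆ (λ σ → subst (complement w ⊆_) (complement-involutive v) (complement-⊆ σ))
    (λ σ → subst (complement (complement w) ⊆_) (complement-involutive v) (complement-⊆ σ)) s)
  back : T (bothᵇ (complement w) v) → T (bothᵇ w (complement v))
  back t = bothᵇ⁺ (subst (λ x → x ⊆ complement v ⊎ complement w ⊆ complement v) (complement-involutive w)
    (⊎-map-⊆ complement-⊆ (λ σ → subst (_⊆ complement v) (complement-involutive (complement w)) (complement-⊆ σ))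
      (bothᵇ⁻ (complement w) v t)))

reverse-⊆⁻ : ∀ (x v : Word) → reverse x ⊆ reverse v → x ⊆ v
reverse-⊆⁻ x v σ = Sub.reverse⁻ σ

reverse-⊆⁺ : ∀ (x v : Word) → x ⊆ v → reverse x ⊆ reverse v
reverse-⊆⁺ x v σ = Sub.reverse⁺ σ

bothᵇ-reverse : ∀ w v → bothᵇ (reverse w) (reverse v) ≡ bothᵇ w v
bothᵇ-reverse w v = T⇔⇒≡
  (λ t → bothᵇ⁺ (⊎-map-⊆ (reverse-⊆⁻ w v)
    (λ σ → reverse-⊆⁻ (complement w) v (subst (_⊆ reverse v) (reverse-map not w) σ)) (bothᵇ⁻ (reverse w) (reverse v) t)))
  (λ t → bothᵇ⁺ {reverse w} (⊎-map-⊆ (reverse-⊆⁺ w v)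
    (λ σ → subst (_⊆ reverse v) (sym (reverse-map not w)) (reverse-⊆⁺ (complement w) v σ)) (bothᵇ⁻ w v t)))

countBoth : Word → ℕ → ℕ
countBoth w n = countWords n (bothᵇ w)

-- All words are counted, not only those starting with `false`, because reversal does not preserve
-- the first letter; `≈⇒half` returns to the words starting with `false`.
record _≈_ (w w' : Word) : Set where
  constructor equinumerous
  field
    counts : ∀ n → countBoth w n ≡ countBoth w' n

open _≈_

≈-reflexive : ∀ {w w'} → w ≡ w' → w ≈ w'
≈-reflexive refl = equinumerous λ _ → refl

≈-trans : ∀ {x y z} → x ≈ y → y ≈ z → x ≈ z
≈-trans (equinumerous p) (equinumerous q) = equinumerous λ n → trans (p n) (q n)

≈-sym : ∀ {x y} → x ≈ y → y ≈ x
≈-sym (equinumerous p) = equinumerous λ n → sym (p n)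

≈-complement : ∀ w → complement w ≈ w
≈-complement w = equinumerous λ n → countWords-cong n λ v _ → bothᵇ-complementˡ w v

≈-reverse : ∀ w → reverse w ≈ w
≈-reverse w = equinumerous λ n →
  trans (sym (countWords-reverse n (bothᵇ (reverse w)))) (countWords-cong n λ v _ → bothᵇ-reverse w v)

-- Complementing changes the first letter and preserves the property of containing `w` or its
-- complement.
countBoth-half : ∀ w m → countBoth w (suc m) ≡
  countWords m (λ v → bothᵇ w (false ∷ v)) + countWords m (λ v → bothᵇ w (false ∷ v))
countBoth-half w m = cong (countWords m (λ v → bothᵇ w (false ∷ v)) +_)
  (trans (sym (countWords-complement m (λ v → bothᵇ w (true ∷ v))))
    (countWords-cong m λ v _ → bothᵇ-complement w (false ∷ v)))

≈⇒half : ∀ {w w'} m → w ≈ w' → countWords m (λ v → bothᵇ w (false ∷ v)) ≡ countWords m (λ v → bothᵇ w' (false ∷ v))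
≈⇒half {w} {w'} m eq = double-injective (trans (sym (countBoth-half w m)) (trans (counts eq (suc m)) (countBoth-half w' m)))
  where
  double-injective : ∀ {a b} → a + a ≡ b + b → a ≡ b
  double-injective {zero} {zero} e = refl
  double-injective {suc a} {suc b} e = cong suc (double-injective {a} {b}
    (suc-injective (trans (sym (+-suc a a)) (trans (suc-injective e) (+-suc b b)))))

+-swap-even : ∀ a b c d → (a + b) + (c + d) ≡ (a + d) + (c + b)
+-swap-even a b c d = trans (+-assoc a b (c + d)) (trans (cong (a +_)
  (trans (+-comm b (c + d)) (trans (cong (_+ b) (+-comm c d)) (+-assoc d c b)))) (sym (+-assoc a d (c + b))))

-- A word v starts with two equal letters a a u or two different letters a a' u. Embedding not b ∷ b ∷ w,
-- up to complement, into v is the same as embedding it into a u, respectively embedding b ∷ w into a' u.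
countBoth-alternate : ∀ b w n → countBoth (not b ∷ b ∷ w) (suc n) ≡
  countBoth (not b ∷ b ∷ w) n + countBoth (b ∷ w) n
countBoth-alternate false w zero = refl
countBoth-alternate true w zero = refl
countBoth-alternate false w (suc n) = +-swap-even (countWords n _) _ _ _
countBoth-alternate true w (suc n) = +-swap-even (countWords n _) _ _ _

≈-alternate : ∀ b w w' → (b ∷ w) ≈ (b ∷ w') → (not b ∷ b ∷ w) ≈ (not b ∷ b ∷ w')
≈-alternate b w w' eq = equinumerous go
  where
  go : ∀ n → countBoth (not b ∷ b ∷ w) n ≡ countBoth (not b ∷ b ∷ w') n
  go zero = refl
  go (suc n) = trans (countBoth-alternate b w n) (trans (cong₂ _+_ (go n) (counts eq n)) (sym (countBoth-alternate b w' n)))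

complement-replicate : ∀ n b → complement (replicate n b) ≡ replicate n (not b)
complement-replicate n b = map-replicate not n b

Bfrom-complement : ∀ b ns → complement (Bfrom b ns) ≡ Bfrom (not b) ns
Bfrom-complement b [] = refl
Bfrom-complement b (n ∷ ns) = trans (map-++ not (replicate n b) _)
  (cong₂ _++_ (complement-replicate n b) (Bfrom-complement (not b) ns))

letterAt : Bool → ℕ → Bool
letterAt b zero = b
letterAt b (suc k) = letterAt (not b) k

letterAt-not : ∀ b k → letterAt (not b) k ≡ not (letterAt b k)
letterAt-not b zero = refl
letterAt-not b (suc k) = letterAt-not (not b) k

letterAt-involutive : ∀ b k → letterAt (letterAt b k) k ≡ b
letterAt-involutive b zero = refl
letterAt-involutive b (suc k) = trans (cong (λ c → letterAt (not c) k) (letterAt-not b k))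
  (trans (cong (λ c → letterAt c k) (not-involutive _)) (letterAt-involutive b k))

Bfrom-snoc : ∀ b ns n → Bfrom b (ns ++ n ∷ []) ≡ Bfrom b ns ++ replicate n (letterAt b (length ns))
Bfrom-snoc b [] n = ++-identityʳ _
Bfrom-snoc b (m ∷ ns) n = trans (cong (replicate m b ++_) (Bfrom-snoc (not b) ns n)) (sym (++-assoc (replicate m b) _ _))

replicate-snoc : ∀ {A : Set} n (x : A) → replicate (suc n) x ≡ replicate n x ++ x ∷ []
replicate-snoc zero x = refl
replicate-snoc (suc n) x = cong (x ∷_) (replicate-snoc n x)

reverse-replicate : ∀ {A : Set} n (x : A) → reverse (replicate n x) ≡ replicate n x
reverse-replicate zero x = refl
reverse-replicate (suc n) x = trans (unfold-reverse x (replicate n x))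
  (trans (cong (_++ x ∷ []) (reverse-replicate n x)) (sym (replicate-snoc n x)))

-- The reversed word starts with the letter of the last run. Counting runs from `not b`, one run
-- earlier, avoids subtracting 1 from the length and covers the empty list.
reverse-Bfrom : ∀ b ns → reverse (Bfrom b ns) ≡ Bfrom (letterAt (not b) (length ns)) (reverse ns)
reverse-Bfrom b [] = refl
reverse-Bfrom b (n ∷ ns) = trans (reverse-++ (replicate n b) (Bfrom (not b) ns))
  (trans (cong₂ _++_ (reverse-Bfrom (not b) ns) (reverse-replicate n b)) (sym (trans
    (cong (Bfrom c) (unfold-reverse n ns)) (trans (Bfrom-snoc c (reverse ns) n)
    (cong (λ d → Bfrom c (reverse ns) ++ replicate n d)
      (trans (cong (letterAt c) (length-reverse ns)) (trans (letterAt-involutive _ (length ns)) (not-involutive b))))))))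
  where c = letterAt (not (not b)) (length ns)

≈-Bfrom : ∀ b ns → Bfrom b ns ≈ B ns
≈-Bfrom false ns = ≈-reflexive refl
≈-Bfrom true ns = ≈-trans (≈-reflexive (sym (Bfrom-complement false ns))) (≈-complement (B ns))

≈-B-reverse : ∀ ns → B (reverse ns) ≈ B ns
≈-B-reverse ns = ≈-trans (≈-sym (≈-Bfrom (letterAt true (length ns)) (reverse ns)))
  (≈-trans (≈-reflexive (sym (reverse-Bfrom false ns))) (≈-reverse (B ns)))

≈-B-1∷ : ∀ k ks l ls → 1 ≤ k → 1 ≤ l → B (k ∷ ks) ≈ B (l ∷ ls) → B (1 ∷ k ∷ ks) ≈ B (1 ∷ l ∷ ls)
≈-B-1∷ (suc k) ks (suc l) ls _ _ eq = ≈-alternate true (replicate k true ++ B ks) (replicate l true ++ B ls)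
  (≈-trans (≈-Bfrom true (suc k ∷ ks)) (≈-trans eq (≈-sym (≈-Bfrom true (suc l ∷ ls)))))

Composition-reverse : ∀ {ns} → Composition ns → Composition (reverse ns)
Composition-reverse {ns} c = Perm.All-resp-↭ (↭-sym (Perm.↭-reverse ns)) c

-- With K the given runs: K is equivalent to its reverse, hence so are they after a run of length 1
-- is put in front of each; and 1 followed by the reverse of K is the reverse of K followed by 1.
≈-B-move1 : ∀ k ks → Composition (k ∷ ks) → B (1 ∷ k ∷ ks) ≈ B ((k ∷ ks) ++ 1 ∷ [])
≈-B-move1 k ks c@(k≥1 ∷ _) = ≈-trans (step (reverse (k ∷ ks)) refl)
  (≈-trans (≈-reflexive (cong B (sym (reverse-++ (k ∷ ks) (1 ∷ [])))))
  (≈-B-reverse ((k ∷ ks) ++ 1 ∷ [])))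
  where
  step : ∀ ls → reverse (k ∷ ks) ≡ ls → B (1 ∷ k ∷ ks) ≈ B (1 ∷ ls)
  step [] e = contradiction (trans (sym (length-reverse (k ∷ ks))) (cong length e)) λ ()
  step (l ∷ ls) e with subst Composition e (Composition-reverse c)
  ... | l≥1 ∷ _ = ≈-B-1∷ k ks l ls k≥1 l≥1 (≈-sym (subst (λ ms → B ms ≈ B (k ∷ ks)) e (≈-B-reverse (k ∷ ks))))

-- The leading runs of length 1 are moved one at a time; those already moved become part of `ks`.
≈-B-move : ∀ s k ks → Composition (k ∷ ks) → B (replicate s 1 ++ k ∷ ks) ≈ B ((k ∷ ks) ++ replicate s 1)
≈-B-move zero k ks c = ≈-reflexive (cong B (sym (++-identityʳ (k ∷ ks))))
≈-B-move (suc s) k ks c = ≈-trans (first s)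
  (≈-trans (≈-reflexive (cong B (++-assoc (replicate s 1) (k ∷ ks) _)))
  (≈-trans (≈-B-move s k (ks ++ 1 ∷ []) (Allₚ.++⁺ c (≤-refl ∷ [])))
  (≈-reflexive (cong B (++-assoc (k ∷ ks) (1 ∷ []) (replicate s 1))))))
  where
  first : ∀ s → B (1 ∷ replicate s 1 ++ k ∷ ks) ≈ B ((replicate s 1 ++ k ∷ ks) ++ 1 ∷ [])
  first zero = ≈-B-move1 k ks c
  first (suc s) = ≈-B-move1 1 (replicate s 1 ++ k ∷ ks) (≤-refl ∷ Allₚ.++⁺ (Allₚ.replicate⁺ s ≤-refl) c)

-- Reversing the whole word restores the core but puts the runs of length 1 in front, from where
-- `≈-B-move` takes them back to the end.
≈-B-reverse-core : ∀ k ks r → Composition (k ∷ ks) → B (reverse (k ∷ ks) ++ replicate r 1) ≈ B ((k ∷ ks) ++ replicate r 1)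
≈-B-reverse-core k ks r c = ≈-trans (≈-sym (≈-B-reverse (reverse (k ∷ ks) ++ replicate r 1)))
  (≈-trans (≈-reflexive (cong B (trans (reverse-++ (reverse (k ∷ ks)) (replicate r 1))
    (cong₂ _++_ (reverse-replicate r 1) (reverse-involutive (k ∷ ks))))))
  (≈-B-move r k ks c))

-- Words with a prescribed number of runs

changes : Bool → Word → ℕ
changes c [] = 0
changes c (d ∷ v) = (if c ==ᵇ d then 0 else 1) + changes d v

changes-triangle : ∀ c d x → changes c x ≤ (if c ==ᵇ d then 0 else 1) + changes d x
changes-triangle c d [] = z≤n
changes-triangle false false (e ∷ x) = ≤-refl
changes-triangle true true (e ∷ x) = ≤-refl
changes-triangle false true (false ∷ x) = m≤n⇒m≤1+n (n≤1+n _)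
changes-triangle false true (true ∷ x) = ≤-refl
changes-triangle true false (false ∷ x) = ≤-refl
changes-triangle true false (true ∷ x) = m≤n⇒m≤1+n (n≤1+n _)

changes-⊆ : ∀ c {x v} → x ⊆ v → changes c x ≤ changes c v
changes-⊆ c [] = z≤n
changes-⊆ c {x} (d ∷ʳ σ) = ≤-trans (changes-triangle c d x) (+-monoʳ-≤ (if c ==ᵇ d then 0 else 1) (changes-⊆ d σ))
changes-⊆ c (_∷_ {x = d} refl σ) = +-monoʳ-≤ (if c ==ᵇ d then 0 else 1) (changes-⊆ d σ)

==ᵇ-refl : ∀ b → (b ==ᵇ b) ≡ true
==ᵇ-refl false = refl
==ᵇ-refl true = refl

==ᵇ-not : ∀ b → (b ==ᵇ not b) ≡ false
==ᵇ-not false = refl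
==ᵇ-not true = refl

changes-same : ∀ b v → changes b (b ∷ v) ≡ changes b v
changes-same b v = cong (λ c → (if c then 0 else 1) + changes b v) (==ᵇ-refl b)

changes-diff : ∀ b v → changes b (not b ∷ v) ≡ suc (changes (not b) v)
changes-diff b v = cong (λ c → (if c then 0 else 1) + changes (not b) v) (==ᵇ-not b)

changes-replicate : ∀ b n v → changes b (replicate n b ++ v) ≡ changes b v
changes-replicate b zero v = refl
changes-replicate b (suc n) v = trans (changes-same b (replicate n b ++ v)) (changes-replicate b n v)

changes-Bfrom : ∀ b {ns} → Composition ns → changes b (Bfrom (not b) ns) ≡ length ns
changes-Bfrom b [] = refl
changes-Bfrom b {suc n ∷ ns} (_ ∷ c) = trans (changes-diff b (replicate n (not b) ++ Bfrom (not (not b)) ns)) (cong suc (trans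
  (changes-replicate (not b) n (Bfrom (not (not b)) ns)) (changes-Bfrom (not b) c)))

countWords-letter : ∀ b m q → countWords (suc m) q ≡ countWords m (q ∘ (b ∷_)) + countWords m (q ∘ (not b ∷_))
countWords-letter false m q = refl
countWords-letter true m q = +-comm (countWords m (q ∘ (false ∷_))) _

countWords-none : ∀ m {q} → (∀ v → length v ≡ m → ¬ T (q v)) → countWords m q ≡ 0
countWords-none zero {q} f with q [] | f [] refl
... | false | _ = refl
... | true | g = ⊥-elim (g tt)
countWords-none (suc m) f = cong₂ _+_ (countWords-none m λ v e → f (false ∷ v) (cong suc e))
  (countWords-none m λ v e → f (true ∷ v) (cong suc e))

-- For a nonempty composition `ns`, containment already forces at least `length ns` runs in `b ∷ v`;
-- the bound leaves exactly that many, and then the runs can only be matched one to one.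
sameRunsᵇ : Bool → List ℕ → Word → Bool
sameRunsᵇ b ns v = subᵇ (Bfrom b ns) (b ∷ v) ∧ (changes b v ≤ᵇ pred (length ns))

-- Words with the same number of runs as B ns whose runs dominate those of B ns.
countSameRuns : Bool → List ℕ → ℕ → ℕ
countSameRuns b ns m = countWords m (sameRunsᵇ b ns)

-- The binomial coefficient `r + s` over `r`: the number of ways to distribute `s` surplus letters
-- over `r + 1` runs.
compositionsWithSlack : ℕ → ℕ → ℕ
compositionsWithSlack zero s = 1
compositionsWithSlack (suc r) zero = 1
compositionsWithSlack (suc r) (suc s) = compositionsWithSlack (suc r) s + compositionsWithSlack r (suc s)

length-Bfrom : ∀ b ns → length (Bfrom b ns) ≡ sum ns
length-Bfrom b [] = refl
length-Bfrom b (n ∷ ns) = trans (length-++ (replicate n b)) (cong₂ _+_ (length-replicate n) (length-Bfrom (not b) ns))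

countSameRuns-none : ∀ b ns m → suc m < sum ns → countSameRuns b ns m ≡ 0
countSameRuns-none b ns m lt = countWords-none m λ v e t → <⇒≱ lt (subst₂ _≤_ (length-Bfrom b ns) (cong suc e)
  (Sub.length-mono-≤ (subᵇ⇒⊆ (Bfrom b ns) (b ∷ v) (proj₁ (T-∧⁻ {subᵇ (Bfrom b ns) (b ∷ v)} t)))))

-- If the letter changed right after the initial `b`, only one letter of the first run would be
-- matched; the rest of the pattern still starts with `b` and would need more changes than the bound
-- allows.
countSameRuns-long : ∀ b p ns m → Composition ns →
  countSameRuns b (suc (suc p) ∷ ns) (suc m) ≡ countSameRuns b (suc p ∷ ns) m
countSameRuns-long b p ns m c = trans (countWords-letter b m (sameRunsᵇ b (suc (suc p) ∷ ns))) (trans (cong₂ _+_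
  (countWords-cong m λ v _ → cong₂ (λ x y → x ∧ (y ≤ᵇ length ns)) (subᵇ-same b _ (b ∷ v)) (changes-same b v))
  (countWords-none m λ v _ t → absurd v (T-∧⁻ {subᵇ (Bfrom b (suc (suc p) ∷ ns)) (b ∷ not b ∷ v)} t)))
  (+-identityʳ _))
  where
  absurd : ∀ v → T (subᵇ (Bfrom b (suc (suc p) ∷ ns)) (b ∷ not b ∷ v)) × T (changes b (not b ∷ v) ≤ᵇ length ns) → ⊥
  absurd v (s , t) = <⇒≱ (subst (_≤ length ns) (changes-diff b v) (≤ᵇ⇒≤ _ _ t))
    (<⇒≤ (subst (_≤ changes (not b) v) (changes-Bfrom (not b) {suc p ∷ ns} (s≤s z≤n ∷ c))
      (changes-⊆ (not b) (subst (λ d → Bfrom d (suc p ∷ ns) ⊆ v) (sym (not-involutive b))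
        (subᵇ⇒⊆ (Bfrom b (suc p ∷ ns)) v (subst T (trans (subᵇ-same b _ (not b ∷ v)) (subᵇ-diff b _ v)) s))))))

countSameRuns-1 : ∀ b m → countSameRuns b (1 ∷ []) (suc m) ≡ countSameRuns b (1 ∷ []) m
countSameRuns-1 b m = trans (countWords-letter b m (sameRunsᵇ b (1 ∷ []))) (trans (cong₂ _+_
  (countWords-cong m λ v _ → cong₂ (λ x y → x ∧ (y ≤ᵇ 0)) (trans (subᵇ-same b [] (b ∷ v)) (sym (subᵇ-same b [] v))) (changes-same b v))
  (countWords-none m λ v _ t → subst (λ k → T (k ≤ᵇ 0)) (changes-diff b v) (proj₂ (T-∧⁻ {subᵇ (b ∷ []) (b ∷ not b ∷ v)} t))))
  (+-identityʳ _))

suc-≤ᵇ : ∀ a b → (suc a ≤ᵇ suc b) ≡ (a ≤ᵇ b)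
suc-≤ᵇ zero b = refl
suc-≤ᵇ (suc a) b = refl

-- The next letter either lengthens the first run, consuming surplus, or opens the second run.
countSameRuns-1∷ : ∀ b k ks m → countSameRuns b (1 ∷ suc k ∷ ks) (suc m) ≡
  countSameRuns b (1 ∷ suc k ∷ ks) m + countSameRuns (not b) (suc k ∷ ks) m
countSameRuns-1∷ b k ks m = trans (countWords-letter b m (sameRunsᵇ b (1 ∷ suc k ∷ ks))) (cong₂ _+_
  (countWords-cong m λ v _ → cong₂ (λ x y → x ∧ (y ≤ᵇ suc (length ks)))
    (trans (subᵇ-same b x (b ∷ v)) (trans (skip b v) (sym (subᵇ-same b x v)))) (changes-same b v))
  (countWords-cong m λ v _ → cong₂ _∧_ (subᵇ-same b x (not b ∷ v))
    (trans (cong (_≤ᵇ suc (length ks)) (changes-diff b v)) (suc-≤ᵇ (changes (not b) v) (length ks)))))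
  where
  x = Bfrom (not b) (suc k ∷ ks)
  skip : ∀ b v → subᵇ (Bfrom (not b) (suc k ∷ ks)) (b ∷ v) ≡ subᵇ (Bfrom (not b) (suc k ∷ ks)) v
  skip false v = refl
  skip true v = refl

countSameRuns-formula : ∀ b n ns m s → Composition (n ∷ ns) → sum (n ∷ ns) + s ≡ suc m →
  countSameRuns b (n ∷ ns) m ≡ compositionsWithSlack (length ns) s
countSameRuns-formula b 1 [] zero s _ e = base b
  where
  base : ∀ b → countSameRuns b (1 ∷ []) 0 ≡ 1
  base false = refl
  base true = refl
countSameRuns-formula b 1 [] (suc m) s c e =
  trans (countSameRuns-1 b m) (countSameRuns-formula b 1 [] m m c refl)
countSameRuns-formula b 1 (suc k ∷ ks) (suc m) zero (_ ∷ c) e = trans (countSameRuns-1∷ b k ks m) (cong₂ _+_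
  (countSameRuns-none b (1 ∷ suc k ∷ ks) m (≤-reflexive (sym (trans (sym (+-identityʳ _)) e))))
  (trans (countSameRuns-formula (not b) (suc k) ks m 0 c (suc-injective e)) (no-slack (length ks))))
  where
  no-slack : ∀ r → compositionsWithSlack r 0 ≡ 1
  no-slack zero = refl
  no-slack (suc r) = refl
countSameRuns-formula b 1 (suc k ∷ ks) (suc m) (suc s) c@(_ ∷ c') e = trans (countSameRuns-1∷ b k ks m) (cong₂ _+_
  (countSameRuns-formula b 1 (suc k ∷ ks) m s c (suc-injective (trans (sym (+-suc _ s)) e)))
  (countSameRuns-formula (not b) (suc k) ks m (suc s) c' (suc-injective e)))
countSameRuns-formula b 1 (suc k ∷ ks) zero s c e = contradiction e λ ()
countSameRuns-formula b (suc (suc p)) ns (suc m) s (_ ∷ c) e =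
  trans (countSameRuns-long b p ns m c) (countSameRuns-formula b (suc p) ns m s (s≤s z≤n ∷ c) (suc-injective e))
countSameRuns-formula b (suc (suc p)) ns zero s c e = contradiction e λ ()
countSameRuns-formula b 1 (zero ∷ ks) m s (_ ∷ () ∷ _) e
countSameRuns-formula b zero ns m s (() ∷ _) e

countSameRuns-independent : ∀ b n ns k ks m → Composition (n ∷ ns) → Composition (k ∷ ks) →
  length ns ≡ length ks → sum (n ∷ ns) ≡ sum (k ∷ ks) → countSameRuns b (n ∷ ns) m ≡ countSameRuns b (k ∷ ks) m
countSameRuns-independent b n ns k ks m c d len e with sum (n ∷ ns) ≤? suc m
... | yes le = trans (countSameRuns-formula b n ns m (suc m ∸ sum (n ∷ ns)) c (m+[n∸m]≡n le))
  (sym (trans (countSameRuns-formula b k ks m (suc m ∸ sum (n ∷ ns)) d (trans (cong (_+ (suc m ∸ sum (n ∷ ns))) (sym e)) (m+[n∸m]≡n le)))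
    (cong (λ r → compositionsWithSlack r (suc m ∸ sum (n ∷ ns))) (sym len))))
... | no gt = trans (countSameRuns-none b (n ∷ ns) m (≰⇒> gt))
  (sym (countSameRuns-none b (k ∷ ks) m (subst (suc m <_) e (≰⇒> gt))))

drops-changes-false : ∀ u → drops (false ∷ u) + drops (false ∷ u) ≤ changes false u ×
  changes false u ≤ suc (drops (false ∷ u) + drops (false ∷ u))
drops-changes-true : ∀ u → drops (true ∷ u) + drops (true ∷ u) ≤ suc (changes true u) ×
  changes true u ≤ drops (true ∷ u) + drops (true ∷ u)
drops-changes-false [] = z≤n , z≤n
drops-changes-false (false ∷ u) = drops-changes-false u
drops-changes-false (true ∷ u) = let (a , b) = drops-changes-true u in a , s≤s b
drops-changes-true [] = z≤n , z≤n
drops-changes-true (true ∷ u) = drops-changes-true u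
drops-changes-true (false ∷ u) = let (a , b) = drops-changes-false u; e = cong suc (sym (+-suc d d)) in
    ≤-trans (≤-reflexive (sym e)) (s≤s (s≤s a)) , ≤-trans (s≤s b) (≤-reflexive e)
  where d = drops (false ∷ u)

-- After an initial `false` the changes are alternately `01` and `10`, so `d` drops go with `2d` or
-- `2d + 1` changes. The bound 3 is the limit of four runs.
fewDrops⇔fewChanges : ∀ u → (drops (false ∷ u) ≤ᵇ 1) ≡ (changes false u ≤ᵇ 3)
fewDrops⇔fewChanges u with drops (false ∷ u) | drops-changes-false u
... | zero | _ , b = sym (Equivalence.to T-≡ (≤⇒≤ᵇ (≤-trans b (s≤s z≤n))))
... | suc zero | _ , b = sym (Equivalence.to T-≡ (≤⇒≤ᵇ b))
... | suc (suc d) | a , _ = sym (T⇔⇒≡ (λ t → ⊥-elim (<⇒≱ (≤-trans (s≤s (≤-trans (m≤m+n 3 (d + d)) (≤-reflexive (four d)))) a) (≤ᵇ⇒≤ (changes false u) 3 t))) λ ())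
  where
  four : ∀ d → 3 + (d + d) ≡ suc d + suc (suc d)
  four d = cong suc (trans (cong suc (sym (+-suc d d))) (sym (+-suc d (suc d))))

countWords-split : ∀ m (p q : Word → Bool) → countWords m p ≡
  countWords m (λ v → p v ∧ q v) + countWords m (λ v → p v ∧ not (q v))
countWords-split m p q = trans (countWords≡length m p) (trans (length-filterᵇ-split p q (words m))
  (sym (cong₂ _+_ (countWords≡length m (λ v → p v ∧ q v)) (countWords≡length m (λ v → p v ∧ not (q v))))))

countTwoDrops : List ℕ → ℕ → ℕ
countTwoDrops ns m = countWords m (λ u → subᵇ (B ns) (false ∷ u) ∧ twoDropsᵇ (false ∷ u))

countSub : List ℕ → ℕ → ℕ
countSub ns m = countWords m (λ u → subᵇ (B ns) (false ∷ u))

countSub-independent : ∀ n ns k ks m → sum (suc n ∷ ns) ≡ sum (suc k ∷ ks) →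
  countSub (suc n ∷ ns) m ≡ countSub (suc k ∷ ks) m
countSub-independent n ns k ks m e = countWords-subᵇ m (replicate n false ++ Bfrom true ns) (replicate k false ++ Bfrom true ks) (suc-injective
  (trans (length-Bfrom false (suc n ∷ ns)) (trans e (sym (length-Bfrom false (suc k ∷ ks))))))

-- The number of words containing the pattern depends only on its length. Those among them with at
-- most one drop are the words with exactly four runs, whose number depends only on the length and
-- number of runs; the difference is what is wanted.
countTwoDrops-independent : ∀ n ns k ks m → Composition (n ∷ ns) → Composition (k ∷ ks) →
  length ns ≡ 3 → length ks ≡ 3 → sum (n ∷ ns) ≡ sum (k ∷ ks) → countTwoDrops (n ∷ ns) m ≡ countTwoDrops (k ∷ ks) m
countTwoDrops-independent (suc n) ns (suc k) ks m c d len len' e = +-cancelˡ-≡ (countSameRuns false (suc n ∷ ns) m) _ _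
  (trans (sym (splitting n ns len)) (trans (countSub-independent n ns k ks m e) (trans (splitting k ks len')
    (cong (_+ countTwoDrops (suc k ∷ ks) m)
      (sym (countSameRuns-independent false (suc n) ns (suc k) ks m c d (trans len (sym len')) e))))))
  where
  splitting : ∀ n ns → length ns ≡ 3 → countSub (suc n ∷ ns) m ≡
    countSameRuns false (suc n ∷ ns) m + countTwoDrops (suc n ∷ ns) m
  splitting n ns len = trans (countWords-split m (λ u → subᵇ (B (suc n ∷ ns)) (false ∷ u)) (λ u → drops (false ∷ u) ≤ᵇ 1))
    (cong (_+ countTwoDrops (suc n ∷ ns) m) (countWords-cong m λ u _ → cong (subᵇ (B (suc n ∷ ns)) (false ∷ u) ∧_)
      (trans (fewDrops⇔fewChanges u) (cong (changes false u ≤ᵇ_) (sym len)))))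
countTwoDrops-independent zero _ _ _ _ (() ∷ _) _ _ _ _
countTwoDrops-independent (suc n) _ zero _ _ _ (() ∷ _) _ _ _

-- The forms of the theorem

runs-replicate : ∀ b n w → runs (b ∷ replicate n b ++ w) ≡ runs (b ∷ w)
runs-replicate b zero w = refl
runs-replicate b (suc n) w = trans (cong (λ c → (if c then 0 else 1) + runs (b ∷ replicate n b ++ w)) (==ᵇ-refl b))
  (runs-replicate b n w)

runs-Bfrom : ∀ b {ns} → Composition ns → runs (Bfrom b ns) ≡ length ns
runs-Bfrom b [] = refl
runs-Bfrom b {suc n ∷ []} (_ ∷ []) = runs-replicate b n []
runs-Bfrom b {suc n ∷ suc k ∷ ns} (_ ∷ c) = trans (runs-replicate b n (Bfrom (not b) (suc k ∷ ns)))
  (cong₂ (λ x y → (if x then 0 else 1) + y) (==ᵇ-not b) (runs-Bfrom (not b) c))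
runs-Bfrom b {zero ∷ _} (() ∷ _)
runs-Bfrom b {suc _ ∷ zero ∷ _} (_ ∷ () ∷ _)

word-composition : ∀ b w → ∃[ n ] ∃[ ns ] (b ∷ w ≡ Bfrom b (suc n ∷ ns) × Composition ns)
word-composition b [] = 0 , [] , refl , []
word-composition false (false ∷ w) with word-composition false w
... | n , ns , e , c = suc n , ns , cong (false ∷_) e , c
word-composition true (true ∷ w) with word-composition true w
... | n , ns , e , c = suc n , ns , cong (true ∷_) e , c
word-composition false (true ∷ w) with word-composition true w
... | n , ns , e , c = 0 , suc n ∷ ns , cong (false ∷_) e , s≤s z≤n ∷ c
word-composition true (false ∷ w) with word-composition false w
... | n , ns , e , c = 0 , suc n ∷ ns , cong (true ∷_) e , s≤s z≤n ∷ c

Alternating-tail : ∀ {b w} → Alternating (b ∷ w) → Alternating w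
Alternating-tail {w = []} _ = tt
Alternating-tail {w = c ∷ w} (_ , a) = a

Alternating⇒ones : ∀ b {ns} → Composition ns → Alternating (Bfrom b ns) → ns ≡ replicate (length ns) 1
Alternating⇒ones b [] a = refl
Alternating⇒ones b {1 ∷ ns} (_ ∷ c) a = cong (1 ∷_) (Alternating⇒ones (not b) c (Alternating-tail a))
Alternating⇒ones b {suc (suc n) ∷ ns} (_ ∷ c) (ne , _) = contradiction refl ne
Alternating⇒ones b {zero ∷ ns} (() ∷ _) a

ones-Alternating : ∀ b n → Alternating (Bfrom b (replicate n 1))
ones-Alternating b zero = tt
ones-Alternating b (suc zero) = tt
ones-Alternating b (suc (suc n)) = b≢not b , ones-Alternating (not b) (suc n)
  where
  b≢not : ∀ b → b ≢ not b
  b≢not false ()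
  b≢not true ()

Composition-ones : ∀ n → Composition (replicate n 1)
Composition-ones n = Allₚ.replicate⁺ n ≤-refl

dual : Word → Word
dual w = complement (reverse w)

length-dual : ∀ w → length (dual w) ≡ length w
length-dual w = trans (length-map not (reverse w)) (length-reverse w)

dual-B : ∀ ns → dual (B ns) ≡ Bfrom (letterAt false (length ns)) (reverse ns)
dual-B ns = trans (cong complement (reverse-Bfrom false ns)) (trans (Bfrom-complement _ (reverse ns))
  (cong (λ b → Bfrom b (reverse ns)) (trans (cong not (letterAt-not false (length ns))) (not-involutive _))))

P-Bfrom-rotation : ∀ b ns → Rotation (P (B ns)) (P (Bfrom b ns))
P-Bfrom-rotation false ns = Rotation-refl
P-Bfrom-rotation true ns = subst (λ w → Rotation (P (B ns)) (P w)) (Bfrom-complement false ns) (P-complement (B ns))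

P-dual-rotation : ∀ ns → Rotation (P (B (reverse ns))) (P (dual (B ns)))
P-dual-rotation ns = subst (λ w → Rotation (P (B (reverse ns))) (P w)) (sym (dual-B ns)) (P-Bfrom-rotation _ (reverse ns))

split-at : ∀ {A : Set} (xs : List A) {i x} → xs !! i ≡ just x → ∃[ as ] ∃[ bs ] (xs ≡ as ++ x ∷ bs × length as ≡ i)
split-at (x ∷ xs) {zero} refl = [] , xs , refl , refl
split-at (x ∷ xs) {suc i} e with split-at xs e
... | as , bs , refl , refl = x ∷ as , bs , refl , refl

dual-!! : ∀ w {j c} → w !! j ≡ just c → dual w !! (length w ∸ 1 ∸ j) ≡ just (not c)
dual-!! w {j} {c} e with split-at w e
... | as , bs , refl , refl = trans (cong₂ _!!_ shape index) (!!-offset (dual bs) 0 refl)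
  where
  shape : dual (as ++ c ∷ bs) ≡ dual bs ++ not c ∷ dual as
  shape = trans (cong complement (trans (reverse-++ as (c ∷ bs)) (trans (cong (_++ reverse as) (unfold-reverse c bs))
    (++-assoc (reverse bs) (c ∷ []) (reverse as))))) (map-++ not (reverse bs) (c ∷ reverse as))
  index : length (as ++ c ∷ bs) ∸ 1 ∸ length as ≡ length (dual bs) + 0
  index = trans (cong (λ n → n ∸ 1 ∸ length as) (trans (length-++ as) (+-suc (length as) (length bs))))
    (trans (m+n∸m≡n (length as) (length bs)) (trans (sym (length-dual bs)) (sym (+-identityʳ _))))

∈-positions⁻ : ∀ b k z {v} → v ∈ positions b k z → ∃[ d ] (v ≡ k + d × z !! d ≡ just b)
∈-positions⁻ false k (false ∷ z) (here refl) = 0 , sym (+-identityʳ k) , refl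
∈-positions⁻ true k (true ∷ z) (here refl) = 0 , sym (+-identityʳ k) , refl
∈-positions⁻ false k (false ∷ z) (there i) with ∈-positions⁻ false (suc k) z i
... | d , refl , e = suc d , sym (+-suc k d) , e
∈-positions⁻ false k (true ∷ z) i with ∈-positions⁻ false (suc k) z i
... | d , refl , e = suc d , sym (+-suc k d) , e
∈-positions⁻ true k (false ∷ z) i with ∈-positions⁻ true (suc k) z i
... | d , refl , e = suc d , sym (+-suc k d) , e
∈-positions⁻ true k (true ∷ z) (there i) with ∈-positions⁻ true (suc k) z i
... | d , refl , e = suc d , sym (+-suc k d) , e

∈-positions⁺ : ∀ b k z d → z !! d ≡ just b → k + d ∈ positions b k z
∈-positions⁺ false k (false ∷ z) zero e = here (+-identityʳ k)
∈-positions⁺ true k (true ∷ z) zero e = here (+-identityʳ k)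
∈-positions⁺ false k (false ∷ z) (suc d) e = there (subst (_∈ positions false (suc k) z) (sym (+-suc k d)) (∈-positions⁺ false (suc k) z d e))
∈-positions⁺ false k (true ∷ z) (suc d) e = subst (_∈ positions false (suc k) z) (sym (+-suc k d)) (∈-positions⁺ false (suc k) z d e)
∈-positions⁺ true k (false ∷ z) (suc d) e = subst (_∈ positions true (suc k) z) (sym (+-suc k d)) (∈-positions⁺ true (suc k) z d e)
∈-positions⁺ true k (true ∷ z) (suc d) e = there (subst (_∈ positions true (suc k) z) (sym (+-suc k d)) (∈-positions⁺ true (suc k) z d e))

increasing-!! : ∀ {xs i x y} → Increasing xs → xs !! i ≡ just x → xs !! suc i ≡ just y → x < y
increasing-!! {x ∷ y ∷ xs} {zero} ((lt ∷ _) ∷ _) refl refl = lt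
increasing-!! {x ∷ xs} {suc i} (_ ∷ inc) e f = increasing-!! {xs} {i} inc e f

!!-++-< : ∀ {A : Set} (xs : List A) {ys i x} → i < length xs → (xs ++ ys) !! i ≡ just x → xs !! i ≡ just x
!!-++-< xs lt e with !!-++⁻ xs e
... | inj₁ f = f
... | inj₂ (j , refl , _) = contradiction lt (≤⇒≯ (m≤m+n (length xs) j))

descent-position : ∀ {xs ys d} → Increasing xs → Increasing ys → DescentAt (xs ++ ys) d → suc d ≡ length xs
descent-position {xs} {ys} {d} ia ib (x , y , ex , ey , lt) with <-cmp (suc d) (length xs)
... | tri≈ _ e _ = e
... | tri< l _ _ = contradiction (increasing-!! {xs} ia (!!-++-< xs (<⇒≤ l) ex) (!!-++-< xs l ey)) (<-asym lt)
... | tri> _ _ (s≤s g) with !!-++⁻ xs {i = d} ex | !!-++⁻ xs {i = suc d} ey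
... | inj₁ e | _ = contradiction (!!-< {xs = xs} e) (≤⇒≯ g)
... | inj₂ _ | inj₁ e = contradiction (!!-< {xs = xs} e) (≤⇒≯ (m≤n⇒m≤1+n g))
... | inj₂ (j , refl , e) | inj₂ (j' , e' , f) with +-cancelˡ-≡ (length xs) (suc j) j' (trans (+-suc (length xs) j) e')
... | refl = contradiction (increasing-!! {ys} ib e f) (<-asym lt)

true∷false⇒¬increasing : ∀ {z} → true∷false ⊆ z → ¬ Increasing (P z)
true∷false⇒¬increasing {z} ι inc with drop-positions 0 ι
... | t , f , t∈ , f∈ , t<f = <-asym t<f (increasing-++ (positions false 0 z) inc f∈ t∈)

P-descent : ∀ {z} → true∷false ⊆ z → descents (P z) ≡ 1 × ∃[ d ] DescentAt (P z) d
P-descent {z} ι with first-descent (P z) (unique (P-permutation z))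
... | inj₁ inc = contradiction inc (true∷false⇒¬increasing ι)
... | inj₂ (as , x , y , bs , e , gt , _) =
  ≤-antisym (descents-P z) (≤-trans (s≤s z≤n) (≤-trans (descents-descent as {bs = bs} gt) (≤-reflexive (cong descents (sym e))))) ,
  length as + 0 , x , y , trans (cong (_!! (length as + 0)) e) (!!-offset as 0 refl) ,
  trans (cong₂ _!!_ e (sym (+-suc (length as) 0))) (!!-offset as 1 refl) , gt

-- In `P z` the positions of `false` come before the descent and those of `true` after it, and
-- letter `n - 1 - j` of `z = dual w` is the complement of letter `j` of `w`. The subword `10`
-- guarantees a descent, which can only sit where the two halves meet.
isG-dual : ∀ w → StartsWith0 w → 3 ≤ runs w → true∷false ⊆ dual w → IsG w (P (dual w))
isG-dual w s r ι = s , Permutation⇒IsPerm _ (P-permutation z) , trans (length-P z) (length-dual w) ,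
  inj₂ (r , proj₁ (P-descent ι) , λ j lt → mk⇔ forward (backward (!!-just {xs = w} lt)))
  where
  z = dual w
  lows = positions false 0 z
  position : ∀ {d} → DescentAt (P z) d → suc d ≡ length lows
  position = descent-position (positions-increasing false 0 z) (positions-increasing true 0 z)
  forward : ∀ {j} → w !! j ≡ just false → AppearsAfterDescent (P z) (length w ∸ 1 ∸ j)
  forward {j} e with ∈-!! (∈-positions⁺ true 0 z _ (dual-!! w e)) | proj₂ (P-descent ι)
  ... | p , e' | d , de = d , length lows + p , de , !!-offset lows p e' ,
    ≤-trans (≤-reflexive (position de)) (m≤m+n _ p)
  backward : ∀ {j} → (∃[ c ] w !! j ≡ just c) → AppearsAfterDescent (P z) (length w ∸ 1 ∸ j) → w !! j ≡ just false
  backward (false , e) _ = e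
  backward {j} (true , e) (d , p , de , pe , lt) with !!-++⁻ lows pe
  ... | inj₁ f = contradiction (!!-< {xs = lows} f) (≤⇒≯ (subst (_≤ p) (position de) lt))
  ... | inj₂ (q , refl , f) with ∈-positions⁻ true 0 z (!!-∈ {xs = positions true 0 z} f)
  ... | d , e' , h with trans (sym h) (trans (cong (z !!_) (sym e')) (dual-!! w e))
  ... | ()

isIG-dual : ∀ w → IsG w (P (dual w)) → IsIG w (Q (dual w))
isIG-dual w g = P (dual w) , g , Permutation⇒IsPerm _ (Q-permutation (dual w)) ,
  trans (length-Q (dual w)) (sym (length-P (dual w))) , P-Q-inverse (dual w)

isG-identity : ∀ n → IsG (replicate (suc n) false ++ []) (upTo (suc n))
isG-identity n = refl , Permutation⇒IsPerm _ (↭-reflexive (cong upTo (sym (length-upTo (suc n))))) ,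
  trans (length-upTo (suc n)) (sym len) ,
  inj₁ (≤-trans (≤-reflexive (runs-Bfrom false {suc n ∷ []} (s≤s z≤n ∷ []))) (s≤s z≤n) , cong upTo (sym len))
  where
  len : length (replicate (suc n) false ++ []) ≡ suc n
  len = trans (cong length (++-identityʳ (replicate (suc n) false))) (length-replicate (suc n))

true∷false⊆Bfrom : ∀ b {a k c d ns} → Composition (a ∷ k ∷ c ∷ d ∷ ns) → true∷false ⊆ Bfrom b (a ∷ k ∷ c ∷ d ∷ ns)
true∷false⊆Bfrom false {suc a} {suc k} {suc c} (_ ∷ _ ∷ _ ∷ _ ∷ _) = Sub.++⁺ˡ (replicate (suc a) false)
  (refl ∷ Sub.++⁺ˡ (replicate k true) (refl ∷ minimum _))
true∷false⊆Bfrom true {suc a} {suc k} (_ ∷ _ ∷ _ ∷ _ ∷ _) = refl ∷ Sub.++⁺ˡ (replicate a true) (refl ∷ minimum _)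
true∷false⊆Bfrom _ {suc a} {zero} (_ ∷ () ∷ _)
true∷false⊆Bfrom false {suc a} {suc k} {zero} (_ ∷ _ ∷ () ∷ _)
true∷false⊆Bfrom _ {zero} (() ∷ _)

true∷false⊆long : ∀ b {ns} → Composition ns → 4 ≤ length ns → true∷false ⊆ Bfrom b ns
true∷false⊆long b {_ ∷ _ ∷ _ ∷ _ ∷ _} c le = true∷false⊆Bfrom b c
true∷false⊆long b {[]} c ()
true∷false⊆long b {_ ∷ []} c (s≤s ())
true∷false⊆long b {_ ∷ _ ∷ []} c (s≤s (s≤s ()))
true∷false⊆long b {_ ∷ _ ∷ _ ∷ []} c (s≤s (s≤s (s≤s ())))

StartsWith0-B : ∀ {ns} → Composition ns → 1 ≤ length ns → StartsWith0 (B ns)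
StartsWith0-B {suc n ∷ ns} _ _ = refl
StartsWith0-B {zero ∷ ns} (() ∷ _) _

isG-B : ∀ {ns} → Composition ns → 4 ≤ length ns → IsG (B ns) (P (dual (B ns)))
isG-B {ns} c le = isG-dual (B ns) (StartsWith0-B c (≤-trans (s≤s z≤n) le))
  (≤-trans (≤-trans (n≤1+n 3) le) (≤-reflexive (sym (runs-Bfrom false c))))
  (subst (true∷false ⊆_) (sym (dual-B ns)) (true∷false⊆long _ (Composition-reverse c)
    (subst (4 ≤_) (sym (length-reverse ns)) le)))

module _ {A : Set} where

  initLast : ∀ (x : A) xs → ∃[ ys ] ∃[ y ] (x ∷ xs ≡ ys ++ y ∷ [])
  initLast x [] = [] , x , refl
  initLast x (x' ∷ xs) with initLast x' xs
  ... | ys , y , e = x ∷ ys , y , cong (x ∷_) e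

≤lex-total : ∀ xs ys → xs ≤lex ys ⊎ ys ≤lex xs
≤lex-total [] ys = inj₁ tt
≤lex-total (x ∷ xs) [] = inj₂ tt
≤lex-total (x ∷ xs) (y ∷ ys) with <-cmp x y | ≤lex-total xs ys
... | tri< lt _ _ | _ = inj₁ (inj₁ lt)
... | tri> _ _ gt | _ = inj₂ (inj₁ gt)
... | tri≈ _ refl _ | inj₁ le = inj₁ (inj₂ (refl , le))
... | tri≈ _ refl _ | inj₂ le = inj₂ (inj₂ (refl , le))

orient : ∀ ns → ∃[ ms ] ((ms ≡ ns ⊎ ms ≡ reverse ns) × reverse ms ≤lex ms)
orient ns with ≤lex-total (reverse ns) ns
... | inj₁ le = ns , inj₁ refl , le
... | inj₂ le = reverse ns , inj₂ refl , subst (_≤lex reverse ns) (sym (reverse-involutive ns)) le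

last?-snoc : ∀ xs x → last? (xs ++ x ∷ []) ≡ just x
last?-snoc [] x = refl
last?-snoc (y ∷ []) x = refl
last?-snoc (y ∷ z ∷ xs) x = last?-snoc (z ∷ xs) x

last?-reverse : ∀ xs → last? (reverse xs) ≡ head? xs
last?-reverse [] = refl
last?-reverse (x ∷ xs) = trans (cong last? (unfold-reverse x xs)) (last?-snoc (reverse xs) x)

head?-reverse : ∀ xs → head? (reverse xs) ≡ last? xs
head?-reverse xs = trans (sym (last?-reverse (reverse xs))) (cong last? (reverse-involutive xs))

strip-leading-ones : ∀ ks → ks ≡ replicate (length ks) 1 ⊎
  ∃[ s ] ∃[ k ] ∃[ ls ] (ks ≡ replicate s 1 ++ k ∷ ls × k ≢ 1)
strip-leading-ones [] = inj₁ refl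
strip-leading-ones (k ∷ ks) with k ≟ 1
... | no ne = inj₂ (0 , k , ks , refl , ne)
... | yes refl with strip-leading-ones ks
... | inj₁ e = inj₁ (cong (1 ∷_) e)
... | inj₂ (s , k , ls , e , ne) = inj₂ (suc s , k , ls , cong (1 ∷_) e , ne)

strip-trailing-ones : ∀ ks → ks ≡ replicate (length ks) 1 ⊎
  ∃[ k ] ∃[ ls ] ∃[ r ] (ks ≡ (k ∷ ls) ++ replicate r 1 × last? (k ∷ ls) ≢ just 1)
strip-trailing-ones [] = inj₁ refl
strip-trailing-ones (k ∷ ks) with strip-trailing-ones ks
... | inj₂ (k' , ls , r , e , ne) = inj₂ (k , k' ∷ ls , r , cong (k ∷_) e , ne)
... | inj₁ e with k ≟ 1
... | yes refl = inj₁ (cong (1 ∷_) e)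
... | no ne = inj₂ (k , [] , length ks , cong (k ∷_) e , ne ∘ just-injective)

strip-ones : ∀ ks → ks ≡ replicate (length ks) 1 ⊎ ∃[ s ] ∃[ k ] ∃[ ls ] ∃[ r ]
  (ks ≡ replicate s 1 ++ (k ∷ ls) ++ replicate r 1 × k ≢ 1 × last? (k ∷ ls) ≢ just 1)
strip-ones ks with strip-leading-ones ks
... | inj₁ e = inj₁ e
... | inj₂ (s , k , ls , e , ne) with strip-trailing-ones (k ∷ ls)
... | inj₁ e' = contradiction (∷-injectiveˡ e') ne
... | inj₂ (k' , ls' , r , e' , ne') with ∷-injectiveˡ e'
... | refl = inj₂ (s , k , ls' , r , trans e (cong (replicate s 1 ++_) e') , ne , ne')

parity : ∀ n → Even n ⊎ (∃[ h ] n ≡ suc (h + h))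
parity zero = inj₁ (0 , refl)
parity (suc n) with parity n
... | inj₁ (h , e) = inj₂ (h , cong suc e)
... | inj₂ (h , e) = inj₁ (suc h , trans (cong suc e) (cong suc (sym (+-suc h h))))

letterAt-even : ∀ b {n} → Even n → letterAt b n ≡ b
letterAt-even b (zero , refl) = refl
letterAt-even b (suc h , refl) = trans (cong (letterAt (not b)) (+-suc h h))
  (trans (cong (λ c → letterAt c (h + h)) (not-involutive b)) (letterAt-even b (h , refl)))

-- Reduction to the forms

-- The initial `false` cannot take part in `10`, so the subword lies in `z`; complementing yields
-- `01` behind an initial `true`, and `101` contains `10`.
true∷false⊆complement : ∀ {z v} → true∷false ⊆ false ∷ z → complement (false ∷ z) ⊆ v → true∷false ⊆ v
true∷false⊆complement (_ ∷ʳ σ) τ = ⊆-trans (refl ∷ ⊆-trans (refl ∷ minimum _) (complement-⊆ σ)) τ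

Occurs-P-P : ∀ {z v} → true∷false ⊆ false ∷ z → Occurs (P (false ∷ v)) (P (false ∷ z)) →
  false ∷ z ⊆ false ∷ v ⊎ complement (false ∷ z) ⊆ false ∷ v
Occurs-P-P {z} {v} ι o with Occurs-P⁻ (false ∷ v) (P-permutation (false ∷ z)) refl o
... | z' , eq , s with P-injective {false ∷ z'} {false ∷ z} ι eq
... | refl = s

containsᵇ-P-P : ∀ {z} v → true∷false ⊆ false ∷ z → containsᵇ (P (false ∷ v)) (P (false ∷ z)) ≡ bothᵇ (false ∷ z) (false ∷ v)
containsᵇ-P-P {z} v ι = T⇔⇒≡
  (λ t → bothᵇ⁺ (Occurs-P-P {z} {v} ι (Contains⇒Occurs {P (false ∷ v)} {P (false ∷ z)} t)))
  (λ t → Occurs⇒Contains {P (false ∷ v)} {P (false ∷ z)} (λ ()) (Occurs-P⁺ (bothᵇ⁻ (false ∷ z) (false ∷ v) t)))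

containing-P : ∀ {z} m → true∷false ⊆ false ∷ z → containing (P (false ∷ z)) (suc m) ≡
  countWords m (λ v → bothᵇ (false ∷ z) (false ∷ v)) +
  countWords m (λ u → containsᵇ (Q (false ∷ u)) (P (false ∷ z)) ∧ twoDropsᵇ (false ∷ u))
containing-P {z} m ι = trans (containing-formula (P (false ∷ z)) m λ v o → nontrivial v (Occurs-P-P {z} {v} ι o))
  (cong (_+ countWords m (λ u → containsᵇ (Q (false ∷ u)) (P (false ∷ z)) ∧ twoDropsᵇ (false ∷ u)))
    (countWords-cong m λ v _ → containsᵇ-P-P {z} v ι))
  where
  nontrivial : ∀ v → false ∷ z ⊆ false ∷ v ⊎ complement (false ∷ z) ⊆ false ∷ v → true∷false ⊆ false ∷ v
  nontrivial v (inj₁ σ) = ⊆-trans ι σ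
  nontrivial v (inj₂ σ) = true∷false⊆complement ι σ

manyChanges⇒twoDrops : ∀ u → 4 ≤ changes false u → 2 ≤ drops (false ∷ u)
manyChanges⇒twoDrops u le = twoDrops⁻ (false ∷ u)
  (subst (T ∘ not) (sym (fewDrops⇔fewChanges u)) (¬T⇒T-not λ t → <⇒≱ le (≤ᵇ⇒≤ (changes false u) 3 t)))

-- The inverse of a P has at most one descent unlike Q (false ∷ z), the inverse of P (false ∷ z).
Q-¬occurs-P : ∀ {z} u → true∷false ⊆ false ∷ z → 4 ≤ changes false z → ¬ Occurs (Q (false ∷ u)) (P (false ∷ z))
Q-¬occurs-P {z} u ι le o with Occurs-Q⁻ (false ∷ u) (P-permutation (false ∷ z)) refl o
... | _ , _ , z' , _ , _ , eq = <⇒≱ (≤-trans (manyChanges⇒twoDrops z le)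
    (≤-reflexive (sym (trans (cong descents (Q≡P⇒P≡Q {false ∷ z'} {false ∷ z} eq)) (descents-Q (false ∷ z)))))) (descents-P (false ∷ z'))

containing-P-long : ∀ {z} m → true∷false ⊆ false ∷ z → 4 ≤ changes false z → containing (P (false ∷ z)) (suc m) ≡
  countWords m (λ v → bothᵇ (false ∷ z) (false ∷ v))
containing-P-long {z} m ι le = trans (containing-P m ι) (trans (cong (countWords m (λ v → bothᵇ (false ∷ z) (false ∷ v)) +_)
  (countWords-none m λ u _ t → Q-¬occurs-P {z} u ι le
    (Contains⇒Occurs {Q (false ∷ u)} {P (false ∷ z)} (proj₁ (T-∧⁻ {containsᵇ (Q (false ∷ u)) (P (false ∷ z))} t)))))
  (+-identityʳ _))

-- A pattern of a `P` starting with its minimum is again a `P` and has at most one descent, while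
-- five runs give `Q` at least two.
P-¬occurs-Q : ∀ {x} v → 4 ≤ changes false x → ¬ Occurs (P (false ∷ v)) (Q (false ∷ x))
P-¬occurs-Q {x} v le o with Occurs-P⁻ (false ∷ v) (Q-permutation (false ∷ x)) refl o
... | z , eq , _ = <⇒≱ (≤-trans (manyChanges⇒twoDrops x le)
    (≤-reflexive (trans (sym (descents-Q (false ∷ x))) (cong descents (sym eq))))) (descents-P (false ∷ z))

containing-Q : ∀ {x} m → 4 ≤ changes false x → (∀ u → Occurs (Q (false ∷ u)) (Q (false ∷ x)) → false ∷ x ⊆ false ∷ u) →
  containing (Q (false ∷ x)) (suc m) ≡ countWords m (subᵇ x)
containing-Q {x} m le criterion = trans
  (containing-formula (Q (false ∷ x)) m λ v o → contradiction o (P-¬occurs-Q {x} v le))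
  (cong₂ _+_ (countWords-none m λ v _ t → P-¬occurs-Q {x} v le (Contains⇒Occurs {P (false ∷ v)} {Q (false ∷ x)} t)) (countWords-cong m λ u _ → T⇔⇒≡
    (λ t → ⊆⇒subᵇ (criterion u
      (Contains⇒Occurs {Q (false ∷ u)} {Q (false ∷ x)} (proj₁ (T-∧⁻ {containsᵇ (Q (false ∷ u)) (Q (false ∷ x))} t)))))
    (λ t → T-∧⁺ (Occurs⇒Contains {Q (false ∷ u)} {Q (false ∷ x)} (λ ()) (Occurs-Q⁺ (subᵇ⇒⊆ (false ∷ x) (false ∷ u) t)))
      (twoDrops⁺ (false ∷ u) (manyChanges⇒twoDrops u
        (≤-trans le (changes-⊆ false (subᵇ⇒⊆ (false ∷ x) (false ∷ u) t))))))))

Occurs-Q-Q : ∀ {x} u → true∷false ⊆ false ∷ x → Occurs (Q (false ∷ u)) (Q (false ∷ x)) →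
  ∃[ i ] ∃[ p ] (p ++ replicate i false ≡ false ∷ x × replicate i true ++ p ⊆ false ∷ u)
Occurs-Q-Q {x} u ι c with Occurs-Q⁻ (false ∷ u) (Q-permutation (false ∷ x)) refl c
... | i , p , z , e , σ , eq with Q-injective {false ∷ z} {false ∷ x} ι eq
... | refl = i , p , e , σ

-- A word ending in `true` has no final block of `false` that could have been moved from the front,
-- so only the plain subword case remains.
Occurs-Q-ending-true : ∀ {x y} u → true∷false ⊆ false ∷ x → false ∷ x ≡ y ++ true ∷ [] →
  Occurs (Q (false ∷ u)) (Q (false ∷ x)) → false ∷ x ⊆ false ∷ u
Occurs-Q-ending-true {x} {y} u ι e o = no-twist (Occurs-Q-Q {x} u ι o)
  where
  no-twist : ∃[ i ] ∃[ p ] (p ++ replicate i false ≡ false ∷ x × replicate i true ++ p ⊆ false ∷ u) → false ∷ x ⊆ false ∷ u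
  no-twist (zero , p , e' , σ) = subst (_⊆ false ∷ u) (trans (sym (++-identityʳ p)) e') σ
  no-twist (suc i , p , e' , σ) with ∷ʳ-injectiveʳ y (p ++ replicate i false)
      (trans (sym e) (trans (sym e') (trans (cong (p ++_) (replicate-snoc i false)) (sym (++-assoc p _ _)))))
  ... | ()

-- The letters of `v` that differ from their predecessor, with `b` preceding the first, already form
-- an alternating word.
alternating-⊆ : ∀ b n v → n ≤ changes b v → Bfrom (not b) (replicate n 1) ⊆ v
alternating-⊆ b zero v le = minimum v
alternating-⊆ false (suc n) (false ∷ v) le = false ∷ʳ alternating-⊆ false (suc n) v le
alternating-⊆ true (suc n) (true ∷ v) le = true ∷ʳ alternating-⊆ true (suc n) v le
alternating-⊆ false (suc n) (true ∷ v) (s≤s le) = refl ∷ alternating-⊆ true n v le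
alternating-⊆ true (suc n) (false ∷ v) (s≤s le) = refl ∷ alternating-⊆ false n v le

changes-append : ∀ b p i → changes b (p ++ replicate i false) ≤ suc (changes b p)
changes-append b (c ∷ p) i = ≤-trans (+-monoʳ-≤ (if b ==ᵇ c then 0 else 1) (changes-append c p i)) (≤-reflexive (+-suc _ _))
changes-append b [] zero = z≤n
changes-append false [] (suc i) = ≤-trans (≤-reflexive (trans (cong (changes false) (sym (++-identityʳ (replicate i false))))
  (changes-replicate false i []))) z≤n
changes-append true [] (suc i) = s≤s (≤-trans (≤-reflexive (trans (cong (changes false) (sym (++-identityʳ (replicate i false))))
  (changes-replicate false i []))) z≤n)

-- Rotating a final block of letters false to the front as letters true does not lose changes.
changes-twist : ∀ i p x → p ++ replicate i false ≡ false ∷ x → changes false x ≤ changes false (replicate i true ++ p)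
changes-twist zero p x e = ≤-reflexive (cong (changes false) (sym (trans (sym (++-identityʳ p)) e)))
changes-twist (suc i) [] x refl = ≤-trans (≤-reflexive (trans (cong (changes false) (sym (++-identityʳ (replicate i false))))
  (changes-replicate false i []))) z≤n
changes-twist (suc i) (false ∷ p) x refl = ≤-trans (changes-append false p (suc i))
  (≤-trans (n≤1+n _) (≤-reflexive (cong suc (sym (changes-replicate true i (false ∷ p))))))

alternating : ℕ → Word
alternating n = Bfrom true (replicate n 1)

changes-alternating : ∀ n → changes false (alternating n) ≡ n
changes-alternating n = trans (changes-Bfrom false (Composition-ones n)) (length-replicate n)

-- Containing an alternating word depends only on the number of changes, and by `changes-twist` the
-- word witnessing an occurrence has enough of them.
Occurs-Q-alternating : ∀ n u → true∷false ⊆ false ∷ alternating n →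
  Occurs (Q (false ∷ u)) (Q (false ∷ alternating n)) → false ∷ alternating n ⊆ false ∷ u
Occurs-Q-alternating n u ι o = let (i , p , e , σ) = Occurs-Q-Q {alternating n} u ι o in
  refl ∷ alternating-⊆ false n u (≤-trans (≤-reflexive (sym (changes-alternating n)))
    (≤-trans (changes-twist i p _ e) (changes-⊆ false σ)))

-- After an initial `false` the complement needs one change more than the word itself, so containing
-- it implies containing the word and the disjunction collapses.
containing-P-alternating : ∀ n m → 4 ≤ n → containing (P (false ∷ alternating n)) (suc m) ≡ countWords m (subᵇ (alternating n))
containing-P-alternating n m le = trans (containing-P-long m ι (≤-trans le (≤-reflexive (sym (changes-alternating n)))))
  (countWords-cong m λ v _ → T⇔⇒≡ (λ t → ⊆⇒subᵇ (go v (bothᵇ⁻ (false ∷ alternating n) (false ∷ v) t)))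
    λ t → bothᵇ⁺ {false ∷ alternating n} {false ∷ v} (inj₁ (subᵇ⇒⊆ (false ∷ alternating n) (false ∷ v) t)))
  where
  ι : true∷false ⊆ false ∷ alternating n
  ι = true∷false⊆long false {replicate (suc n) 1} (Composition-ones (suc n))
    (≤-trans (m≤n⇒m≤1+n le) (≤-reflexive (sym (length-replicate (suc n)))))
  go : ∀ v → false ∷ alternating n ⊆ false ∷ v ⊎ complement (false ∷ alternating n) ⊆ false ∷ v →
    false ∷ alternating n ⊆ false ∷ v
  go v (inj₁ σ) = σ
  go v (inj₂ σ) = refl ∷ alternating-⊆ false n v (<⇒≤ (subst (_≤ changes false v)
    (trans (cong (changes false) (Bfrom-complement false (replicate (suc n) 1))) (changes-alternating (suc n)))
    (changes-⊆ false σ)))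

containing-Q-alternating : ∀ {x} n → 4 ≤ changes false x → length x ≡ n → 4 ≤ n →
  (∀ u → Occurs (Q (false ∷ u)) (Q (false ∷ x)) → false ∷ x ⊆ false ∷ u) →
  ∀ m → containing (Q (false ∷ x)) (suc m) ≡ containing (P (B (replicate (suc n) 1))) (suc m)
containing-Q-alternating {x} n le len le' criterion m = trans (containing-Q m le criterion)
  (trans (countWords-subᵇ m x (alternating n) (trans len (sym (trans (length-Bfrom true (replicate n 1)) (sum-ones n)))))
  (sym (containing-P-alternating n m le')))
  where
  sum-ones : ∀ n → sum (replicate n 1) ≡ n
  sum-ones zero = refl
  sum-ones (suc n) = cong suc (sum-ones n)

changes-B-tail : ∀ n {ns} → Composition ns → changes false (replicate n false ++ Bfrom true ns) ≡ length ns
changes-B-tail n {ns} c = trans (changes-replicate false n (Bfrom true ns)) (changes-Bfrom false c)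

B4 : ∀ a b c d → B (a ∷ b ∷ c ∷ d ∷ []) ≡ blocks a b c d
B4 a b c d = cong (λ w → replicate a false ++ replicate b true ++ replicate c false ++ w) (++-identityʳ (replicate d true))

blocks-ending : ∀ a b c d → blocks a b c (suc d) ≡ (replicate a false ++ replicate b true ++ replicate c false ++ replicate d true) ++ true ∷ []
blocks-ending a b c d rewrite replicate-snoc d true = sym (trans (++-assoc (replicate a false) _ _)
  (cong (replicate a false ++_) (trans (++-assoc (replicate b true) _ _) (cong (replicate b true ++_)
    (++-assoc (replicate c false) _ _)))))

-- The pattern is also `Q` of the word with the two middle blocks exchanged. That word ends in
-- `true`, so its occurrences in a `Q` are plain subwords; they form the second summand.
containing-P-4 : ∀ a b c d m → Composition (suc a ∷ b ∷ c ∷ d ∷ []) → containing (P (B (suc a ∷ b ∷ c ∷ d ∷ []))) (suc m) ≡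
  countWords m (λ v → bothᵇ (B (suc a ∷ b ∷ c ∷ d ∷ [])) (false ∷ v)) + countTwoDrops (suc a ∷ c ∷ b ∷ d ∷ []) m
containing-P-4 a b c (suc d) m comp@(p ∷ q ∷ r ∷ s ∷ []) = trans (containing-P m (true∷false⊆long false comp (s≤s (s≤s (s≤s (s≤s z≤n))))))
  (cong (countWords m (λ v → bothᵇ (B ks) (false ∷ v)) +_) (countWords-cong m λ u _ → cong (_∧ twoDropsᵇ (false ∷ u))
    (T⇔⇒≡ (λ t → ⊆⇒subᵇ (Occurs-Q-ending-true {y = y} u ι ending
        (subst (Occurs (Q (false ∷ u))) eq (Contains⇒Occurs {Q (false ∷ u)} {P (B ks)} t))))
      (λ t → Occurs⇒Contains {Q (false ∷ u)} {P (B ks)} (λ ()) (subst (Occurs (Q (false ∷ u))) (sym eq)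
        (Occurs-Q⁺ {false ∷ u} {B ls} (subᵇ⇒⊆ (B ls) (false ∷ u) t)))))))
  where
  ks = suc a ∷ b ∷ c ∷ suc d ∷ []
  ls = suc a ∷ c ∷ b ∷ suc d ∷ []
  eq : P (B ks) ≡ Q (B ls)
  eq = trans (cong P (B4 (suc a) b c (suc d))) (trans (P-blocks≡Q-blocks (suc a) b c (suc d)) (cong Q (sym (B4 (suc a) c b (suc d)))))
  ι : true∷false ⊆ B ls
  ι = true∷false⊆long false {ls} (p ∷ r ∷ q ∷ s ∷ []) (s≤s (s≤s (s≤s (s≤s z≤n))))
  y = replicate (suc a) false ++ replicate c true ++ replicate b false ++ replicate d true
  ending : B ls ≡ y ++ true ∷ []
  ending = trans (B4 (suc a) c b (suc d)) (blocks-ending (suc a) c b d)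
containing-P-4 a b c zero m (_ ∷ _ ∷ _ ∷ () ∷ [])

-- From five runs on, only the words for `P` contribute, and these are compared by `≈`. With exactly
-- four runs there is an additional summand, which depends on the total length only.
containing-P-≈ : ∀ ks ls → Composition ks → Composition ls → length ks ≡ length ls → sum ks ≡ sum ls → 4 ≤ length ks →
  B ks ≈ B ls → ∀ m → containing (P (B ks)) (suc m) ≡ containing (P (B ls)) (suc m)
containing-P-≈ [] _ _ _ _ _ () _ _
containing-P-≈ (_ ∷ _) [] _ _ () _ _ _ _
containing-P-≈ (zero ∷ _) _ (() ∷ _) _ _ _ _ _ _
containing-P-≈ (_ ∷ _) (zero ∷ _) _ (() ∷ _) _ _ _ _ _
containing-P-≈ (suc a ∷ ks) (suc a' ∷ ls) ck cl len e le eq m with m≤n⇒m<n∨m≡n le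
... | inj₁ (s≤s 4≤) = trans (containing-P-long m (true∷false⊆long false ck le) (long a ck 4≤)) (trans (≈⇒half m eq)
    (sym (containing-P-long m (true∷false⊆long false cl (subst (4 ≤_) len le))
      (long a' cl (subst (4 ≤_) (suc-injective len) 4≤)))))
  where
  long : ∀ n {j ns} → Composition (j ∷ ns) → 4 ≤ length ns → 4 ≤ changes false (replicate n false ++ Bfrom true ns)
  long n (_ ∷ c) le = ≤-trans le (≤-reflexive (sym (changes-B-tail n c)))
... | inj₂ 4≡ = four ks ls (suc-injective (sym 4≡)) (trans (sym (suc-injective len)) (suc-injective (sym 4≡))) ck cl e eq
  where
  middle : ∀ a b c d → sum (suc a ∷ c ∷ b ∷ d ∷ []) ≡ sum (suc a ∷ b ∷ c ∷ d ∷ [])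
  middle a b c d = cong (suc a +_) (trans (sym (+-assoc c b (d + 0))) (trans (cong (_+ (d + 0)) (+-comm c b)) (+-assoc b c (d + 0))))
  four : ∀ ks ls → length ks ≡ 3 → length ls ≡ 3 → Composition (suc a ∷ ks) → Composition (suc a' ∷ ls) →
    sum (suc a ∷ ks) ≡ sum (suc a' ∷ ls) → B (suc a ∷ ks) ≈ B (suc a' ∷ ls) →
    containing (P (B (suc a ∷ ks))) (suc m) ≡ containing (P (B (suc a' ∷ ls))) (suc m)
  four (b ∷ c ∷ d ∷ []) (b' ∷ c' ∷ d' ∷ []) refl refl ck@(p ∷ q ∷ r ∷ s ∷ []) cl@(p' ∷ q' ∷ r' ∷ s' ∷ []) e eq =
    trans (containing-P-4 a b c d m ck) (trans (cong₂ _+_ (≈⇒half m eq)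
      (countTwoDrops-independent (suc a) (c ∷ b ∷ d ∷ []) (suc a') (c' ∷ b' ∷ d' ∷ []) m (p ∷ r ∷ q ∷ s ∷ [])
        (p' ∷ r' ∷ q' ∷ s' ∷ []) refl refl (trans (middle a b c d) (trans e (sym (middle a' b' c' d'))))))
    (sym (containing-P-4 a' b' c' d' m cl)))

-- As `length rs` is even, the final run `k` consists of `false`. The dual moves it to the front as
-- `true`, and rotating returns it to the end, so in effect only `rs` is reversed.
Q-dual-rotation : ∀ rs k → Even (length rs) → Rotation (Q (dual (B (rs ++ k ∷ [])))) (Q (B (reverse rs ++ k ∷ [])))
Q-dual-rotation rs k ev = subst₂ (λ y z → Rotation (Q y) (Q z)) (sym twisted) (sym untwisted) (Q-rotate k (B (reverse rs)))
  where
  twisted : dual (B (rs ++ k ∷ [])) ≡ replicate k true ++ B (reverse rs)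
  twisted = trans (dual-B (rs ++ k ∷ [])) (cong₂ Bfrom
    (trans (cong (letterAt false) (trans (length-++ rs) (+-comm (length rs) 1))) (letterAt-even true ev))
    (reverse-++ rs (k ∷ [])))
  untwisted : B (reverse rs ++ k ∷ []) ≡ B (reverse rs) ++ replicate k false
  untwisted = trans (Bfrom-snoc false (reverse rs) k) (cong (λ b → B (reverse rs) ++ replicate k b)
    (letterAt-even false (subst Even (sym (length-reverse rs)) ev)))

containing-Q-rc : ∀ rs k n → Even (length rs) → containing (Q (B (rs ++ k ∷ []))) n ≡ containing (Q (B (reverse rs ++ k ∷ []))) n
containing-Q-rc rs k n ev = trans (containing-rc n (Q-permutation (B (rs ++ k ∷ []))))
  (trans (cong (λ xs → containing xs n) (rc-Q (B (rs ++ k ∷ [])))) (containing-rotation n (Q-dual-rotation rs k ev)))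

-- Choosing a form by the number of runs

Form : List ℕ → Set
Form π = Form1 π ⊎ Form2 π ⊎ Form3 π ⊎ Form4 π

Reduces : List ℕ → Set
Reduces σ = Σ (List ℕ) λ τ → Σ (List ℕ) λ π →
  IsRotationOf τ π × Form π × WilfEquiv (p1432 ∷ σ ∷ []) (p1432 ∷ τ ∷ [])

reduces : ∀ {σ} π → 1 ≤ length π → Form π → (∀ m → containing σ (suc m) ≡ containing π (suc m)) → Reduces σ
reduces π le f eq = π , π , (0 , le , sym (++-identityʳ π)) , f , containing⇒WilfEquiv eq

reduces-≡ : ∀ {σ τ} → (∀ m → containing σ (suc m) ≡ containing τ (suc m)) → Reduces τ → Reduces σ
reduces-≡ eq (ρ , π , r , f , w) = ρ , π , r , f , λ n le → trans (containing⇒WilfEquiv eq n le) (w n le)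

P-two-blocks : ∀ a b → P (replicate a false ++ replicate b true) ≡ upTo (a + b)
P-two-blocks a b rewrite positions-++ false 0 (replicate a false) (replicate b true) | positions-++ true 0 (replicate a false) (replicate b true)
  | length-replicate a {false} | positions-replicate false 0 a | positions-replicate-not true 0 a
  | positions-replicate true a b | positions-replicate-not false a b | ++-identityʳ (range 0 a) =
  trans (sym (range-++ 0 a b)) (sym (upTo≡range (a + b)))

Q-two-blocks : ∀ a b → Q (replicate a false ++ replicate b true) ≡ upTo (a + b)
Q-two-blocks a b rewrite count-++ false (replicate a false) (replicate b true) | count-replicate false a
  | count-replicate-not false b | +-identityʳ a | label-++ 0 a (replicate a false) (replicate b true)
  | label-replicate-false 0 a a | label-replicate-true (count false (replicate a false)) (a + count true (replicate a false)) b
  | count-replicate-not true a | +-identityʳ a =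
  trans (sym (range-++ 0 a b)) (sym (upTo≡range (a + b)))

reduces-identity : ∀ n → Reduces (upTo (suc n))
reduces-identity n = reduces (upTo (suc n)) (s≤s z≤n)
  -- The identity is form (1) with `b = c = 0`.
  (inj₁ (suc n , 0 , 0 , z≤n , isG-identity n)) λ _ → refl

length-P-dual : ∀ ns → length (P (dual (B ns))) ≡ sum ns
length-P-dual ns = trans (length-P (dual (B ns))) (trans (length-dual (B ns)) (length-Bfrom false ns))

1≤sum : ∀ {ns} → Composition ns → 1 ≤ length ns → 1 ≤ sum ns
1≤sum {n ∷ ns} (p ∷ _) _ = ≤-trans p (m≤m+n n (sum ns))

-- The representative is `P` of the dual word, which has the runs of `B ns` in reverse order; hence
-- `reverse ns` in the hypothesis.
reduces-to-G : ∀ {σ} ns → Composition ns → 1 ≤ length ns → Form (P (dual (B ns))) →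
  (∀ m → containing σ (suc m) ≡ containing (P (B (reverse ns))) (suc m)) → Reduces σ
reduces-to-G ns c le f eq = reduces (P (dual (B ns))) (subst (1 ≤_) (sym (length-P-dual ns)) (1≤sum c le)) f
  λ m → trans (eq m) (containing-rotation (suc m) (P-dual-rotation ns))

form1-3 : ∀ a b c → Composition (a ∷ b ∷ c ∷ []) → c ≤ a → Form (P (dual (B (a ∷ b ∷ c ∷ []))))
form1-3 (suc a) (suc b) (suc c) comp le = inj₁ (suc a , suc b , suc c , le ,
  subst (λ w → IsG w (P (dual (B ns)))) shape (isG-dual (B ns) refl (≤-reflexive (sym (runs-Bfrom false comp)))
    (subst (true∷false ⊆_) (sym (dual-B ns)) (refl ∷ Sub.++⁺ˡ (replicate c true) (refl ∷ minimum _)))))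
  where
  ns = suc a ∷ suc b ∷ suc c ∷ []
  shape : B ns ≡ replicate (suc a) false ++ replicate (suc b) true ++ replicate (suc c) false
  shape = cong (λ w → replicate (suc a) false ++ replicate (suc b) true ++ w) (++-identityʳ (replicate (suc c) false))
form1-3 zero _ _ (() ∷ _)
form1-3 (suc _) zero _ (_ ∷ () ∷ _)
form1-3 (suc _) (suc _) zero (_ ∷ _ ∷ () ∷ _)

P≡Q-3 : ∀ a b c → P (B (a ∷ b ∷ c ∷ [])) ≡ Q (B (a ∷ c ∷ b ∷ []))
P≡Q-3 a b c = P-blocks≡Q-blocks a b c 0

-- Runs (a, b, c) under `P` are (a, c, b) under `Q`; the reverse-complement symmetry turns these
-- into (c, a, b), which are (c, b, a) under `P`.
containing-P-3 : ∀ a b c n → containing (P (B (a ∷ b ∷ c ∷ []))) n ≡ containing (P (B (c ∷ b ∷ a ∷ []))) n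
containing-P-3 a b c n = trans (cong (λ xs → containing xs n) (P≡Q-3 a b c))
  (trans (containing-Q-rc (a ∷ c ∷ []) b n (1 , refl)) (cong (λ xs → containing xs n) (sym (P≡Q-3 c b a))))

reduces-P-3 : ∀ a b c → Composition (a ∷ b ∷ c ∷ []) → Reduces (P (B (a ∷ b ∷ c ∷ [])))
reduces-P-3 a b c comp@(p ∷ q ∷ r ∷ []) with ≤-total a c
... | inj₁ le = reduces-to-G (c ∷ b ∷ a ∷ []) (r ∷ q ∷ p ∷ []) (s≤s z≤n) (form1-3 c b a (r ∷ q ∷ p ∷ []) le) λ _ → refl
... | inj₂ le = reduces-to-G (a ∷ b ∷ c ∷ []) comp (s≤s z≤n) (form1-3 a b c comp le) λ m → containing-P-3 a b c (suc m)

form2-alternating : ∀ n → 4 ≤ n → Form (P (dual (B (replicate n 1))))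
form2-alternating n le = inj₂ (inj₁ (B (replicate n 1) , ones-Alternating false n ,
  StartsWith0-B (Composition-ones n) (≤-trans (s≤s z≤n) le') , ≤-trans le' (≤-reflexive (sym (runs-Bfrom false (Composition-ones n)))) ,
  isG-B (Composition-ones n) le'))
  where le' = subst (4 ≤_) (sym (length-replicate n)) le

reduces-to-alternating : ∀ {σ} n → 4 ≤ n → (∀ m → containing σ (suc m) ≡ containing (P (B (replicate n 1))) (suc m)) → Reduces σ
reduces-to-alternating n le eq = reduces-to-G (replicate n 1) (Composition-ones n)
  (subst (1 ≤_) (sym (length-replicate n)) (≤-trans (s≤s z≤n) le)) (form2-alternating n le)
  λ m → trans (eq m) (cong (λ ns → containing (P (B ns)) (suc m)) (sym (reverse-replicate n 1)))

↭-length-sum : ∀ {ks ls : List ℕ} → ks ↭ ls → length ks ≡ length ls × sum ks ≡ sum ls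
↭-length-sum p = Perm.↭-length p , sum-↭ p

replicate-+ : ∀ r s → replicate r 1 ++ replicate s 1 ≡ replicate (r + s) 1
replicate-+ zero s = refl
replicate-+ (suc r) s = cong (1 ∷_) (replicate-+ r s)

orient-↭ : ∀ {ns ms : List ℕ} → ms ≡ ns ⊎ ms ≡ reverse ns → ns ↭ ms
orient-↭ (inj₁ refl) = ↭-refl
orient-↭ {ns} (inj₂ refl) = ↭-sym (Perm.↭-reverse ns)

-- The runs of length 1 outside the core are gathered on the right, and the core, whose end runs
-- differ from 1, is reversed if the lexicographic condition asks for it. The comparison is with the
-- reverse of `target` because `G` involves the dual.
reduces-P-core : ∀ s k ls r → Composition (k ∷ ls) → k ≢ 1 → last? (k ∷ ls) ≢ just 1 →
  4 ≤ length (replicate s 1 ++ (k ∷ ls) ++ replicate r 1) → Reduces (P (B (replicate s 1 ++ (k ∷ ls) ++ replicate r 1)))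
reduces-P-core s k ls r c k≢1 l≢1 le with orient (k ∷ ls)
... | ns , choice , lex = reduces-to-G target ct (≤-trans (s≤s z≤n) le')
    (inj₂ (inj₂ (inj₁ (ns , r + s , cn , 1≤n , proj₁ (ends choice) , proj₂ (ends choice) , lex ,
      ≤-trans le' (≤-reflexive (sym (runs-Bfrom false ct))) , isG-B ct le'))))
    (containing-P-≈ source (reverse target) cs (Composition-reverse ct) (proj₁ same) (proj₂ same) le equiv)
  where
  core = k ∷ ls
  source = replicate s 1 ++ core ++ replicate r 1
  target = ns ++ replicate (r + s) 1
  cs : Composition source
  cs = Allₚ.++⁺ (Composition-ones s) (Allₚ.++⁺ c (Composition-ones r))
  cn : Composition ns
  cn = Perm.All-resp-↭ (orient-↭ choice) c
  ct : Composition target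
  ct = Allₚ.++⁺ cn (Composition-ones (r + s))
  1≤n : 1 ≤ length ns
  1≤n = subst (1 ≤_) (Perm.↭-length (orient-↭ choice)) (s≤s z≤n)
  ends : ns ≡ core ⊎ ns ≡ reverse core → head? ns ≢ just 1 × last? ns ≢ just 1
  ends (inj₁ refl) = k≢1 ∘ just-injective , l≢1
  ends (inj₂ refl) = (λ e → l≢1 (trans (sym (head?-reverse core)) e)) ,
    λ e → k≢1 (just-injective (trans (sym (last?-reverse core)) e))
  moved : (core ++ replicate r 1) ++ replicate s 1 ≡ core ++ replicate (r + s) 1
  moved = trans (++-assoc core (replicate r 1) (replicate s 1)) (cong (core ++_) (replicate-+ r s))
  source↭target : source ↭ target
  source↭target = ↭-trans (Perm.++-comm (replicate s 1) (core ++ replicate r 1))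
    (↭-trans (↭-reflexive moved) (Perm.++⁺ʳ (replicate (r + s) 1) (orient-↭ choice)))
  le' : 4 ≤ length target
  le' = subst (4 ≤_) (Perm.↭-length source↭target) le
  same : length source ≡ length (reverse target) × sum source ≡ sum (reverse target)
  same = ↭-length-sum (↭-trans source↭target (↭-sym (Perm.↭-reverse target)))
  oriented : ns ≡ core ⊎ ns ≡ reverse core → B (core ++ replicate (r + s) 1) ≈ B target
  oriented (inj₁ refl) = ≈-reflexive refl
  oriented (inj₂ refl) = ≈-sym (≈-B-reverse-core k ls (r + s) c)
  equiv : B source ≈ B (reverse target)
  equiv = ≈-trans (≈-B-move s k (ls ++ replicate r 1) (Allₚ.++⁺ c (Composition-ones r)))
    (≈-trans (≈-reflexive (cong B moved)) (≈-trans (oriented choice) (≈-sym (≈-B-reverse target))))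

reduces-P-long : ∀ ks → Composition ks → 4 ≤ length ks → Reduces (P (B ks))
reduces-P-long ks c le with strip-ones ks
... | inj₁ e = subst (Reduces ∘ P ∘ B) (sym e) (reduces-to-alternating (length ks) le λ _ → refl)
... | inj₂ (s , k , ls , r , refl , k≢1 , l≢1) =
  reduces-P-core s k ls r (Allₚ.++⁻ˡ (k ∷ ls) (Allₚ.++⁻ʳ (replicate s 1) c)) k≢1 l≢1 le

reduces-P : ∀ n ns → Composition (suc n ∷ ns) → Reduces (P (B (suc n ∷ ns)))
reduces-P n [] c = subst Reduces (sym (P-two-blocks (suc n) 0)) (reduces-identity (n + 0))
reduces-P n (k ∷ []) c = subst Reduces (sym (trans (cong (λ w → P (replicate (suc n) false ++ w)) (++-identityʳ (replicate k true)))
  (P-two-blocks (suc n) k))) (reduces-identity (n + k))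
reduces-P n (k ∷ l ∷ []) c = reduces-P-3 (suc n) k l c
reduces-P n ns@(_ ∷ _ ∷ _ ∷ _) c = reduces-P-long (suc n ∷ ns) c (s≤s (s≤s (s≤s (s≤s z≤n))))

-- If `orient` keeps `rs`, the dual reverses it and `containing-Q-rc` compensates; if `orient`
-- reverses `rs`, the dual restores it. The last run `k` stays in place as the `m` of form (4).
reduces-to-IG : ∀ rs k → Composition (rs ++ k ∷ []) → Even (length rs) → 5 ≤ length (rs ++ k ∷ []) →
  (Alternating (B (rs ++ k ∷ [])) → ⊥) → Reduces (Q (B (rs ++ k ∷ [])))
reduces-to-IG rs k c ev le ¬alt with orient rs
... | ns , choice , lex = reduces (Q (dual w)) 1≤ (inj₂ (inj₂ (inj₂
    (ns , k , Allₚ.++⁻ˡ ns ct , ev' , 1≤k , ¬alt' , ≤-trans le' (≤-reflexive (sym (runs-Bfrom false ct))) , lex ,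
      isIG-dual w (isG-B ct (≤-trans (n≤1+n 4) le'))))))
    λ m → trans (same choice m) (sym (containing-rotation (suc m) (Q-dual-rotation ns k ev')))
  where
  w = B (ns ++ k ∷ [])
  perm : rs ++ k ∷ [] ↭ ns ++ k ∷ []
  perm = Perm.++⁺ʳ (k ∷ []) (orient-↭ choice)
  ct : Composition (ns ++ k ∷ [])
  ct = Perm.All-resp-↭ perm c
  1≤k : 1 ≤ k
  1≤k = All.lookup c (∈-++⁺ʳ rs (here refl))
  ev' : Even (length ns)
  ev' = subst Even (Perm.↭-length (orient-↭ choice)) ev
  le' : 5 ≤ length (ns ++ k ∷ [])
  le' = subst (5 ≤_) (Perm.↭-length perm) le
  1≤ : 1 ≤ length (Q (dual w))
  1≤ = subst (1 ≤_) (sym (trans (length-Q (dual w)) (trans (length-dual w) (length-Bfrom false (ns ++ k ∷ [])))))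
    (1≤sum ct (≤-trans (s≤s z≤n) le'))
  -- A word is alternating when all its runs have length 1, and reordering the runs does not affect
  -- this.
  ¬alt' : Alternating w → ⊥
  ¬alt' alt = ¬alt (subst (Alternating ∘ B) (sym ones) (ones-Alternating false (length (rs ++ k ∷ []))))
    where
    all-ones : All (_≡ 1) (ns ++ k ∷ [])
    all-ones = subst (All (_≡ 1)) (sym (Alternating⇒ones false ct alt)) (Allₚ.replicate⁺ _ refl)
    ones : rs ++ k ∷ [] ≡ replicate (length (rs ++ k ∷ [])) 1
    ones = All-≡⇒replicate (Perm.All-resp-↭ (↭-sym perm) all-ones)
      where
      All-≡⇒replicate : ∀ {xs} → All (_≡ 1) xs → xs ≡ replicate (length xs) 1
      All-≡⇒replicate [] = refl
      All-≡⇒replicate (refl ∷ al) = cong (1 ∷_) (All-≡⇒replicate al)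
  same : ns ≡ rs ⊎ ns ≡ reverse rs → ∀ m → containing (Q (B (rs ++ k ∷ []))) (suc m) ≡ containing (Q (B (reverse ns ++ k ∷ []))) (suc m)
  same (inj₁ refl) m = containing-Q-rc rs k (suc m) ev
  same (inj₂ refl) m = cong (λ ls → containing (Q (B (ls ++ k ∷ []))) (suc m)) (sym (reverse-involutive rs))

changes-≤-length : ∀ b v → changes b v ≤ length v
changes-≤-length b [] = z≤n
changes-≤-length b (c ∷ v) with b ==ᵇ c
... | true = m≤n⇒m≤1+n (changes-≤-length c v)
... | false = s≤s (changes-≤-length c v)

-- When only plain subwords give occurrences, the count depends on the length alone, so the
-- alternating word of the same length serves.
reduces-Q-rigid : ∀ x → 4 ≤ changes false x →
  (∀ u → Occurs (Q (false ∷ u)) (Q (false ∷ x)) → false ∷ x ⊆ false ∷ u) → Reduces (Q (false ∷ x))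
reduces-Q-rigid x le criterion = reduces-to-alternating (suc (length x)) (m≤n⇒m≤1+n le')
  (containing-Q-alternating (length x) le refl le' criterion)
  where le' = ≤-trans le (changes-≤-length false x)

-- The parity of the number of runs decides the last letter. An even number ends in `true` and is
-- rigid; an odd number ends in `false`, which is rigid if all runs have length 1 and gives form (4)
-- otherwise.
reduces-Q-long : ∀ n ks → Composition (suc n ∷ ks) → 4 ≤ length ks → Reduces (Q (B (suc n ∷ ks)))
reduces-Q-long n ks comp@(_ ∷ c) le with initLast (suc n) ks
... | rs , k , e with parity (length rs) | strip-ones (suc n ∷ ks)
... | inj₁ ev | inj₁ ones = subst (Reduces ∘ Q ∘ B) (sym ones) (reduces-Q-rigid (alternating (length ks))
    (≤-trans le (≤-reflexive (sym (changes-alternating (length ks)))))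
    λ u → Occurs-Q-alternating (length ks) u (true∷false⊆long false (Composition-ones (suc (length ks)))
      (≤-trans (m≤n⇒m≤1+n le) (≤-reflexive (sym (length-replicate (suc (length ks))))))))
... | inj₁ ev | inj₂ (s , j , ls , r , e' , j≢1 , _) = subst (Reduces ∘ Q ∘ B) (sym e)
    (reduces-to-IG rs k (subst Composition e comp) ev (subst (λ ms → 5 ≤ length ms) e (s≤s le)) λ alt →
      j≢1 (All.lookup (subst (All (_≡ 1)) (sym (Alternating⇒ones false comp (subst (Alternating ∘ B) (sym e) alt)))
        (Allₚ.replicate⁺ _ refl)) (subst (j ∈_) (sym e') (∈-++⁺ʳ (replicate s 1) (here refl)))))
... | inj₂ (h , odd) | _ = reduces-Q-rigid _ (≤-trans le (≤-reflexive (sym (changes-B-tail n c))))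
    λ u → Occurs-Q-ending-true u (true∷false⊆long false comp (m≤n⇒m≤1+n le)) (ending k (subst Composition e comp) e)
  where
  ending : ∀ k → Composition (rs ++ k ∷ []) → suc n ∷ ks ≡ rs ++ k ∷ [] → B (suc n ∷ ks) ≡ (B rs ++ replicate (pred k) true) ++ true ∷ []
  ending zero c' e with All.lookup c' (∈-++⁺ʳ rs (here refl))
  ... | ()
  ending (suc k) c' e = trans (cong B e) (trans (Bfrom-snoc false rs (suc k)) (trans
    (cong (B rs ++_) (trans (cong (replicate (suc k)) last-letter) (replicate-snoc k true)))
    (sym (++-assoc (B rs) (replicate k true) (true ∷ [])))))
    where
    last-letter : letterAt false (length rs) ≡ true
    last-letter = trans (cong (letterAt false) odd) (letterAt-even true (h , refl))

-- Up to four runs give nothing new: one or two runs give the identity, three or four runs a `P`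
-- with the second and third run exchanged.
reduces-Q : ∀ n ns → Composition (suc n ∷ ns) → Reduces (Q (B (suc n ∷ ns)))
reduces-Q n [] c = subst Reduces (sym (Q-two-blocks (suc n) 0)) (reduces-identity (n + 0))
reduces-Q n (k ∷ []) c = subst Reduces (sym (trans (cong (λ w → Q (replicate (suc n) false ++ w)) (++-identityʳ (replicate k true)))
  (Q-two-blocks (suc n) k))) (reduces-identity (n + k))
reduces-Q n (k ∷ l ∷ []) (p ∷ q ∷ r ∷ []) = subst Reduces (P≡Q-3 (suc n) l k) (reduces-P-3 (suc n) l k (p ∷ r ∷ q ∷ []))
reduces-Q n (k ∷ l ∷ m ∷ []) (p ∷ q ∷ r ∷ s ∷ []) = subst Reduces
  (trans (cong P (B4 (suc n) l k m)) (trans (P-blocks≡Q-blocks (suc n) l k m) (cong Q (sym (B4 (suc n) k l m)))))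
  (reduces-P-long (suc n ∷ l ∷ k ∷ m ∷ []) (p ∷ r ∷ q ∷ s ∷ []) (s≤s (s≤s (s≤s (s≤s z≤n)))))
reduces-Q n ns@(_ ∷ _ ∷ _ ∷ _ ∷ _) c = reduces-Q-long n ns c (s≤s (s≤s (s≤s (s≤s z≤n))))

reduces-canonical : ∀ {σ} → Canonical σ → Reduces σ
reduces-canonical {σ} (canonical p h av) with classify p h av
... | inj₁ (v , refl) with word-composition false v
... | n , ns , e , c = subst (Reduces ∘ P) (sym e) (reduces-P n ns (s≤s z≤n ∷ c))
reduces-canonical {σ} (canonical p h av) | inj₂ (u , refl) with word-composition false u
... | n , ns , e , c = subst (Reduces ∘ Q) (sym e) (reduces-Q n ns (s≤s z≤n ∷ c))

-- The empty list passes as a permutation but cannot be a rotation `τ` of `π`, which needs a shift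
-- below the length. Every nonempty permutation contains both patterns, so the one-point permutation
-- replaces it.
containing-[] : ∀ m → containing [] (suc m) ≡ containing (0 ∷ []) (suc m)
containing-[] m = countCanonical-cong (suc m) λ {xs} c →
  (λ _ → Contains⁺ (nonempty c) Rotation-refl (embeds ((0 , 0) ∷ []) (sorted-OrderIso ([] ∷ [])) (single xs (from-0 c)) refl)) ,
  (λ _ → Contains⁺ (nonempty c) Rotation-refl (embeds [] (λ ()) (minimum xs) refl))
  where
  single : ∀ xs → head? xs ≡ just 0 → 0 ∷ [] ⊆ xs
  single (x ∷ xs) refl = refl ∷ minimum xs

canonical-rotation : ∀ {σ} → σ ≢ [] → Permutation σ → Avoids σ p1432 → ∃[ ρ ] (Rotation σ ρ × Canonical ρ)
canonical-rotation {σ} ne p av = from-rotation (rotation-from-0 (covers p (nonempty-length ne)))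
  where
  from-rotation : ∃[ ρ ] (Rotation σ ρ × head? ρ ≡ just 0) → ∃[ ρ ] (Rotation σ ρ × Canonical ρ)
  from-rotation (ρ , r , h) = ρ , r , canonical (Permutation-resp-↭ (Rotation⇒↭ r) p) h
    λ c → T-not⇒¬T {containsᵇ σ p1432} av (Contains-rotate {σ} {ρ} {p1432} ne r c)

reduces-nonempty : ∀ {σ} → σ ≢ [] → Permutation σ → Avoids σ p1432 → Reduces σ
reduces-nonempty ne p av = let (ρ , r , c) = canonical-rotation ne p av in
  reduces-≡ (λ m → containing-rotation (suc m) r) (reduces-canonical c)

theorem5p22 : (σ : List ℕ) → IsPerm σ → Avoids σ p1432 →
    Σ (List ℕ) λ τ → Σ (List ℕ) λ π →
    IsRotationOf τ π × (Form1 π ⊎ Form2 π ⊎ Form3 π ⊎ Form4 π) ×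
    WilfEquiv (p1432 ∷ σ ∷ []) (p1432 ∷ τ ∷ [])
theorem5p22 [] _ _ = reduces-≡ {τ = 0 ∷ []} containing-[] (reduces-identity 0)
theorem5p22 (x ∷ xs) p av = reduces-nonempty (λ ()) (IsPerm⇒Permutation (x ∷ xs) p) av
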